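{- In the language of second-order arithmetic, let $\exists X\,\forall Y\,\Psi(X,Y)$ be a $\Sigma^1_2$ sentence such that $\Psi(X,Y)$ is a $\Pi^0_3$ formula. If $\mathrm{RCA}_0 + \mathrm{B}\Sigma^0_2 + \exists X\,\forall Y\,\Psi(X,Y)$ is consistent, then $\mathrm{RCA}_0 + \mathrm{B}\Sigma^0_2 + \exists X\,\forall Y\,\Psi(X,Y)$ does not prove $\mathrm{I}\Sigma^0_2$.
   Context: $\mathrm{RCA}_0$ is the standard base system of reverse mathematics (basic arithmetic axioms, $\Delta^0_1$ comprehension, and $\Sigma^0_1$ induction). For a $\Sigma^0_k$ formula $\Phi$ (possibly with free number and set variables), $\mathrm{I}\Sigma^0_k$ is the scheme of universal closures of $(\Phi(0)\land\forall i\,(\Phi(i)\Rightarrow\Phi(i+1)))\Rightarrow\forall i\,\Phi(i)$, and $\mathrm{B}\Sigma^0_k$ is the scheme of universal closures of $(\forall i\,\exists j\,\Phi(i,j))\Rightarrow\forall m\,\exists n\,(\forall i<m)\,(\exists j<n)\,\Phi(i,j)$. -}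

module Defs where

-- Syntax, classification and a Hilbert-style proof calculus for
-- (two-sorted, classical, first-order) second-order arithmetic in the
-- language {0, 1, +, ·, <, =, ∈}.  Variables are de Bruijn indices;
-- number variables and set variables are indexed separately.

open import Data.Nat using (ℕ; zero; suc; _<_; _+_)
open import Data.Sum using (_⊎_)
open import Data.Empty using (⊥)
open import Data.Unit using (⊤)
open import Data.Product using (_×_)
open import Relation.Nullary using (¬_)
open import Relation.Binary.PropositionalEquality using (_≡_)

infixl 8 _⊕_
infixl 9 _⊗_
infix 6 _≐_ _≺_ _∈'_
infixr 4 _⇒_
infixr 5 _∧'_ _∨'_
infix 4 _⇔_
infix 2 _⊢_

data Tm : Set where
  var : ℕ → Tm
  zer : Tm
  one : Tm
  _⊕_ : Tm → Tm → Tm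
  _⊗_ : Tm → Tm → Tm

-- Formulas. Primitive connectives: ⊥, →, number ∀, set ∀.
-- (t ∈' X) : X is a set variable (de Bruijn index).
data Fm : Set where
  ⊥'   : Fm
  _≐_  : Tm → Tm → Fm
  _≺_  : Tm → Tm → Fm
  _∈'_ : Tm → ℕ → Fm
  _⇒_  : Fm → Fm → Fm
  ∀ⁿ   : Fm → Fm
  ∀ˢ   : Fm → Fm

¬' : Fm → Fm
¬' φ = φ ⇒ ⊥'

_∧'_ : Fm → Fm → Fm
φ ∧' ψ = ¬' (φ ⇒ ¬' ψ)

_∨'_ : Fm → Fm → Fm
φ ∨' ψ = ¬' φ ⇒ ψ

_⇔_ : Fm → Fm → Fm
φ ⇔ ψ = (φ ⇒ ψ) ∧' (ψ ⇒ φ)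

∃ⁿ : Fm → Fm
∃ⁿ φ = ¬' (∀ⁿ (¬' φ))

∃ˢ : Fm → Fm
∃ˢ φ = ¬' (∀ˢ (¬' φ))

substT : (ℕ → Tm) → Tm → Tm
substT σ (var n) = σ n
substT σ zer = zer
substT σ one = one
substT σ (s ⊕ t) = substT σ s ⊕ substT σ t
substT σ (s ⊗ t) = substT σ s ⊗ substT σ t

wkT : Tm → Tm
wkT = substT (λ n → var (suc n))

liftσ : (ℕ → Tm) → ℕ → Tm
liftσ σ zero = var zero
liftσ σ (suc n) = wkT (σ n)

substN : (ℕ → Tm) → Fm → Fm
substN σ ⊥' = ⊥'
substN σ (s ≐ t) = substT σ s ≐ substT σ t
substN σ (s ≺ t) = substT σ s ≺ substT σ t
substN σ (t ∈' X) = substT σ t ∈' X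
substN σ (φ ⇒ ψ) = substN σ φ ⇒ substN σ ψ
substN σ (∀ⁿ φ) = ∀ⁿ (substN (liftσ σ) φ)
substN σ (∀ˢ φ) = ∀ˢ (substN σ φ)

liftρ : (ℕ → ℕ) → ℕ → ℕ
liftρ ρ zero = zero
liftρ ρ (suc n) = suc (ρ n)

renS : (ℕ → ℕ) → Fm → Fm
renS ρ ⊥' = ⊥'
renS ρ (s ≐ t) = s ≐ t
renS ρ (s ≺ t) = s ≺ t
renS ρ (t ∈' X) = t ∈' ρ X
renS ρ (φ ⇒ ψ) = renS ρ φ ⇒ renS ρ ψ
renS ρ (∀ⁿ φ) = ∀ⁿ (renS ρ φ)
renS ρ (∀ˢ φ) = ∀ˢ (renS (liftρ ρ) φ)

wkN : Fm → Fm
wkN = substN (λ n → var (suc n))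

wkS : Fm → Fm
wkS = renS suc

instσ : Tm → ℕ → Tm
instσ t zero = t
instσ t (suc n) = var n

inst : Tm → Fm → Fm
inst t = substN (instσ t)

instρ : ℕ → ℕ → ℕ
instρ Y zero = Y
instρ Y (suc n) = n

instS : ℕ → Fm → Fm
instS Y = renS (instρ Y)

NumBoundT : ℕ → Tm → Set
NumBoundT d (var n) = n < d
NumBoundT d zer = ⊤
NumBoundT d one = ⊤
NumBoundT d (s ⊕ t) = NumBoundT d s × NumBoundT d t
NumBoundT d (s ⊗ t) = NumBoundT d s × NumBoundT d t

NumBound : ℕ → Fm → Set
NumBound d ⊥' = ⊤
NumBound d (s ≐ t) = NumBoundT d s × NumBoundT d t
NumBound d (s ≺ t) = NumBoundT d s × NumBoundT d t
NumBound d (t ∈' X) = NumBoundT d t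
NumBound d (φ ⇒ ψ) = NumBound d φ × NumBound d ψ
NumBound d (∀ⁿ φ) = NumBound (suc d) φ
NumBound d (∀ˢ φ) = NumBound d φ

SetBound : ℕ → Fm → Set
SetBound d ⊥' = ⊤
SetBound d (s ≐ t) = ⊤
SetBound d (s ≺ t) = ⊤
SetBound d (t ∈' X) = X < d
SetBound d (φ ⇒ ψ) = SetBound d φ × SetBound d ψ
SetBound d (∀ⁿ φ) = SetBound d φ
SetBound d (∀ˢ φ) = SetBound (suc d) φ

data Δ₀ : Fm → Set where
  d⊥   : Δ₀ ⊥'
  d≐   : ∀ s t → Δ₀ (s ≐ t)
  d≺   : ∀ s t → Δ₀ (s ≺ t)
  d∈   : ∀ t X → Δ₀ (t ∈' X)
  d⇒   : ∀ {φ ψ} → Δ₀ φ → Δ₀ ψ → Δ₀ (φ ⇒ ψ)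
  d∀<  : ∀ t {φ} → Δ₀ φ → Δ₀ (∀ⁿ ((var zero ≺ wkT t) ⇒ φ))

mutual
  data Σ⁰ : ℕ → Fm → Set where
    s0  : ∀ {φ} → Δ₀ φ → Σ⁰ zero φ
    sΠ  : ∀ {k φ} → Π⁰ k φ → Σ⁰ (suc k) φ
    s∃  : ∀ {k φ} → Σ⁰ (suc k) φ → Σ⁰ (suc k) (∃ⁿ φ)

  data Π⁰ : ℕ → Fm → Set where
    p0  : ∀ {φ} → Δ₀ φ → Π⁰ zero φ
    pΣ  : ∀ {k φ} → Σ⁰ k φ → Π⁰ (suc k) φ
    p∀  : ∀ {k φ} → Π⁰ (suc k) φ → Π⁰ (suc k) (∀ⁿ φ)

-- Theories and provability.
-- A theory is a set of formulas; a formula with free variables counts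
-- as (and is used as) its universal closure.

Theory : Set₁
Theory = Fm → Set

_∪ᵀ_ : Theory → Theory → Theory
(T ∪ᵀ U) φ = T φ ⊎ U φ

｛_｝ : Fm → Theory
｛ σ ｝ φ = φ ≡ σ

private
  v0 v1 v2 : Tm
  v0 = var 0
  v1 = var 1
  v2 = var 2

data _⊢_ (T : Theory) : Fm → Set where
  ax    : ∀ {φ} → T φ → T ⊢ φ
  mp    : ∀ {φ ψ} → T ⊢ φ ⇒ ψ → T ⊢ φ → T ⊢ ψ
  axK   : ∀ {φ ψ} → T ⊢ φ ⇒ ψ ⇒ φ
  axS   : ∀ {φ ψ χ} → T ⊢ (φ ⇒ ψ ⇒ χ) ⇒ (φ ⇒ ψ) ⇒ φ ⇒ χ
  axDN  : ∀ {φ} → T ⊢ ¬' (¬' φ) ⇒ φ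
  gen   : ∀ {φ} → T ⊢ φ → T ⊢ ∀ⁿ φ
  ∀elim : ∀ {φ} t → T ⊢ ∀ⁿ φ ⇒ inst t φ
  ∀dist : ∀ {φ ψ} → T ⊢ ∀ⁿ (wkN ψ ⇒ φ) ⇒ ψ ⇒ ∀ⁿ φ
  genS   : ∀ {φ} → T ⊢ φ → T ⊢ ∀ˢ φ
  ∀ˢelim : ∀ {φ} Y → T ⊢ ∀ˢ φ ⇒ instS Y φ
  ∀ˢdist : ∀ {φ ψ} → T ⊢ ∀ˢ (wkS ψ ⇒ φ) ⇒ ψ ⇒ ∀ˢ φ
  eqRefl  : T ⊢ v0 ≐ v0
  eqEuc   : T ⊢ v0 ≐ v1 ⇒ v0 ≐ v2 ⇒ v1 ≐ v2
  eq⊕l    : T ⊢ v0 ≐ v1 ⇒ v0 ⊕ v2 ≐ v1 ⊕ v2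
  eq⊕r    : T ⊢ v0 ≐ v1 ⇒ v2 ⊕ v0 ≐ v2 ⊕ v1
  eq⊗l    : T ⊢ v0 ≐ v1 ⇒ v0 ⊗ v2 ≐ v1 ⊗ v2
  eq⊗r    : T ⊢ v0 ≐ v1 ⇒ v2 ⊗ v0 ≐ v2 ⊗ v1
  eq≺l    : T ⊢ v0 ≐ v1 ⇒ v0 ≺ v2 ⇒ v1 ≺ v2
  eq≺r    : T ⊢ v0 ≐ v1 ⇒ v2 ≺ v0 ⇒ v2 ≺ v1
  eq∈     : T ⊢ v0 ≐ v1 ⇒ v0 ∈' 0 ⇒ v1 ∈' 0

Consistent : Theory → Set
Consistent T = ¬ (T ⊢ ⊥')

-- basic axioms (Simpson, Definition I.2.4)
data Basic : Fm → Set where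
  b1 : Basic (¬' (v0 ⊕ one ≐ zer))
  b2 : Basic (v0 ⊕ one ≐ v1 ⊕ one ⇒ v0 ≐ v1)
  b3 : Basic (v0 ⊕ zer ≐ v0)
  b4 : Basic (v0 ⊕ (v1 ⊕ one) ≐ (v0 ⊕ v1) ⊕ one)
  b5 : Basic (v0 ⊗ zer ≐ zer)
  b6 : Basic (v0 ⊗ (v1 ⊕ one) ≐ (v0 ⊗ v1) ⊕ v0)
  b7 : Basic (¬' (v0 ≺ zer))
  b8 : Basic ((v0 ≺ v1 ⊕ one) ⇔ (v0 ≺ v1 ∨' v0 ≐ v1))

succσ : ℕ → Tm
succσ zero = var zero ⊕ one
succσ (suc n) = var (suc n)

-- induction instance for φ(i), i = number variable 0, other free
-- variables (number and set) are parameters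
indAx : Fm → Fm
indAx φ = (inst zer φ ∧' ∀ⁿ (φ ⇒ substN succσ φ)) ⇒ ∀ⁿ φ

data IΣ⁰ (k : ℕ) : Fm → Set where
  ind : ∀ {φ} → Σ⁰ k φ → IΣ⁰ k (indAx φ)

-- bounding instance for Φ(i,j), j = number variable 0, i = 1,
-- remaining free variables are parameters:
-- (∀i ∃j Φ) → ∀m ∃n (∀i<m)(∃j<n) Φ
bndρ : ℕ → Tm
bndρ zero = var 0
bndρ (suc zero) = var 1
bndρ (suc (suc k)) = var (suc (suc (suc (suc k))))

bndAx : Fm → Fm
bndAx Φ =
  ∀ⁿ (∃ⁿ Φ) ⇒
  ∀ⁿ (∃ⁿ (∀ⁿ (v0 ≺ v2 ⇒ ∃ⁿ (v0 ≺ v2 ∧' substN bndρ Φ))))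

data BΣ⁰ (k : ℕ) : Fm → Set where
  bnd : ∀ {Φ} → Σ⁰ k Φ → BΣ⁰ k (bndAx Φ)

-- Δ⁰₁ comprehension: ∀n(φ(n) ↔ ψ(n)) → ∃X ∀n(n ∈ X ↔ φ(n)),
-- φ ∈ Σ⁰₁, ψ ∈ Π⁰₁, X not free in φ (ensured by wkS)
compAx : Fm → Fm → Fm
compAx φ ψ = ∀ⁿ (φ ⇔ ψ) ⇒ ∃ˢ (∀ⁿ (v0 ∈' 0 ⇔ wkS φ))

data Δ⁰₁CA : Fm → Set where
  comp : ∀ {φ ψ} → Σ⁰ 1 φ → Π⁰ 1 ψ → Δ⁰₁CA (compAx φ ψ)

RCA₀ : Theory
RCA₀ = (Basic ∪ᵀ IΣ⁰ 1) ∪ᵀ Δ⁰₁CA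

ProvesScheme : Theory → Theory → Set
ProvesScheme T S = ∀ φ → S φ → T ⊢ φ

{-# OPTIONS --safe #-}
module Submission where

-- If T = RCA₀ + BΣ⁰₂ + ∃X∀YΨ proves IΣ⁰₂, every model M of T satisfies IΣ⁰₂.  Fix A
-- with ∀YΨ(A,Y) in M.  A recursion along finite sets yields a set B with columns
-- B_0 = {c}, B_1, B_2, …, where B_{i+1} adds to B_i the stages at which candidates
-- for the witnesses of finitely many true Π⁰₃ statements ∀x∃u∀z X(x,u,z) in A, B
-- are refuted; the columns are bounded by IΣ⁰₂ and BΣ⁰₂.  By compactness there are
-- M and B with c nonstandard that work for all relevant X at once.  Let J be the cut
-- generated by the columns of standard index, with the sets that are Δ⁰₁ in A and B
-- over J.  The statements X make J Σ⁰₁-elementary in M, whence IΣ⁰₁ and BΣ⁰₂ hold in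
-- J, and make Ψ(A,Y) true there: X says of an index for Y that it is undefined at
-- some n < u or that Ψ has its witness below u.  In J the column B_i is bounded
-- exactly for standard i, so IΣ⁰₂ fails.
--
-- The argument is constructive because satisfaction of negative formulas is
-- ¬¬-stable; classical existence is ∃ᶜ = ¬¬ Σ.

open import Defs
open import Relation.Nullary using (¬_) renaming (yes to yesᵈ; no to noᵈ)
open import Algebra.Bundles using (CommutativeSemiring)
open import Data.Bool using (Bool; true; false)
open import Data.Empty using (⊥; ⊥-elim)
open import Data.Fin using (Fin; zero; suc; toℕ; _↑ˡ_; _↑ʳ_; splitAt)
open import Data.Fin.Properties using (splitAt-↑ˡ; splitAt-↑ʳ; toℕ<n)
open import Data.List using (List; []; _∷_; _++_)
open import Data.List.Membership.Propositional using () renaming (_∈_ to _∈ˡ_)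
open import Data.List.Relation.Unary.All using (All; []; _∷_) renaming (map to mapAll)
open import Data.List.Relation.Unary.All.Properties using (++⁻ˡ; ++⁻ʳ)
open import Data.List.Relation.Unary.Any using (here; there)
open import Data.Nat using (ℕ; zero; suc; z≤n; s≤s; _⊔_) renaming (_+_ to _+ℕ_; _<_ to _<ℕ_; _≤_ to _≤ℕ_)
import Data.Nat.Properties as ℕₚ
open import Data.Product using (Σ; _×_; _,_; proj₁; proj₂)
open import Data.Sum using (_⊎_; inj₁; inj₂; [_,_]′)
open import Data.Unit using (⊤; tt)
open import Data.Vec using (Vec; []; _∷_; lookup; map)
open import Data.Vec.Properties using (lookup-map)
open import Level using (0ℓ)
open import Relation.Binary.Bundles using (Setoid)
open import Relation.Binary.PropositionalEquality using (_≡_; refl; sym; trans; cong; cong₂; subst; subst₂)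


-- The main obstacle is self-reference. B witnesses the failure of IΣ⁰₂ in J, so B must be a set of
-- J, and J must be elementary for formulas that mention B while B is being built. The recursion is
-- well-founded because a refutation counts at stage w only if its queries to B lie below w.
-- Boundedness rests on monotonicity: every X is monotone in u, so only candidates below a true
-- witness are ever refuted. Conversely, a column in which every candidate is refuted would be
-- unbounded, since each refutation puts a larger stage into the same column; so some candidate is a
-- witness. A second obstacle is that a Δ⁰₁ definition over J need not define a set of M, so
-- ∀YΨ(A,Y) cannot be applied directly to the sets of J. The disjuncts "undefined or contradictory"
-- cover the definitions that fail in M; for a set of J they are false once z is large in J, which
-- leaves the disjunct about Ψ. The squares make J closed under sum and product. Two term models are
-- used: the first supplies A and shows, with standard c, that finitely many requirements hold
-- together; the second realises all of them with c nonstandard.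

-- Stable propositions and double-negated existence

Stable : Set → Set
Stable A = ¬ ¬ A → A

infix 1 _⟺_
_⟺_ : Set → Set → Set
A ⟺ B = (A → B) × (B → A)

⟺-refl : ∀ {A} → A ⟺ A
⟺-refl = (λ x → x) , (λ x → x)

⟺-sym : ∀ {A B} → A ⟺ B → B ⟺ A
⟺-sym (f , g) = g , f

⟺-trans : ∀ {A B C} → A ⟺ B → B ⟺ C → A ⟺ C
⟺-trans (f , g) (f' , g') = (λ x → f' (f x)) , (λ x → g (g' x))

→-cong : ∀ {A B A' B' : Set} → A ⟺ A' → B ⟺ B' → (A → B) ⟺ (A' → B')
→-cong (f , g) (h , k) = (λ u x → h (u (g x))) , (λ u x → k (u (f x)))

Π-cong : ∀ {X : Set} {A B : X → Set} → (∀ x → A x ⟺ B x) → (∀ x → A x) ⟺ (∀ x → B x)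
Π-cong h = (λ u x → proj₁ (h x) (u x)) , (λ u x → proj₂ (h x) (u x))

¬-cong : ∀ {A B : Set} → A ⟺ B → (¬ A) ⟺ (¬ B)
¬-cong e = →-cong e ⟺-refl

em : ∀ {P Q : Set} → Stable Q → (P → Q) → (¬ P → Q) → Q
em st f g = st λ nq → nq (g λ p → nq (f p))

×-stable : ∀ {A B} → Stable A → Stable B → Stable (A × B)
×-stable sa sb nn = sa (λ na → nn (λ p → na (proj₁ p))) , sb (λ nb → nn (λ p → nb (proj₂ p)))

→-stable : ∀ {A B : Set} → Stable B → Stable (A → B)
→-stable sb nn a = sb λ nb → nn λ f → nb (f a)

Π-stable : ∀ {X : Set} {B : X → Set} → (∀ x → Stable (B x)) → Stable (∀ x → B x)
Π-stable sb nn a = sb a λ nb → nn λ f → nb (f a)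

¬-stable : ∀ {A : Set} → Stable (¬ A)
¬-stable nn a = nn λ f → f a

∃ᶜ : {X : Set} → (X → Set) → Set
∃ᶜ P = ¬ ¬ (Σ _ P)

infixl 1 _>>=_
_>>=_ : ∀ {A B : Set} → ¬ ¬ A → (A → ¬ ¬ B) → ¬ ¬ B
(m >>= f) k = m λ a → f a k

return : ∀ {A : Set} → A → ¬ ¬ A
return a k = k a

lem : ∀ {A : Set} → ¬ ¬ (A ⊎ ¬ A)
lem k = k (inj₂ λ a → k (inj₁ a))

infixr 5 _◂_
_◂_ : {A : Set} → A → (ℕ → A) → ℕ → A
(a ◂ f) zero = a
(a ◂ f) (suc n) = f n

-- Classical models and soundness

-- Equality is a congruence rather than identity, and atoms are stable rather than decidable: a term
-- model whose atoms are provability statements offers no more.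
record Model : Set₁ where
  infix 4 _≈_ _<_ _∈_
  infixl 6 _+_
  infixl 7 _*_
  field
    D S : Set
    _≈_ _<_ : D → D → Set
    _∈_ : D → S → Set
    0# 1# : D
    _+_ _*_ : D → D → D
    ≈-stable : ∀ {x y} → Stable (x ≈ y)
    <-stable : ∀ {x y} → Stable (x < y)
    ∈-stable : ∀ {x s} → Stable (x ∈ s)
    ≈-refl : ∀ {x} → x ≈ x
    ≈-euc : ∀ {x y z} → x ≈ y → x ≈ z → y ≈ z
    +-cong : ∀ {x x' y y'} → x ≈ x' → y ≈ y' → x + y ≈ x' + y'
    *-cong : ∀ {x x' y y'} → x ≈ x' → y ≈ y' → x * y ≈ x' * y'
    <-resp : ∀ {x x' y y'} → x ≈ x' → y ≈ y' → x < y → x' < y'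
    ∈-resp : ∀ {x x' s} → x ≈ x' → x ∈ s → x' ∈ s

  eval : (ℕ → D) → Tm → D
  eval ρ (var n) = ρ n
  eval ρ zer = 0#
  eval ρ one = 1#
  eval ρ (s ⊕ t) = eval ρ s + eval ρ t
  eval ρ (s ⊗ t) = eval ρ s * eval ρ t

  Sat : (ℕ → D) → (ℕ → S) → Fm → Set
  Sat ρ η ⊥' = ⊥
  Sat ρ η (s ≐ t) = eval ρ s ≈ eval ρ t
  Sat ρ η (s ≺ t) = eval ρ s < eval ρ t
  Sat ρ η (t ∈' X) = eval ρ t ∈ η X
  Sat ρ η (φ ⇒ ψ) = Sat ρ η φ → Sat ρ η ψ
  Sat ρ η (∀ⁿ φ) = ∀ d → Sat (d ◂ ρ) η φ
  Sat ρ η (∀ˢ φ) = ∀ s → Sat ρ (s ◂ η) φ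

  Valid : Fm → Set
  Valid φ = ∀ ρ η → Sat ρ η φ

  Sat-stable : ∀ φ {ρ η} → Stable (Sat ρ η φ)
  Sat-stable ⊥' nn = nn λ x → x
  Sat-stable (s ≐ t) = ≈-stable
  Sat-stable (s ≺ t) = <-stable
  Sat-stable (t ∈' X) = ∈-stable
  Sat-stable (φ ⇒ ψ) = →-stable (Sat-stable ψ)
  Sat-stable (∀ⁿ φ) = Π-stable λ _ → Sat-stable φ
  Sat-stable (∀ˢ φ) = Π-stable λ _ → Sat-stable φ

  eval-subst : ∀ {ρ ρ' σ} t → (∀ n → eval ρ (σ n) ≡ ρ' n) → eval ρ (substT σ t) ≡ eval ρ' t
  eval-subst (var n) h = h n
  eval-subst zer h = refl
  eval-subst one h = refl
  eval-subst (s ⊕ t) h = cong₂ _+_ (eval-subst s h) (eval-subst t h)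
  eval-subst (s ⊗ t) h = cong₂ _*_ (eval-subst s h) (eval-subst t h)

  eval-wk : ∀ {d ρ} t → eval (d ◂ ρ) (wkT t) ≡ eval ρ t
  eval-wk t = eval-subst t (λ _ → refl)

  ≡⇒⟺ : ∀ {A B : Set} → A ≡ B → A ⟺ B
  ≡⇒⟺ refl = ⟺-refl

  Sat-subst : ∀ {ρ ρ' σ η} φ → (∀ n → eval ρ (σ n) ≡ ρ' n) → Sat ρ η (substN σ φ) ⟺ Sat ρ' η φ
  Sat-subst ⊥' h = ⟺-refl
  Sat-subst (s ≐ t) h = ≡⇒⟺ (cong₂ _≈_ (eval-subst s h) (eval-subst t h))
  Sat-subst (s ≺ t) h = ≡⇒⟺ (cong₂ _<_ (eval-subst s h) (eval-subst t h))
  Sat-subst {η = η} (t ∈' X) h = ≡⇒⟺ (cong (_∈ η X) (eval-subst t h))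
  Sat-subst (φ ⇒ ψ) h = →-cong (Sat-subst φ h) (Sat-subst ψ h)
  Sat-subst {ρ} {ρ'} {σ} (∀ⁿ φ) h = Π-cong λ d → Sat-subst φ λ where
    zero → refl
    (suc n) → trans (eval-wk (σ n)) (h n)
  Sat-subst (∀ˢ φ) h = Π-cong λ s → Sat-subst φ h

  Sat-ren : ∀ {ρ η η' r} φ → (∀ k → η (r k) ≡ η' k) → Sat ρ η (renS r φ) ⟺ Sat ρ η' φ
  Sat-ren ⊥' h = ⟺-refl
  Sat-ren (s ≐ t) h = ⟺-refl
  Sat-ren (s ≺ t) h = ⟺-refl
  Sat-ren {ρ} (t ∈' X) h = ≡⇒⟺ (cong (eval ρ t ∈_) (h X))
  Sat-ren (φ ⇒ ψ) h = →-cong (Sat-ren φ h) (Sat-ren ψ h)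
  Sat-ren (∀ⁿ φ) h = Π-cong λ d → Sat-ren φ h
  Sat-ren (∀ˢ φ) h = Π-cong λ s → Sat-ren φ λ where
    zero → refl
    (suc k) → h k

  eval-bounded : ∀ {ρ ρ' m} t → NumBoundT m t → (∀ n → n <ℕ m → ρ n ≡ ρ' n) → eval ρ t ≡ eval ρ' t
  eval-bounded (var n) b h = h n b
  eval-bounded zer b h = refl
  eval-bounded one b h = refl
  eval-bounded (s ⊕ t) (b , c) h = cong₂ _+_ (eval-bounded s b h) (eval-bounded t c h)
  eval-bounded (s ⊗ t) (b , c) h = cong₂ _*_ (eval-bounded s b h) (eval-bounded t c h)

  Sat-bounded : ∀ {ρ ρ' η η' m k} φ → NumBound m φ → SetBound k φ →
    (∀ n → n <ℕ m → ρ n ≡ ρ' n) → (∀ n → n <ℕ k → η n ≡ η' n) → Sat ρ η φ ⟺ Sat ρ' η' φ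
  Sat-bounded ⊥' b c h g = ⟺-refl
  Sat-bounded (s ≐ t) (b , b') c h g = ≡⇒⟺ (cong₂ _≈_ (eval-bounded s b h) (eval-bounded t b' h))
  Sat-bounded (s ≺ t) (b , b') c h g = ≡⇒⟺ (cong₂ _<_ (eval-bounded s b h) (eval-bounded t b' h))
  Sat-bounded (t ∈' X) b c h g = ≡⇒⟺ (cong₂ _∈_ (eval-bounded t b h) (g X c))
  Sat-bounded (φ ⇒ ψ) (b , b') (c , c') h g =
    →-cong (Sat-bounded φ b c h g) (Sat-bounded ψ b' c' h g)
  Sat-bounded (∀ⁿ φ) b c h g = Π-cong λ d → Sat-bounded φ b c
    (λ { zero _ → refl ; (suc n) (s≤s p) → h n p }) g
  Sat-bounded (∀ˢ φ) b c h g = Π-cong λ s → Sat-bounded φ b c h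
    (λ { zero _ → refl ; (suc n) (s≤s p) → g n p })

  sound : ∀ {T φ} → (∀ {ψ} → T ψ → Valid ψ) → T ⊢ φ → Valid φ
  sound h (ax x) = h x
  sound h (mp d e) ρ η = sound h d ρ η (sound h e ρ η)
  sound h axK ρ η = λ a _ → a
  sound h axS ρ η = λ f g x → f x (g x)
  sound h (axDN {φ}) ρ η = Sat-stable φ
  sound h (gen d) ρ η = λ x → sound h d (x ◂ ρ) η
  sound h (∀elim {φ} t) ρ η = λ u → proj₂ (Sat-subst φ λ { zero → refl ; (suc n) → refl }) (u (eval ρ t))
  sound h (∀dist {φ} {ψ}) ρ η = λ u a d → u d (proj₂ (Sat-subst ψ λ _ → refl) a)
  sound h (genS d) ρ η = λ s → sound h d ρ (s ◂ η)
  sound h (∀ˢelim {φ} Y) ρ η = λ u → proj₂ (Sat-ren φ λ { zero → refl ; (suc n) → refl }) (u (η Y))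
  sound h (∀ˢdist {φ} {ψ}) ρ η = λ u a s → u s (proj₂ (Sat-ren ψ λ _ → refl) a)
  sound h eqRefl ρ η = ≈-refl
  sound h eqEuc ρ η = ≈-euc
  sound h eq⊕l ρ η = λ p → +-cong p ≈-refl
  sound h eq⊕r ρ η = λ p → +-cong ≈-refl p
  sound h eq⊗l ρ η = λ p → *-cong p ≈-refl
  sound h eq⊗r ρ η = λ p → *-cong ≈-refl p
  sound h eq≺l ρ η = λ p → <-resp p ≈-refl
  sound h eq≺r ρ η = λ p → <-resp ≈-refl p
  sound h eq∈ ρ η = ∈-resp

_⊨_ : Model → Theory → Set
M ⊨ T = ∀ {ψ} → T ψ → Model.Valid M ψ

-- Substitution calculus and bounds on free variables

substT-comp : ∀ {τ σ υ} t → (∀ n → substT τ (σ n) ≡ υ n) → substT τ (substT σ t) ≡ substT υ t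
substT-comp (var n) h = h n
substT-comp zer h = refl
substT-comp one h = refl
substT-comp (s ⊕ t) h = cong₂ _⊕_ (substT-comp s h) (substT-comp t h)
substT-comp (s ⊗ t) h = cong₂ _⊗_ (substT-comp s h) (substT-comp t h)

lift-wk : ∀ {τ} t → substT (liftσ τ) (wkT t) ≡ wkT (substT τ t)
lift-wk t = trans (substT-comp t λ _ → refl) (sym (substT-comp t λ _ → refl))

substN-comp : ∀ {τ σ υ} φ → (∀ n → substT τ (σ n) ≡ υ n) → substN τ (substN σ φ) ≡ substN υ φ
substN-comp ⊥' h = refl
substN-comp (s ≐ t) h = cong₂ _≐_ (substT-comp s h) (substT-comp t h)
substN-comp (s ≺ t) h = cong₂ _≺_ (substT-comp s h) (substT-comp t h)
substN-comp (t ∈' X) h = cong (_∈' X) (substT-comp t h)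
substN-comp (φ ⇒ ψ) h = cong₂ _⇒_ (substN-comp φ h) (substN-comp ψ h)
substN-comp {τ} {σ} (∀ⁿ φ) h = cong ∀ⁿ (substN-comp φ λ where
  zero → refl
  (suc n) → trans (lift-wk (σ n)) (cong wkT (h n)))
substN-comp (∀ˢ φ) h = cong ∀ˢ (substN-comp φ h)

substT-cong : ∀ {σ τ m} t → NumBoundT m t → (∀ n → n <ℕ m → σ n ≡ τ n) → substT σ t ≡ substT τ t
substT-cong (var n) b h = h n b
substT-cong zer b h = refl
substT-cong one b h = refl
substT-cong (s ⊕ t) (b , c) h = cong₂ _⊕_ (substT-cong s b h) (substT-cong t c h)
substT-cong (s ⊗ t) (b , c) h = cong₂ _⊗_ (substT-cong s b h) (substT-cong t c h)

substN-cong : ∀ {σ τ m} φ → NumBound m φ → (∀ n → n <ℕ m → σ n ≡ τ n) → substN σ φ ≡ substN τ φ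
substN-cong ⊥' b h = refl
substN-cong (s ≐ t) (b , c) h = cong₂ _≐_ (substT-cong s b h) (substT-cong t c h)
substN-cong (s ≺ t) (b , c) h = cong₂ _≺_ (substT-cong s b h) (substT-cong t c h)
substN-cong (t ∈' X) b h = cong (_∈' X) (substT-cong t b h)
substN-cong (φ ⇒ ψ) (b , c) h = cong₂ _⇒_ (substN-cong φ b h) (substN-cong ψ c h)
substN-cong (∀ⁿ φ) b h = cong ∀ⁿ (substN-cong φ b λ { zero _ → refl ; (suc n) (s≤s p) → cong wkT (h n p) })
substN-cong (∀ˢ φ) b h = cong ∀ˢ (substN-cong φ b h)

substT-id : ∀ {σ} t → (∀ n → σ n ≡ var n) → substT σ t ≡ t
substT-id (var n) h = h n
substT-id zer h = refl
substT-id one h = refl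
substT-id (s ⊕ t) h = cong₂ _⊕_ (substT-id s h) (substT-id t h)
substT-id (s ⊗ t) h = cong₂ _⊗_ (substT-id s h) (substT-id t h)

substN-id : ∀ {σ} φ → (∀ n → σ n ≡ var n) → substN σ φ ≡ φ
substN-id ⊥' h = refl
substN-id (s ≐ t) h = cong₂ _≐_ (substT-id s h) (substT-id t h)
substN-id (s ≺ t) h = cong₂ _≺_ (substT-id s h) (substT-id t h)
substN-id (t ∈' X) h = cong (_∈' X) (substT-id t h)
substN-id (φ ⇒ ψ) h = cong₂ _⇒_ (substN-id φ h) (substN-id ψ h)
substN-id (∀ⁿ φ) h = cong ∀ⁿ (substN-id φ λ { zero → refl ; (suc n) → cong wkT (h n) })
substN-id (∀ˢ φ) h = cong ∀ˢ (substN-id φ h)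

renS-comp : ∀ {τ σ υ} φ → (∀ n → τ (σ n) ≡ υ n) → renS τ (renS σ φ) ≡ renS υ φ
renS-comp ⊥' h = refl
renS-comp (s ≐ t) h = refl
renS-comp (s ≺ t) h = refl
renS-comp (t ∈' X) h = cong (t ∈'_) (h X)
renS-comp (φ ⇒ ψ) h = cong₂ _⇒_ (renS-comp φ h) (renS-comp ψ h)
renS-comp (∀ⁿ φ) h = cong ∀ⁿ (renS-comp φ h)
renS-comp (∀ˢ φ) h = cong ∀ˢ (renS-comp φ λ { zero → refl ; (suc n) → cong suc (h n) })

renS-cong : ∀ {σ τ m} φ → SetBound m φ → (∀ n → n <ℕ m → σ n ≡ τ n) → renS σ φ ≡ renS τ φ
renS-cong ⊥' b h = refl
renS-cong (s ≐ t) b h = refl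
renS-cong (s ≺ t) b h = refl
renS-cong (t ∈' X) b h = cong (t ∈'_) (h X b)
renS-cong (φ ⇒ ψ) (b , c) h = cong₂ _⇒_ (renS-cong φ b h) (renS-cong ψ c h)
renS-cong (∀ⁿ φ) b h = cong ∀ⁿ (renS-cong φ b h)
renS-cong (∀ˢ φ) b h = cong ∀ˢ (renS-cong φ b λ { zero _ → refl ; (suc n) (s≤s p) → cong suc (h n p) })

renS-id : ∀ {σ} φ → (∀ n → σ n ≡ n) → renS σ φ ≡ φ
renS-id ⊥' h = refl
renS-id (s ≐ t) h = refl
renS-id (s ≺ t) h = refl
renS-id (t ∈' X) h = cong (t ∈'_) (h X)
renS-id (φ ⇒ ψ) h = cong₂ _⇒_ (renS-id φ h) (renS-id ψ h)
renS-id (∀ⁿ φ) h = cong ∀ⁿ (renS-id φ h)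
renS-id (∀ˢ φ) h = cong ∀ˢ (renS-id φ λ { zero → refl ; (suc n) → cong suc (h n) })

substN-renS : ∀ {σ r} φ → substN σ (renS r φ) ≡ renS r (substN σ φ)
substN-renS ⊥' = refl
substN-renS (s ≐ t) = refl
substN-renS (s ≺ t) = refl
substN-renS (t ∈' X) = refl
substN-renS (φ ⇒ ψ) = cong₂ _⇒_ (substN-renS φ) (substN-renS ψ)
substN-renS (∀ⁿ φ) = cong ∀ⁿ (substN-renS φ)
substN-renS (∀ˢ φ) = cong ∀ˢ (substN-renS φ)

NumBoundT-mono : ∀ {m n} t → m ≤ℕ n → NumBoundT m t → NumBoundT n t
NumBoundT-mono (var x) p b = ℕₚ.<-≤-trans b p
NumBoundT-mono zer p b = tt
NumBoundT-mono one p b = tt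
NumBoundT-mono (s ⊕ t) p (b , c) = NumBoundT-mono s p b , NumBoundT-mono t p c
NumBoundT-mono (s ⊗ t) p (b , c) = NumBoundT-mono s p b , NumBoundT-mono t p c

NumBound-mono : ∀ {m n} φ → m ≤ℕ n → NumBound m φ → NumBound n φ
NumBound-mono ⊥' p b = tt
NumBound-mono (s ≐ t) p (b , c) = NumBoundT-mono s p b , NumBoundT-mono t p c
NumBound-mono (s ≺ t) p (b , c) = NumBoundT-mono s p b , NumBoundT-mono t p c
NumBound-mono (t ∈' X) p b = NumBoundT-mono t p b
NumBound-mono (φ ⇒ ψ) p (b , c) = NumBound-mono φ p b , NumBound-mono ψ p c
NumBound-mono (∀ⁿ φ) p b = NumBound-mono φ (s≤s p) b
NumBound-mono (∀ˢ φ) p b = NumBound-mono φ p b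

SetBound-mono : ∀ {m n} φ → m ≤ℕ n → SetBound m φ → SetBound n φ
SetBound-mono ⊥' p b = tt
SetBound-mono (s ≐ t) p b = tt
SetBound-mono (s ≺ t) p b = tt
SetBound-mono (t ∈' X) p b = ℕₚ.<-≤-trans b p
SetBound-mono (φ ⇒ ψ) p (b , c) = SetBound-mono φ p b , SetBound-mono ψ p c
SetBound-mono (∀ⁿ φ) p b = SetBound-mono φ p b
SetBound-mono (∀ˢ φ) p b = SetBound-mono φ (s≤s p) b

Bounded : ℕ → Fm → Set
Bounded b φ = NumBound b φ × SetBound b φ

Bounded-mono : ∀ {m n} φ → m ≤ℕ n → Bounded m φ → Bounded n φ
Bounded-mono φ p (b , c) = NumBound-mono φ p b , SetBound-mono φ p c

boundT : Tm → ℕ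
boundT (var n) = suc n
boundT zer = 0
boundT one = 0
boundT (s ⊕ t) = boundT s ⊔ boundT t
boundT (s ⊗ t) = boundT s ⊔ boundT t

-- An overestimate: quantifiers do not lower it, and one number serves both sorts of variables.
bound : Fm → ℕ
bound ⊥' = 0
bound (s ≐ t) = boundT s ⊔ boundT t
bound (s ≺ t) = boundT s ⊔ boundT t
bound (t ∈' X) = boundT t ⊔ suc X
bound (φ ⇒ ψ) = bound φ ⊔ bound ψ
bound (∀ⁿ φ) = bound φ
bound (∀ˢ φ) = bound φ

boundedT : ∀ t → NumBoundT (boundT t) t
boundedT (var n) = ℕₚ.≤-refl
boundedT zer = tt
boundedT one = tt
boundedT (s ⊕ t) = NumBoundT-mono s (ℕₚ.m≤m⊔n _ _) (boundedT s) , NumBoundT-mono t (ℕₚ.m≤n⊔m (boundT s) _) (boundedT t)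
boundedT (s ⊗ t) = NumBoundT-mono s (ℕₚ.m≤m⊔n _ _) (boundedT s) , NumBoundT-mono t (ℕₚ.m≤n⊔m (boundT s) _) (boundedT t)

bounded : ∀ φ → Bounded (bound φ) φ
bounded ⊥' = tt , tt
bounded (s ≐ t) = (NumBoundT-mono s (ℕₚ.m≤m⊔n _ _) (boundedT s) , NumBoundT-mono t (ℕₚ.m≤n⊔m (boundT s) _) (boundedT t)) , tt
bounded (s ≺ t) = (NumBoundT-mono s (ℕₚ.m≤m⊔n _ _) (boundedT s) , NumBoundT-mono t (ℕₚ.m≤n⊔m (boundT s) _) (boundedT t)) , tt
bounded (t ∈' X) = NumBoundT-mono t (ℕₚ.m≤m⊔n _ _) (boundedT t) , ℕₚ.m≤n⊔m (boundT t) _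
bounded (φ ⇒ ψ) with Bounded-mono φ (ℕₚ.m≤m⊔n (bound φ) (bound ψ)) (bounded φ) | Bounded-mono ψ (ℕₚ.m≤n⊔m (bound φ) (bound ψ)) (bounded ψ)
... | a , b | c , d = (a , c) , (b , d)
bounded (∀ⁿ φ) = NumBound-mono φ (ℕₚ.m≤n⇒m≤1+n ℕₚ.≤-refl) (proj₁ (bounded φ)) , proj₂ (bounded φ)
bounded (∀ˢ φ) = proj₁ (bounded φ) , SetBound-mono φ (ℕₚ.m≤n⇒m≤1+n ℕₚ.≤-refl) (proj₂ (bounded φ))

NumBoundT-subst : ∀ {σ m k} t → (∀ n → n <ℕ m → NumBoundT k (σ n)) → NumBoundT m t → NumBoundT k (substT σ t)
NumBoundT-subst (var n) h b = h n b
NumBoundT-subst zer h b = tt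
NumBoundT-subst one h b = tt
NumBoundT-subst (s ⊕ t) h (b , c) = NumBoundT-subst s h b , NumBoundT-subst t h c
NumBoundT-subst (s ⊗ t) h (b , c) = NumBoundT-subst s h b , NumBoundT-subst t h c

-- Admissibility of substitution

alls : ℕ → Fm → Fm
alls zero φ = φ
alls (suc m) φ = ∀ⁿ (alls m φ)

allSs : ℕ → Fm → Fm
allSs zero φ = φ
allSs (suc m) φ = ∀ˢ (allSs m φ)

lifts : ℕ → (ℕ → Tm) → ℕ → Tm
lifts zero σ = σ
lifts (suc m) σ = liftσ (lifts m σ)

lifts-comm : ∀ m σ → lifts m (liftσ σ) ≡ liftσ (lifts m σ)
lifts-comm zero σ = refl
lifts-comm (suc m) σ = cong liftσ (lifts-comm m σ)

substN-alls : ∀ m {σ} φ → substN σ (alls m φ) ≡ alls m (substN (lifts m σ) φ)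
substN-alls zero φ = refl
substN-alls (suc m) {σ} φ = cong ∀ⁿ (trans (substN-alls m φ) (cong (λ s → alls m (substN s φ)) (lifts-comm m σ)))

-- The effect of instantiating `m` quantifiers: `σ` below `m`, while the indices from `m` on drop by
-- `m`.
below : ℕ → (ℕ → Tm) → ℕ → Tm
below zero σ n = var n
below (suc m) σ zero = σ zero
below (suc m) σ (suc n) = below m (λ k → σ (suc k)) n

below-< : ∀ m σ n → n <ℕ m → below m σ n ≡ σ n
below-< (suc m) σ zero p = refl
below-< (suc m) σ (suc n) (s≤s p) = below-< m _ n p

below-inst : ∀ m σ n → substT (below m σ) (lifts m (instσ (σ m)) n) ≡ below (suc m) σ n
below-inst zero σ zero = substT-id (σ 0) λ _ → refl
below-inst zero σ (suc n) = refl
below-inst (suc m) σ zero = refl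
below-inst (suc m) σ (suc n) =
  trans (substT-comp (lifts m (instσ (σ (suc m))) n) λ _ → refl) (below-inst m (λ k → σ (suc k)) n)

liftsρ : ℕ → (ℕ → ℕ) → ℕ → ℕ
liftsρ zero σ = σ
liftsρ (suc m) σ = liftρ (liftsρ m σ)

liftsρ-comm : ∀ m σ → liftsρ m (liftρ σ) ≡ liftρ (liftsρ m σ)
liftsρ-comm zero σ = refl
liftsρ-comm (suc m) σ = cong liftρ (liftsρ-comm m σ)

renS-allSs : ∀ m {σ} φ → renS σ (allSs m φ) ≡ allSs m (renS (liftsρ m σ) φ)
renS-allSs zero φ = refl
renS-allSs (suc m) {σ} φ = cong ∀ˢ (trans (renS-allSs m φ) (cong (λ s → allSs m (renS s φ)) (liftsρ-comm m σ)))

belowρ : ℕ → (ℕ → ℕ) → ℕ → ℕ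
belowρ zero σ n = n
belowρ (suc m) σ zero = σ zero
belowρ (suc m) σ (suc n) = belowρ m (λ k → σ (suc k)) n

belowρ-< : ∀ m σ n → n <ℕ m → belowρ m σ n ≡ σ n
belowρ-< (suc m) σ zero p = refl
belowρ-< (suc m) σ (suc n) (s≤s p) = belowρ-< m _ n p

belowρ-inst : ∀ m σ n → belowρ m σ (liftsρ m (instρ (σ m)) n) ≡ belowρ (suc m) σ n
belowρ-inst zero σ zero = refl
belowρ-inst zero σ (suc n) = refl
belowρ-inst (suc m) σ zero = refl
belowρ-inst (suc m) σ (suc n) = belowρ-inst m (λ k → σ (suc k)) n

module _ {T : Theory} where

  gens : ∀ m {φ} → T ⊢ φ → T ⊢ alls m φ
  gens zero d = d
  gens (suc m) d = gen (gens m d)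

  -- The outermost quantifier binds index `m`, so `σ m` goes in first. Its weakening under the
  -- remaining quantifiers is undone when these are instantiated in turn (`below-inst`).
  inst-alls : ∀ m {φ} σ → T ⊢ alls m φ → T ⊢ substN (below m σ) φ
  inst-alls zero {φ} σ d = subst (T ⊢_) (sym (substN-id φ λ _ → refl)) d
  inst-alls (suc m) {φ} σ d =
    subst (T ⊢_) (substN-comp φ (below-inst m σ))
      (inst-alls m σ (subst (T ⊢_) (substN-alls m φ) (mp (∀elim (σ m)) d)))

  -- Induction on the derivation would fail at `ax`, as a theory need not be closed under
  -- substitution. Generalising all free variables and instantiating them again avoids this.
  ⊢-subst : ∀ {φ} σ → T ⊢ φ → T ⊢ substN σ φ
  ⊢-subst {φ} σ d = subst (T ⊢_)
    (substN-cong φ (proj₁ (bounded φ)) (below-< (bound φ) σ)) (inst-alls (bound φ) σ (gens (bound φ) d))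

  genSs : ∀ m {φ} → T ⊢ φ → T ⊢ allSs m φ
  genSs zero d = d
  genSs (suc m) d = genS (genSs m d)

  inst-allSs : ∀ m {φ} σ → T ⊢ allSs m φ → T ⊢ renS (belowρ m σ) φ
  inst-allSs zero {φ} σ d = subst (T ⊢_) (sym (renS-id φ λ _ → refl)) d
  inst-allSs (suc m) {φ} σ d =
    subst (T ⊢_) (renS-comp φ (belowρ-inst m σ))
      (inst-allSs m σ (subst (T ⊢_) (renS-allSs m φ) (mp (∀ˢelim (σ m)) d)))

  ⊢-ren : ∀ {φ} σ → T ⊢ φ → T ⊢ renS σ φ
  ⊢-ren {φ} σ d = subst (T ⊢_)
    (renS-cong φ (proj₂ (bounded φ)) (belowρ-< (bound φ) σ)) (inst-allSs (bound φ) σ (genSs (bound φ) d))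

-- Derivations from hypotheses whose free variables act as constants

data Loc (T : Theory) (G : Fm → Set) : Fm → Set where
  hyp : ∀ {φ} → G φ → Loc T G φ
  thm : ∀ {φ} → T ⊢ φ → Loc T G φ
  app : ∀ {φ ψ} → Loc T G (φ ⇒ ψ) → Loc T G φ → Loc T G ψ

module _ {T : Theory} where

  Loc-mono : ∀ {G H φ} → (∀ {γ} → G γ → H γ) → Loc T G φ → Loc T H φ
  Loc-mono f (hyp x) = hyp (f x)
  Loc-mono f (thm x) = thm x
  Loc-mono f (app d e) = app (Loc-mono f d) (Loc-mono f e)

  Loc⇒⊢ : ∀ {φ} → Loc T (λ _ → ⊥) φ → T ⊢ φ
  Loc⇒⊢ (thm x) = x
  Loc⇒⊢ (app d e) = mp (Loc⇒⊢ d) (Loc⇒⊢ e)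

  ⊢I : ∀ {φ} → T ⊢ φ ⇒ φ
  ⊢I {φ} = mp (mp axS axK) (axK {ψ = φ})

  ded : ∀ {G γ φ} → Loc T (G ∪ᵀ ｛ γ ｝) φ → Loc T G (γ ⇒ φ)
  ded (hyp (inj₁ x)) = app (thm axK) (hyp x)
  ded (hyp (inj₂ refl)) = thm ⊢I
  ded (thm x) = app (thm axK) (thm x)
  ded (app d e) = app (app (thm axS) (ded d)) (ded e)

  weak : ∀ {G γ φ} → Loc T G φ → Loc T (G ∪ᵀ ｛ γ ｝) φ
  weak = Loc-mono inj₁

  hyp₀ : ∀ {G γ} → Loc T (G ∪ᵀ ｛ γ ｝) γ
  hyp₀ = hyp (inj₂ refl)

  Loc-efq : ∀ {G φ} → Loc T G ⊥' → Loc T G φ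
  Loc-efq d = app (thm axDN) (app (thm axK) d)

  ¬⇒-fst : ∀ {G φ ψ} → Loc T G (¬' (φ ⇒ ψ)) → Loc T G φ
  ¬⇒-fst d = app (thm axDN) (ded (app (weak d) (ded (Loc-efq (app (weak hyp₀) hyp₀)))))

  ¬⇒-snd : ∀ {G φ ψ} → Loc T G (¬' (φ ⇒ ψ)) → Loc T G (¬' ψ)
  ¬⇒-snd d = ded (app (weak d) (app (thm axK) hyp₀))

  Loc-subst : ∀ {G H φ} σ → (∀ {γ} → G γ → H (substN σ γ)) → Loc T G φ → Loc T H (substN σ φ)
  Loc-subst σ f (hyp x) = hyp (f x)
  Loc-subst σ f (thm x) = thm (⊢-subst σ x)
  Loc-subst σ f (app d e) = app (Loc-subst σ f d) (Loc-subst σ f e)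

  Loc-ren : ∀ {G H φ} σ → (∀ {γ} → G γ → H (renS σ γ)) → Loc T G φ → Loc T H (renS σ φ)
  Loc-ren σ f (hyp x) = hyp (f x)
  Loc-ren σ f (thm x) = thm (⊢-ren σ x)
  Loc-ren σ f (app d e) = app (Loc-ren σ f d) (Loc-ren σ f e)

  wk-∀elim : ∀ φ → T ⊢ wkN (∀ⁿ φ) ⇒ φ
  wk-∀elim φ = subst (λ χ → T ⊢ wkN (∀ⁿ φ) ⇒ χ)
    (trans (substN-comp {υ = var} φ (λ { zero → refl ; (suc n) → refl })) (substN-id φ λ _ → refl))
    (∀elim (var 0))

  wk-∀ˢelim : ∀ φ → T ⊢ wkS (∀ˢ φ) ⇒ φ
  wk-∀ˢelim φ = subst (λ χ → T ⊢ wkS (∀ˢ φ) ⇒ χ)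
    (trans (renS-comp {υ = λ n → n} φ (λ { zero → refl ; (suc n) → refl })) (renS-id φ λ _ → refl))
    (∀ˢelim 0)

  ⊢∀K : ∀ φ ψ → T ⊢ ∀ⁿ (φ ⇒ ψ) ⇒ ∀ⁿ φ ⇒ ∀ⁿ ψ
  ⊢∀K φ ψ = Loc⇒⊢ (ded (ded (app (app (thm ∀dist) (app (app (thm ∀dist) (thm (gen inner))) (weak hyp₀))) hyp₀)))
    where
    inner = Loc⇒⊢ (ded (ded (app (app (thm (wk-∀elim (φ ⇒ ψ))) (weak hyp₀)) (app (thm (wk-∀elim φ)) hyp₀))))

  ⊢∀ˢK : ∀ φ ψ → T ⊢ ∀ˢ (φ ⇒ ψ) ⇒ ∀ˢ φ ⇒ ∀ˢ ψ
  ⊢∀ˢK φ ψ = Loc⇒⊢ (ded (ded (app (app (thm ∀ˢdist) (app (app (thm ∀ˢdist) (thm (genS inner))) (weak hyp₀))) hyp₀)))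
    where
    inner = Loc⇒⊢ (ded (ded (app (app (thm (wk-∀ˢelim (φ ⇒ ψ))) (weak hyp₀)) (app (thm (wk-∀ˢelim φ)) hyp₀))))

  Image : (Fm → Fm) → (Fm → Set) → Fm → Set
  Image f G φ = Σ Fm λ γ → G γ × (φ ≡ f γ)

  -- Generalisation is pushed to the leaves: at a hypothesis `∀dist` yields `γ ⇒ ∀ⁿ (wkN γ)`, and
  -- `⊢∀K` distributes the quantifier over modus ponens.
  Loc-gen : ∀ {G ψ} → Loc T (Image wkN G) ψ → Loc T G (∀ⁿ ψ)
  Loc-gen (hyp (γ , g , refl)) = app (app (thm ∀dist) (thm (gen ⊢I))) (hyp g)
  Loc-gen (thm x) = thm (gen x)
  Loc-gen (app d e) = app (app (thm (⊢∀K _ _)) (Loc-gen d)) (Loc-gen e)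

  Loc-genS : ∀ {G ψ} → Loc T (Image wkS G) ψ → Loc T G (∀ˢ ψ)
  Loc-genS (hyp (γ , g , refl)) = app (app (thm ∀ˢdist) (thm (genS ⊢I))) (hyp g)
  Loc-genS (thm x) = thm (genS x)
  Loc-genS (app d e) = app (app (thm (⊢∀ˢK _ _)) (Loc-genS d)) (Loc-genS e)

  -- Turns the constant `v` into the variable 0 and weakens the smaller indices; larger ones do not
  -- occur where it is applied.
  bindσ : ℕ → ℕ → ℕ
  bindσ v n with n ℕₚ.<? v
  ... | yesᵈ _ = suc n
  ... | noᵈ _ = 0

  bindσ-< : ∀ v n → n <ℕ v → bindσ v n ≡ suc n
  bindσ-< v n p with n ℕₚ.<? v
  ... | yesᵈ _ = refl
  ... | noᵈ q = ⊥-elim (q p)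

  bindσ-≡ : ∀ v → bindσ v v ≡ 0
  bindσ-≡ v with v ℕₚ.<? v
  ... | yesᵈ p = ⊥-elim (ℕₚ.n≮n v p)
  ... | noᵈ _ = refl

  -- The theorem on constants: `var v` occurs in no hypothesis, so it can be renamed into the
  -- variable to be bound, after which `Loc-gen` applies.
  Loc-fresh : ∀ {G ψ} v → (∀ {γ} → G γ → Bounded v γ) → NumBound (suc v) ψ →
    Loc T G (inst (var v) ψ) → Loc T G (∀ⁿ ψ)
  Loc-fresh {G} {ψ} v h b d = Loc-gen (subst (Loc T (Image wkN G)) eq
    (Loc-subst σ (λ {γ} g → γ , g , substN-cong γ (proj₁ (h g)) λ n p → cong var (bindσ-< v n p)) d))
    where
    σ : ℕ → Tm
    σ n = var (bindσ v n)
    eq : substN σ (inst (var v) ψ) ≡ ψ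
    eq = trans (substN-comp ψ λ _ → refl) (trans (substN-cong ψ b λ where
      zero _ → cong var (bindσ-≡ v)
      (suc n) (s≤s p) → cong var (bindσ-< v n p)) (substN-id ψ λ _ → refl))

  Loc-freshS : ∀ {G ψ} v → (∀ {γ} → G γ → Bounded v γ) → SetBound (suc v) ψ →
    Loc T G (instS v ψ) → Loc T G (∀ˢ ψ)
  Loc-freshS {G} {ψ} v h b d = Loc-genS (subst (Loc T (Image wkS G)) eq
    (Loc-ren (bindσ v) (λ {γ} g → γ , g , renS-cong γ (proj₂ (h g)) λ n p → bindσ-< v n p) d))
    where
    eq : renS (bindσ v) (instS v ψ) ≡ ψ
    eq = trans (renS-comp ψ λ _ → refl) (trans (renS-cong ψ b λ where
      zero _ → bindσ-≡ v
      (suc n) (s≤s p) → bindσ-< v n p) (renS-id ψ λ _ → refl))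

-- Enumeration of formulas

next : ℕ × ℕ → ℕ × ℕ
next (zero , y) = suc y , 0
next (suc x , y) = x , suc y

unpair : ℕ → ℕ × ℕ
unpair zero = 0 , 0
unpair (suc n) = next (unpair n)

Hit : ℕ × ℕ → Set
Hit p = Σ ℕ λ n → unpair n ≡ p

hit-diag : ∀ k x y → Hit (k +ℕ x , y) → Hit (x , k +ℕ y)
hit-diag zero x y h = h
hit-diag (suc k) x y (n , e) = subst (λ z → Hit (x , z)) (ℕₚ.+-suc k y) (hit-diag k x (suc y) (suc n , cong next e))

hit-axis : ∀ s → Hit (s , 0)
hit-axis zero = 0 , refl
hit-axis (suc s) with hit-diag s 0 0 (subst (λ z → Hit (z , 0)) (sym (ℕₚ.+-identityʳ s)) (hit-axis s))
... | n , e = suc n , trans (cong next e) (cong (λ z → suc z , 0) (ℕₚ.+-identityʳ s))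

hit : ∀ x y → Hit (x , y)
hit x y = subst (λ z → Hit (x , z)) (ℕₚ.+-identityʳ y) (hit-diag y x 0 (hit-axis (y +ℕ x)))

enT : ℕ → ℕ → Tm
enT zero n = zer
enT (suc d) n with unpair n
... | 0 , m = var m
... | 1 , m = zer
... | 2 , m = one
... | 3 , m = enT d (proj₁ (unpair m)) ⊕ enT d (proj₂ (unpair m))
... | suc (suc (suc (suc _))) , m = enT d (proj₁ (unpair m)) ⊗ enT d (proj₂ (unpair m))

en : ℕ → ℕ → Fm
en zero n = ⊥'
en (suc d) n with unpair n
... | 0 , m = ⊥'
... | 1 , m = enT d (proj₁ (unpair m)) ≐ enT d (proj₂ (unpair m))
... | 2 , m = enT d (proj₁ (unpair m)) ≺ enT d (proj₂ (unpair m))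
... | 3 , m = enT d (proj₁ (unpair m)) ∈' proj₂ (unpair m)
... | 4 , m = en d (proj₁ (unpair m)) ⇒ en d (proj₂ (unpair m))
... | 5 , m = ∀ⁿ (en d m)
... | suc (suc (suc (suc (suc (suc _))))) , m = ∀ˢ (en d m)

hit₂ : ∀ a x y → Σ ℕ λ n → Σ ℕ λ m → (unpair n ≡ (a , m)) × (unpair m ≡ (x , y))
hit₂ a x y with hit x y
... | m , e with hit a m
... | n , e' = n , m , e' , e

-- Demanded at every large depth, because the two immediate subterms have to be decoded at one
-- common depth.
EnT : Tm → Set
EnT t = Σ ℕ λ d → ∀ e → d ≤ℕ e → Σ ℕ λ n → enT e n ≡ t

enT-bin : ∀ {s t} a f → (∀ d n {m} → unpair n ≡ (a , m) → enT (suc d) n ≡ f (enT d (proj₁ (unpair m))) (enT d (proj₂ (unpair m)))) →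
  EnT s → EnT t → EnT (f s t)
enT-bin {s} {t} a f h (d , p) (d' , p') = suc (d ⊔ d') , g
  where
  g : ∀ e → suc (d ⊔ d') ≤ℕ e → Σ ℕ λ n → enT e n ≡ f s t
  g (suc e) (s≤s q) with p e (ℕₚ.≤-trans (ℕₚ.m≤m⊔n _ _) q) | p' e (ℕₚ.≤-trans (ℕₚ.m≤n⊔m d _) q)
  ... | x , ex | y , ey with hit₂ a x y
  ... | n , m , e1 , e2 = n , trans (h e n e1) (trans (cong (λ z → f (enT e (proj₁ z)) (enT e (proj₂ z))) e2) (cong₂ f ex ey))

en-surjT : ∀ t → EnT t
en-surjT (var k) = 1 , λ { (suc e) _ → let n , p = hit 0 k in n , g e n p }
  where
  g : ∀ e n → unpair n ≡ (0 , k) → enT (suc e) n ≡ var k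
  g e n p rewrite p = refl
en-surjT zer = 0 , λ { zero _ → 0 , refl ; (suc e) _ → let n , p = hit 1 0 in n , g e n p }
  where
  g : ∀ e n → unpair n ≡ (1 , 0) → enT (suc e) n ≡ zer
  g e n p rewrite p = refl
en-surjT one = 1 , λ { (suc e) _ → let n , p = hit 2 0 in n , g e n p }
  where
  g : ∀ e n → unpair n ≡ (2 , 0) → enT (suc e) n ≡ one
  g e n p rewrite p = refl
en-surjT (s ⊕ t) = enT-bin 3 _⊕_ g (en-surjT s) (en-surjT t)
  where
  g : ∀ d n {m} → unpair n ≡ (3 , m) → enT (suc d) n ≡ enT d (proj₁ (unpair m)) ⊕ enT d (proj₂ (unpair m))
  g d n p rewrite p = refl
en-surjT (s ⊗ t) = enT-bin 4 _⊗_ g (en-surjT s) (en-surjT t)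
  where
  g : ∀ d n {m} → unpair n ≡ (4 , m) → enT (suc d) n ≡ enT d (proj₁ (unpair m)) ⊗ enT d (proj₂ (unpair m))
  g d n p rewrite p = refl

En : Fm → Set
En φ = Σ ℕ λ d → ∀ e → d ≤ℕ e → Σ ℕ λ n → en e n ≡ φ

en-atom : ∀ {s t} a f → (∀ d n {m} → unpair n ≡ (a , m) → en (suc d) n ≡ f (enT d (proj₁ (unpair m))) (enT d (proj₂ (unpair m)))) →
  EnT s → EnT t → En (f s t)
en-atom {s} {t} a f h (d , p) (d' , p') = suc (d ⊔ d') , g
  where
  g : ∀ e → suc (d ⊔ d') ≤ℕ e → Σ ℕ λ n → en e n ≡ f s t
  g (suc e) (s≤s q) with p e (ℕₚ.≤-trans (ℕₚ.m≤m⊔n _ _) q) | p' e (ℕₚ.≤-trans (ℕₚ.m≤n⊔m d _) q)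
  ... | x , ex | y , ey with hit₂ a x y
  ... | n , m , e1 , e2 = n , trans (h e n e1) (trans (cong (λ z → f (enT e (proj₁ z)) (enT e (proj₂ z))) e2) (cong₂ f ex ey))

en-surj : ∀ φ → En φ
en-surj ⊥' = 0 , λ { zero _ → 0 , refl ; (suc e) _ → 0 , refl }
en-surj (s ≐ t) = en-atom 1 _≐_ g (en-surjT s) (en-surjT t)
  where
  g : ∀ d n {m} → unpair n ≡ (1 , m) → en (suc d) n ≡ (enT d (proj₁ (unpair m)) ≐ enT d (proj₂ (unpair m)))
  g d n p rewrite p = refl
en-surj (s ≺ t) = en-atom 2 _≺_ g (en-surjT s) (en-surjT t)
  where
  g : ∀ d n {m} → unpair n ≡ (2 , m) → en (suc d) n ≡ (enT d (proj₁ (unpair m)) ≺ enT d (proj₂ (unpair m)))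
  g d n p rewrite p = refl
en-surj (t ∈' X) with en-surjT t
... | d , p = suc d , λ { (suc e) (s≤s q) → let x , ex = p e q ; n , m , e1 , e2 = hit₂ 3 x X in
    n , trans (g e n e1) (trans (cong (λ z → enT e (proj₁ z) ∈' proj₂ z) e2) (cong (_∈' X) ex)) }
  where
  g : ∀ d n {m} → unpair n ≡ (3 , m) → en (suc d) n ≡ (enT d (proj₁ (unpair m)) ∈' proj₂ (unpair m))
  g d n p rewrite p = refl
en-surj (φ ⇒ ψ) with en-surj φ | en-surj ψ
... | d , p | d' , p' = suc (d ⊔ d') , λ { (suc e) (s≤s q) →
    let x , ex = p e (ℕₚ.≤-trans (ℕₚ.m≤m⊔n _ _) q) ; y , ey = p' e (ℕₚ.≤-trans (ℕₚ.m≤n⊔m d _) q) ; n , m , e1 , e2 = hit₂ 4 x y in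
    n , trans (g e n e1) (trans (cong (λ z → en e (proj₁ z) ⇒ en e (proj₂ z)) e2) (cong₂ _⇒_ ex ey)) }
  where
  g : ∀ d n {m} → unpair n ≡ (4 , m) → en (suc d) n ≡ (en d (proj₁ (unpair m)) ⇒ en d (proj₂ (unpair m)))
  g d n p rewrite p = refl
en-surj (∀ⁿ φ) with en-surj φ
... | d , p = suc d , λ { (suc e) (s≤s q) → let x , ex = p e q ; n , e1 = hit 5 x in n , trans (g e n e1) (cong ∀ⁿ ex) }
  where
  g : ∀ d n {m} → unpair n ≡ (5 , m) → en (suc d) n ≡ ∀ⁿ (en d m)
  g d n p rewrite p = refl
en-surj (∀ˢ φ) with en-surj φ
... | d , p = suc d , λ { (suc e) (s≤s q) → let x , ex = p e q ; n , e1 = hit 6 x in n , trans (g e n e1) (cong ∀ˢ ex) }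
  where
  g : ∀ d n {m} → unpair n ≡ (6 , m) → en (suc d) n ≡ ∀ˢ (en d m)
  g d n p rewrite p = refl

enum : ℕ → Fm
enum k = en (proj₁ (unpair k)) (proj₂ (unpair k))

enum-surj : ∀ φ → Σ ℕ λ k → enum k ≡ φ
enum-surj φ with en-surj φ
... | d , p with p d ℕₚ.≤-refl
... | n , e with hit d n
... | k , e' = k , trans (cong (λ z → en (proj₁ z) (proj₂ z)) e') e

-- Henkin term models

-- G (suc n) adds the n-th formula exactly when it is consistent; membership
-- in the limit is thereby equivalent to a negated statement, which makes truth in
-- the term model stable without excluded middle.

module Henkin (T : Theory) (G₀ : Fm → Set) (b₀ : ℕ) (G₀-bounded : ∀ {γ} → G₀ γ → Bounded b₀ γ)
  (con₀ : ¬ Loc T G₀ ⊥') where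

  Con : (Fm → Set) → Set
  Con G = ¬ Loc T G ⊥'

  -- The Henkin axiom for a universal formula: if there is a counterexample at all, then the fresh
  -- variable `v` is one.
  witness : ℕ → Fm → Fm
  witness v (∀ⁿ ψ) = inst (var v) ψ ⇒ ∀ⁿ ψ
  witness v (∀ˢ ψ) = instS v ψ ⇒ ∀ˢ ψ
  witness v _ = ⊥' ⇒ ⊥'

  Decide : (Fm → Set) → Fm → Fm → Set
  Decide G φ χ = (χ ≡ φ) × Con (G ∪ᵀ ｛ φ ｝)

  mutual
    G : ℕ → Fm → Set
    G zero = G₀
    G (suc n) = (G n ∪ᵀ Decide (G n) (enum n)) ∪ᵀ ｛ witness (v n) (enum n) ｝

    b v : ℕ → ℕ
    b zero = b₀
    b (suc n) = v n ⊔ bound (witness (v n) (enum n))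
    v n = b n ⊔ bound (enum n)

  mutual
    G-bounded : ∀ n {γ} → G n γ → Bounded (b n) γ
    G-bounded zero g = G₀-bounded g
    G-bounded (suc n) {γ} (inj₁ g) = Bounded-mono γ (ℕₚ.m≤m⊔n _ _) (Gv-bounded n g)
    G-bounded (suc n) (inj₂ refl) = Bounded-mono (witness (v n) (enum n)) (ℕₚ.m≤n⊔m (v n) _) (bounded (witness (v n) (enum n)))

    Gv-bounded : ∀ n {γ} → (G n ∪ᵀ Decide (G n) (enum n)) γ → Bounded (v n) γ
    Gv-bounded n {γ} (inj₁ g) = Bounded-mono γ (ℕₚ.m≤m⊔n _ _) (G-bounded n g)
    Gv-bounded n (inj₂ (refl , _)) = Bounded-mono (enum n) (ℕₚ.m≤n⊔m (b n) _) (bounded (enum n))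

  -- No case distinction is needed: a derivation of falsity refutes `Con (G ∪ᵀ ｛ φ ｝)`, hence shows
  -- that nothing was added, and so it already is a derivation from `G`.
  decide-con : ∀ G φ → Con G → Con (G ∪ᵀ Decide G φ)
  decide-con G φ con d = con (Loc-cut d)
    where
    incon : ¬ Con (G ∪ᵀ ｛ φ ｝)
    incon c = c (Loc-mono (λ { (inj₁ g) → inj₁ g ; (inj₂ (e , _)) → inj₂ e }) d)
    Loc-cut : ∀ {χ} → Loc T (G ∪ᵀ Decide G φ) χ → Loc T G χ
    Loc-cut = Loc-mono λ { (inj₁ g) → g ; (inj₂ (_ , c)) → ⊥-elim (incon c) }

  trivial-con : ∀ {G} → Con G → Con (G ∪ᵀ ｛ ⊥' ⇒ ⊥' ｝)
  trivial-con c d = c (app (ded d) (thm ⊢I))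

  -- Refuting the Henkin axiom would prove both `ψ(v)` and the negation of `∀ψ`; as `v` is fresh,
  -- the former generalises and contradicts the latter.
  witness-con : ∀ {G} v φ → (∀ {γ} → G γ → Bounded v γ) → Bounded v φ → Con G → Con (G ∪ᵀ ｛ witness v φ ｝)
  witness-con v ⊥' h b = trivial-con
  witness-con v (s ≐ t) h b = trivial-con
  witness-con v (s ≺ t) h b = trivial-con
  witness-con v (t ∈' X) h b = trivial-con
  witness-con v (φ ⇒ ψ) h b = trivial-con
  witness-con v (∀ⁿ ψ) h (b , _) c d = c (app (¬⇒-snd (ded d)) (Loc-fresh v h b (¬⇒-fst (ded d))))
  witness-con v (∀ˢ ψ) h (_ , b) c d = c (app (¬⇒-snd (ded d)) (Loc-freshS v h b (¬⇒-fst (ded d))))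

  G-con : ∀ n → Con (G n)
  G-con zero = con₀
  G-con (suc n) = witness-con (v n) (enum n) (Gv-bounded n)
    (Bounded-mono (enum n) (ℕₚ.m≤n⊔m (b n) _) (bounded (enum n))) (decide-con (G n) (enum n) (G-con n))

  Gω : Fm → Set
  Gω φ = Σ ℕ λ n → G n φ

  G-mono : ∀ {m} k {φ} → G m φ → G (k +ℕ m) φ
  G-mono zero g = g
  G-mono (suc k) g = inj₁ (inj₁ (G-mono k g))

  G-join : ∀ m n → (∀ {φ} → G m φ → G (n +ℕ m) φ) × (∀ {φ} → G n φ → G (n +ℕ m) φ)
  G-join m n = G-mono n , λ {φ} g → subst (λ k → G k φ) (ℕₚ.+-comm m n) (G-mono m g)

  Loc-stage : ∀ {φ} → Loc T Gω φ → Σ ℕ λ n → Loc T (G n) φ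
  Loc-stage (hyp (n , g)) = n , hyp g
  Loc-stage (thm x) = 0 , thm x
  Loc-stage (app d e) with Loc-stage d | Loc-stage e
  ... | m , d' | n , e' = n +ℕ m , app (Loc-mono (proj₁ (G-join m n)) d') (Loc-mono (proj₂ (G-join m n)) e')

  Gω-con : Con Gω
  Gω-con d = G-con (proj₁ (Loc-stage d)) (proj₂ (Loc-stage d))

  In : Fm → Set
  In = Loc T Gω

  -- Consistency with the limit restricts to the stage at which `φ` is examined, and there it is the
  -- very evidence that `Decide` asks for.
  In-max : ∀ φ → Con (Gω ∪ᵀ ｛ φ ｝) → In φ
  In-max φ c with enum-surj φ
  ... | n , refl = hyp (suc n , inj₁ (inj₂ (refl , λ d → c (Loc-mono (λ { (inj₁ g) → inj₁ (n , g) ; (inj₂ e) → inj₂ e }) d))))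

  In-stable : ∀ {φ} → Stable (In φ)
  In-stable {φ} nn = In-max φ λ d → nn λ i → Gω-con (app (ded d) i)

  In-⇒ : ∀ {φ ψ} → (In φ → In ψ) → In (φ ⇒ ψ)
  In-⇒ f = In-max _ λ d → Gω-con (app (¬⇒-snd (ded d)) (f (¬⇒-fst (ded d))))

  In-∀ⁿ : ∀ {ψ} → (∀ t → In (inst t ψ)) → In (∀ⁿ ψ)
  In-∀ⁿ {ψ} f with enum-surj (∀ⁿ ψ)
  ... | n , e = app (hyp (suc n , inj₂ (cong (witness (v n)) (sym e)))) (f (var (v n)))

  In-∀ˢ : ∀ {ψ} → (∀ t → In (instS t ψ)) → In (∀ˢ ψ)
  In-∀ˢ {ψ} f with enum-surj (∀ˢ ψ)
  ... | n , e = app (hyp (suc n , inj₂ (cong (witness (v n)) (sym e)))) (f (v n))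

  thm-subst : ∀ {φ} σ → T ⊢ φ → In (substN σ φ)
  thm-subst σ d = thm (⊢-subst σ d)

  env₃ : Tm → Tm → Tm → ℕ → Tm
  env₃ x y z = x ◂ y ◂ z ◂ var

  eq-refl : ∀ {x} → In (x ≐ x)
  eq-refl {x} = thm-subst (env₃ x x x) eqRefl
  eq-euc : ∀ {x y z} → In (x ≐ y) → In (x ≐ z) → In (y ≐ z)
  eq-euc {x} {y} {z} p q = app (app (thm-subst (env₃ x y z) eqEuc) p) q
  eq-trans : ∀ {x y z} → In (x ≐ y) → In (y ≐ z) → In (x ≐ z)
  eq-trans p q = eq-euc (eq-euc p eq-refl) q

  model : Model
  model = record
    { D = Tm ; S = ℕ
    ; _≈_ = λ s t → In (s ≐ t) ; _<_ = λ s t → In (s ≺ t) ; _∈_ = λ t X → In (t ∈' X)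
    ; 0# = zer ; 1# = one ; _+_ = _⊕_ ; _*_ = _⊗_
    ; ≈-stable = In-stable ; <-stable = In-stable ; ∈-stable = In-stable
    ; ≈-refl = eq-refl
    ; ≈-euc = eq-euc
    ; +-cong = λ {x} {x'} {y} {y'} p q → eq-trans (app (thm-subst (env₃ x x' y) eq⊕l) p) (app (thm-subst (env₃ y y' x') eq⊕r) q)
    ; *-cong = λ {x} {x'} {y} {y'} p q → eq-trans (app (thm-subst (env₃ x x' y) eq⊗l) p) (app (thm-subst (env₃ y y' x') eq⊗r) q)
    ; <-resp = λ {x} {x'} {y} {y'} p q r → app (app (thm-subst (env₃ y y' x') eq≺r) q) (app (app (thm-subst (env₃ x x' y) eq≺l) p) r)
    ; ∈-resp = λ {x} {x'} {s} p r → app (app (thm (⊢-ren (λ _ → s) (⊢-subst (env₃ x x' x) eq∈))) p) r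
    }

  open Model model using (Sat; eval)

  eval-model : ∀ ρ t → eval ρ t ≡ substT ρ t
  eval-model ρ (var n) = refl
  eval-model ρ zer = refl
  eval-model ρ one = refl
  eval-model ρ (s ⊕ t) = cong₂ _⊕_ (eval-model ρ s) (eval-model ρ t)
  eval-model ρ (s ⊗ t) = cong₂ _⊗_ (eval-model ρ s) (eval-model ρ t)

  inst-lift : ∀ {ρ X t} φ → inst t (renS X (substN (liftσ ρ) φ)) ≡ renS X (substN (t ◂ ρ) φ)
  inst-lift {ρ} φ = trans (substN-renS (substN (liftσ ρ) φ)) (cong (renS _) (substN-comp φ λ where
    zero → refl
    (suc n) → trans (substT-comp (ρ n) λ _ → refl) (substT-id (ρ n) λ _ → refl)))

  instS-lift : ∀ {X Y} φ → instS Y (renS (liftρ X) φ) ≡ renS (Y ◂ X) φ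
  instS-lift φ = renS-comp φ λ { zero → refl ; (suc n) → refl }

  truth : ∀ φ {ρ X} → Sat ρ X φ ⟺ In (renS X (substN ρ φ))
  truth ⊥' = ⊥-elim , Gω-con
  truth (s ≐ t) {ρ} rewrite eval-model ρ s | eval-model ρ t = ⟺-refl
  truth (s ≺ t) {ρ} rewrite eval-model ρ s | eval-model ρ t = ⟺-refl
  truth (t ∈' X) {ρ} rewrite eval-model ρ t = ⟺-refl
  truth (φ ⇒ ψ) = (λ f → In-⇒ λ i → proj₁ (truth ψ) (f (proj₂ (truth φ) i))) ,
    (λ i a → proj₂ (truth ψ) (app i (proj₁ (truth φ) a)))
  truth (∀ⁿ φ) = (λ f → In-∀ⁿ λ t → subst In (sym (inst-lift φ)) (proj₁ (truth φ) (f t))) ,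
    (λ i t → proj₂ (truth φ) (subst In (inst-lift φ) (app (thm (∀elim t)) i)))
  truth (∀ˢ φ) {ρ} = (λ f → In-∀ˢ λ t → subst In (sym (instS-lift (substN ρ φ))) (proj₁ (truth φ) (f t))) ,
    (λ i t → proj₂ (truth φ) (subst In (instS-lift (substN ρ φ)) (app (thm (∀ˢelim t)) i)))

  model⊨T : model ⊨ T
  model⊨T {ψ} x ρ X = proj₂ (truth ψ) (thm (⊢-ren X (⊢-subst ρ (ax x))))

  model⊨G₀ : ∀ {γ} → G₀ γ → Sat var (λ n → n) γ
  model⊨G₀ {γ} g = proj₂ (truth γ) (subst In (sym (trans (renS-id _ λ _ → refl) (substN-id γ λ _ → refl))) (hyp (0 , g)))

-- Δ₀ formulas with parameters and two set parameters

-- Δ₀ formulas with k variables, parameters named by C, and two set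
-- parameters, A (false) and B (true).

infixl 8 _⊞_
infixl 9 _⊠_
infix 6 _==_ _<<_
infixr 4 _⊃_
infixr 5 _∧ᵖ_

data PT (C : Set) (k : ℕ) : Set where
  v       : Fin k → PT C k
  cst     : C → PT C k
  zr on   : PT C k
  _⊞_ _⊠_ : PT C k → PT C k → PT C k

data PF (C : Set) (k : ℕ) : Set where
  ff        : PF C k
  _==_ _<<_ : PT C k → PT C k → PF C k
  mem       : PT C k → Bool → PF C k
  _⊃_       : PF C k → PF C k → PF C k
  all<      : PT C k → PF C (suc k) → PF C k

neg : ∀ {C k} → PF C k → PF C k
neg φ = φ ⊃ ff

_∧ᵖ_ : ∀ {C k} → PF C k → PF C k → PF C k
φ ∧ᵖ ψ = neg (φ ⊃ neg ψ)

ex< : ∀ {C k} → PT C k → PF C (suc k) → PF C k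
ex< t φ = neg (all< t (neg φ))

#0 : ∀ {C k} → PT C (suc k)
#0 = v zero
#1 : ∀ {C k} → PT C (suc (suc k))
#1 = v (suc zero)
#2 : ∀ {C k} → PT C (suc (suc (suc k)))
#2 = v (suc (suc zero))
#3 : ∀ {C k} → PT C (suc (suc (suc (suc k))))
#3 = v (suc (suc (suc zero)))
wkP : ∀ {C k} → PT C k → PT C (suc k)
wkP (v i) = v (suc i)
wkP (cst c) = cst c
wkP zr = zr
wkP on = on
wkP (s ⊞ t) = wkP s ⊞ wkP t
wkP (s ⊠ t) = wkP s ⊠ wkP t

subP : ∀ {C C' k m} → (Fin k → PT C' m) → (C → PT C' m) → PT C k → PT C' m
subP σ ν (v i) = σ i
subP σ ν (cst c) = ν c
subP σ ν zr = zr
subP σ ν on = on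
subP σ ν (s ⊞ t) = subP σ ν s ⊞ subP σ ν t
subP σ ν (s ⊠ t) = subP σ ν s ⊠ subP σ ν t

liftP : ∀ {C k m} → (Fin k → PT C m) → Fin (suc k) → PT C (suc m)
liftP σ zero = v zero
liftP σ (suc i) = wkP (σ i)

sub : ∀ {C C' k m} → (Fin k → PT C' m) → (C → PT C' m) → PF C k → PF C' m
sub σ ν ff = ff
sub σ ν (s == t) = subP σ ν s == subP σ ν t
sub σ ν (s << t) = subP σ ν s << subP σ ν t
sub σ ν (mem t b) = mem (subP σ ν t) b
sub σ ν (φ ⊃ ψ) = sub σ ν φ ⊃ sub σ ν ψ
sub σ ν (all< t φ) = all< (subP σ ν t) (sub (liftP σ) (λ c → wkP (ν c)) φ)

mapC : ∀ {C C' k} → (C → C') → PF C k → PF C' k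
mapC f = sub v (λ c → cst (f c))

toTm : ∀ {n k} → PT (Fin n) k → Tm
toTm (v i) = var (toℕ i)
toTm {k = k} (cst j) = var (k +ℕ toℕ j)
toTm zr = zer
toTm on = one
toTm (s ⊞ t) = toTm s ⊕ toTm t
toTm (s ⊠ t) = toTm s ⊗ toTm t

setix : Bool → ℕ
setix false = 0
setix true = 1

toFm : ∀ {n k} → PF (Fin n) k → Fm
toFm ff = ⊥'
toFm (s == t) = toTm s ≐ toTm t
toFm (s << t) = toTm s ≺ toTm t
toFm (mem t b) = toTm t ∈' setix b
toFm (φ ⊃ ψ) = toFm φ ⇒ toFm ψ
toFm (all< t φ) = ∀ⁿ (var 0 ≺ wkT (toTm t) ⇒ toFm φ)

toFm-Δ₀ : ∀ {n k} (φ : PF (Fin n) k) → Δ₀ (toFm φ)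
toFm-Δ₀ ff = d⊥
toFm-Δ₀ (s == t) = d≐ _ _
toFm-Δ₀ (s << t) = d≺ _ _
toFm-Δ₀ (mem t b) = d∈ _ _
toFm-Δ₀ (φ ⊃ ψ) = d⇒ (toFm-Δ₀ φ) (toFm-Δ₀ ψ)
toFm-Δ₀ (all< t φ) = d∀< (toTm t) (toFm-Δ₀ φ)

infixr 5 _++ᵉ_
_++ᵉ_ : ∀ {A : Set} {k} → Vec A k → (ℕ → A) → ℕ → A
[] ++ᵉ f = f
(x ∷ e) ++ᵉ f = x ◂ (e ++ᵉ f)

++ᵉ-lookup : ∀ {A : Set} {k} (e : Vec A k) f i → (e ++ᵉ f) (toℕ i) ≡ lookup e i
++ᵉ-lookup (x ∷ e) f zero = refl
++ᵉ-lookup (x ∷ e) f (suc i) = ++ᵉ-lookup e f i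

++ᵉ-drop : ∀ {A : Set} {k} (e : Vec A k) f n → (e ++ᵉ f) (k +ℕ n) ≡ f n
++ᵉ-drop [] f n = refl
++ᵉ-drop (x ∷ e) f n = ++ᵉ-drop e f n

finEnv : ∀ {A : Set} {n} → A → (Fin n → A) → ℕ → A
finEnv {n = zero} a κ _ = a
finEnv {n = suc n} a κ = κ zero ◂ finEnv a (λ i → κ (suc i))

finEnv-toℕ : ∀ {A : Set} {n} a (κ : Fin n → A) j → finEnv a κ (toℕ j) ≡ κ j
finEnv-toℕ a κ zero = refl
finEnv-toℕ a κ (suc j) = finEnv-toℕ a (λ i → κ (suc i)) j

andI : ∀ {A B : Set} → A → B → ¬ (A → ¬ B)
andI a b k = k a b

andE : ∀ {A B : Set} → Stable A → Stable B → ¬ (A → ¬ B) → A × B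
andE sa sb h = sa (λ na → h λ a _ → na a) , sb (λ nb → h λ _ b → nb b)

module Interp (M : Model) where
  open Model M

  ⟦_⟧ : ∀ {C k} → PT C k → (C → D) → Vec D k → D
  ⟦ v i ⟧ κ e = lookup e i
  ⟦ cst c ⟧ κ e = κ c
  ⟦ zr ⟧ κ e = 0#
  ⟦ on ⟧ κ e = 1#
  ⟦ s ⊞ t ⟧ κ e = ⟦ s ⟧ κ e + ⟦ t ⟧ κ e
  ⟦ s ⊠ t ⟧ κ e = ⟦ s ⟧ κ e * ⟦ t ⟧ κ e

  -- The sets are arbitrary predicates, so that one formula can be read with true sets, with a
  -- finite code in place of B, or inside the cut.
  PSat : (Bool → D → Set) → ∀ {C k} → (C → D) → Vec D k → PF C k → Set
  PSat I κ e ff = ⊥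
  PSat I κ e (s == t) = ⟦ s ⟧ κ e ≈ ⟦ t ⟧ κ e
  PSat I κ e (s << t) = ⟦ s ⟧ κ e < ⟦ t ⟧ κ e
  PSat I κ e (mem t b) = I b (⟦ t ⟧ κ e)
  PSat I κ e (φ ⊃ ψ) = PSat I κ e φ → PSat I κ e ψ
  PSat I κ e (all< t φ) = ∀ d → d < ⟦ t ⟧ κ e → PSat I κ (d ∷ e) φ

  StableI : (Bool → D → Set) → Set
  StableI I = ∀ b {x} → Stable (I b x)

  PSat-stable : ∀ {I} → StableI I → ∀ {C k} (φ : PF C k) {κ e} → Stable (PSat I κ e φ)
  PSat-stable sI ff nn = nn λ x → x
  PSat-stable sI (s == t) = ≈-stable
  PSat-stable sI (s << t) = <-stable
  PSat-stable sI (mem t b) = sI b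
  PSat-stable sI (φ ⊃ ψ) = →-stable (PSat-stable sI ψ)
  PSat-stable sI (all< t φ) = Π-stable λ _ → →-stable (PSat-stable sI φ)

  ex-i : ∀ {X : Set} {P Q : X → Set} → ∃ᶜ (λ d → P d × Q d) → ¬ (∀ d → P d → ¬ Q d)
  ex-i h k = h λ { (d , p , q) → k d p q }

  ex-e : ∀ {X : Set} {P Q : X → Set} → ¬ (∀ d → P d → ¬ Q d) → ∃ᶜ (λ d → P d × Q d)
  ex-e h k = h λ d p q → k (d , p , q)

  wkP-eval : ∀ {C k} {κ : C → D} {d} {e : Vec D k} (t : PT C k) → ⟦ wkP t ⟧ κ (d ∷ e) ≡ ⟦ t ⟧ κ e
  wkP-eval (v i) = refl
  wkP-eval (cst c) = refl
  wkP-eval zr = refl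
  wkP-eval on = refl
  wkP-eval (s ⊞ t) = cong₂ _+_ (wkP-eval s) (wkP-eval t)
  wkP-eval (s ⊠ t) = cong₂ _*_ (wkP-eval s) (wkP-eval t)

  module _ {C C' : Set} where

    subP-eval : ∀ {k m} {σ : Fin k → PT C' m} {ν : C → PT C' m} {κ κ' e e'} →
      (∀ i → ⟦ σ i ⟧ κ' e' ≡ lookup e i) → (∀ c → ⟦ ν c ⟧ κ' e' ≡ κ c) →
      ∀ t → ⟦ subP σ ν t ⟧ κ' e' ≡ ⟦ t ⟧ κ e
    subP-eval h g (v i) = h i
    subP-eval h g (cst c) = g c
    subP-eval h g zr = refl
    subP-eval h g on = refl
    subP-eval h g (s ⊞ t) = cong₂ _+_ (subP-eval h g s) (subP-eval h g t)
    subP-eval h g (s ⊠ t) = cong₂ _*_ (subP-eval h g s) (subP-eval h g t)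

    PSat-sub : ∀ {I k m} {σ : Fin k → PT C' m} {ν : C → PT C' m} {κ κ' e e'} (φ : PF C k) →
      (∀ i → ⟦ σ i ⟧ κ' e' ≡ lookup e i) → (∀ c → ⟦ ν c ⟧ κ' e' ≡ κ c) →
      PSat I κ' e' (sub σ ν φ) ⟺ PSat I κ e φ
    PSat-sub ff h g = ⟺-refl
    PSat-sub (s == t) h g = ≡⇒⟺ (cong₂ _≈_ (subP-eval h g s) (subP-eval h g t))
    PSat-sub (s << t) h g = ≡⇒⟺ (cong₂ _<_ (subP-eval h g s) (subP-eval h g t))
    PSat-sub {I} (mem t b) h g = ≡⇒⟺ (cong (I b) (subP-eval h g t))
    PSat-sub (φ ⊃ ψ) h g = →-cong (PSat-sub φ h g) (PSat-sub ψ h g)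
    PSat-sub {σ = σ} {ν} (all< t φ) h g = Π-cong λ d →
      →-cong (≡⇒⟺ (cong (d <_) (subP-eval h g t)))
        (PSat-sub φ (λ { zero → refl ; (suc i) → trans (wkP-eval (σ i)) (h i) }) (λ c → trans (wkP-eval (ν c)) (g c)))

  RespI : (Bool → D → Set) → Set
  RespI I = ∀ b {x y} → x ≈ y → I b x → I b y

  ⟦⟧-resp : ∀ {C k} {κ : C → D} {e e' : Vec D k} → (∀ i → lookup e i ≈ lookup e' i) → (t : PT C k) → ⟦ t ⟧ κ e ≈ ⟦ t ⟧ κ e'
  ⟦⟧-resp h (v i) = h i
  ⟦⟧-resp h (cst c) = ≈-refl
  ⟦⟧-resp h zr = ≈-refl
  ⟦⟧-resp h on = ≈-refl
  ⟦⟧-resp h (s ⊞ t) = +-cong (⟦⟧-resp h s) (⟦⟧-resp h t)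
  ⟦⟧-resp h (s ⊠ t) = *-cong (⟦⟧-resp h s) (⟦⟧-resp h t)

  PSat-resp : ∀ {I} → RespI I → ∀ {C k} {κ : C → D} {e e' : Vec D k} → (∀ i → lookup e i ≈ lookup e' i) → (φ : PF C k) →
    PSat I κ e φ ⟺ PSat I κ e' φ
  PSat-resp {I} r h = go h
    where
    rev : ∀ {x y} → x ≈ y → y ≈ x
    rev p = ≈-euc p ≈-refl
    go : ∀ {C k} {κ : C → D} {e e' : Vec D k} → (∀ i → lookup e i ≈ lookup e' i) → (φ : PF C k) → PSat I κ e φ ⟺ PSat I κ e' φ
    go h ff = ⟺-refl
    go h (s == t) = (λ p → ≈-euc (⟦⟧-resp h s) (≈-euc (rev p) (⟦⟧-resp h t))) ,
      (λ p → ≈-euc (rev (⟦⟧-resp h s)) (≈-euc (rev p) (rev (⟦⟧-resp h t))))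
    go h (s << t) = <-resp (⟦⟧-resp h s) (⟦⟧-resp h t) , <-resp (rev (⟦⟧-resp h s)) (rev (⟦⟧-resp h t))
    go h (mem t b) = r b (⟦⟧-resp h t) , r b (rev (⟦⟧-resp h t))
    go h (φ ⊃ ψ) = →-cong (go h φ) (go h ψ)
    go h (all< t φ) = Π-cong λ d → →-cong (<-resp ≈-refl (⟦⟧-resp h t) , <-resp ≈-refl (rev (⟦⟧-resp h t)))
      (go (λ { zero → ≈-refl ; (suc i) → h i }) φ)

  PSat-mapC : ∀ {C C' : Set} {I k} {f : C → C'} {κ : C' → D} {e : Vec D k} (φ : PF C k) →
    PSat I κ e (mapC f φ) ⟺ PSat I (λ c → κ (f c)) e φ
  PSat-mapC φ = PSat-sub φ (λ _ → refl) (λ _ → refl)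

  PSat-κ : ∀ {C : Set} {I k} {κ κ' : C → D} {e : Vec D k} (φ : PF C k) → (∀ c → κ c ≡ κ' c) →
    PSat I κ e φ ⟺ PSat I κ' e φ
  PSat-κ {κ = κ} {e = e} φ h = ⟺-trans (⟺-sym (PSat-sub {σ = v} {ν = cst} {κ' = κ} {e' = e} φ (λ _ → refl) λ c → refl)) (PSat-sub φ (λ _ → refl) h)

  withB : S → (D → Set) → Bool → D → Set
  withB A X false x = x ∈ A
  withB A X true x = X x

  ⟪_,_⟫ : S → S → Bool → D → Set
  ⟪ A , B ⟫ = withB A (_∈ B)

  ⟪⟫-stable : ∀ {A B} → StableI ⟪ A , B ⟫
  ⟪⟫-stable false = ∈-stable
  ⟪⟫-stable true = ∈-stable

  ◂◂ : S → S → ℕ → S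
  ◂◂ A B = A ◂ B ◂ λ _ → B

  module _ {n} {κ : Fin n → D} where
    toTm-eval : ∀ {k ρ} {e : Vec D k} (t : PT (Fin n) k) → (∀ i → ρ (toℕ i) ≡ lookup e i) → (∀ j → ρ (k +ℕ toℕ j) ≡ κ j) →
      eval ρ (toTm t) ≡ ⟦ t ⟧ κ e
    toTm-eval (v i) h g = h i
    toTm-eval (cst c) h g = g c
    toTm-eval zr h g = refl
    toTm-eval on h g = refl
    toTm-eval (s ⊞ t) h g = cong₂ _+_ (toTm-eval s h g) (toTm-eval t h g)
    toTm-eval (s ⊠ t) h g = cong₂ _*_ (toTm-eval s h g) (toTm-eval t h g)

    Sat-toFm : ∀ {k ρ η A B} {e : Vec D k} (φ : PF (Fin n) k) → η 0 ≡ A → η 1 ≡ B →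
      (∀ i → ρ (toℕ i) ≡ lookup e i) → (∀ j → ρ (k +ℕ toℕ j) ≡ κ j) →
      Sat ρ η (toFm φ) ⟺ PSat ⟪ A , B ⟫ κ e φ
    Sat-toFm ff a b h g = ⟺-refl
    Sat-toFm (s == t) a b h g = ≡⇒⟺ (cong₂ _≈_ (toTm-eval s h g) (toTm-eval t h g))
    Sat-toFm (s << t) a b h g = ≡⇒⟺ (cong₂ _<_ (toTm-eval s h g) (toTm-eval t h g))
    Sat-toFm (mem t false) refl b h g = ≡⇒⟺ (cong (_∈ _) (toTm-eval t h g))
    Sat-toFm (mem t true) a refl h g = ≡⇒⟺ (cong (_∈ _) (toTm-eval t h g))
    Sat-toFm (φ ⊃ ψ) a b h g = →-cong (Sat-toFm φ a b h g) (Sat-toFm ψ a b h g)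
    Sat-toFm {k} (all< t φ) a b h g = Π-cong λ d →
      →-cong (≡⇒⟺ (cong (d <_) (trans (eval-wk (toTm t)) (toTm-eval t h g))))
        (Sat-toFm φ a b (λ { zero → refl ; (suc i) → h i }) g)

-- A formula uses finitely many of its parameters. `toFm` can only turn names in `Fin n` into free
-- variables, so this is the bridge from elements of a model to instances of the axiom schemes.
record Finitary {C : Set} {k} (X : Set → ℕ → Set) (mp : ∀ {C C'} → (C → C') → X C k → X C' k) (x : X C k) : Set where
  constructor fin
  field
    {size} : ℕ
    names : Fin size → C
    body : X (Fin size) k
    correct : mp names body ≡ x

mapP : ∀ {C C' k} → (C → C') → PT C k → PT C' k
mapP f = subP v (λ c → cst (f c))

subP-cong : ∀ {C C' k m} {σ σ' : Fin k → PT C' m} {ν ν' : C → PT C' m} → (∀ i → σ i ≡ σ' i) → (∀ c → ν c ≡ ν' c) →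
  ∀ t → subP σ ν t ≡ subP σ' ν' t
subP-cong h g (v i) = h i
subP-cong h g (cst c) = g c
subP-cong h g zr = refl
subP-cong h g on = refl
subP-cong h g (s ⊞ t) = cong₂ _⊞_ (subP-cong h g s) (subP-cong h g t)
subP-cong h g (s ⊠ t) = cong₂ _⊠_ (subP-cong h g s) (subP-cong h g t)

sub-cong : ∀ {C C' k m} {σ σ' : Fin k → PT C' m} {ν ν' : C → PT C' m} → (∀ i → σ i ≡ σ' i) → (∀ c → ν c ≡ ν' c) →
  ∀ φ → sub σ ν φ ≡ sub σ' ν' φ
sub-cong h g ff = refl
sub-cong h g (s == t) = cong₂ _==_ (subP-cong h g s) (subP-cong h g t)
sub-cong h g (s << t) = cong₂ _<<_ (subP-cong h g s) (subP-cong h g t)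
sub-cong h g (mem t b) = cong (λ t → mem t b) (subP-cong h g t)
sub-cong h g (φ ⊃ ψ) = cong₂ _⊃_ (sub-cong h g φ) (sub-cong h g ψ)
sub-cong h g (all< t φ) = cong₂ all< (subP-cong h g t)
  (sub-cong (λ { zero → refl ; (suc i) → cong wkP (h i) }) (λ c → cong wkP (g c)) φ)

mapP-mapP : ∀ {C C' C'' k} {f : C → C'} {g : C' → C''} {h : C → C''} → (∀ c → g (f c) ≡ h c) → (t : PT C k) → mapP g (mapP f t) ≡ mapP h t
mapP-mapP p (v i) = refl
mapP-mapP p (cst c) = cong cst (p c)
mapP-mapP p zr = refl
mapP-mapP p on = refl
mapP-mapP p (s ⊞ t) = cong₂ _⊞_ (mapP-mapP p s) (mapP-mapP p t)
mapP-mapP p (s ⊠ t) = cong₂ _⊠_ (mapP-mapP p s) (mapP-mapP p t)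

liftP-v : ∀ {C k} (i : Fin (suc k)) → liftP {C} v i ≡ v i
liftP-v zero = refl
liftP-v (suc i) = refl

mapC-all< : ∀ {C C' k} (f : C → C') (t : PT C k) φ → mapC f (all< t φ) ≡ all< (mapP f t) (mapC f φ)
mapC-all< f t φ = cong (all< _) (sub-cong liftP-v (λ _ → refl) φ)

mapC-mapC : ∀ {C C' C'' k} {f : C → C'} {g : C' → C''} {h : C → C''} → (∀ c → g (f c) ≡ h c) → (φ : PF C k) → mapC g (mapC f φ) ≡ mapC h φ
mapC-mapC p ff = refl
mapC-mapC p (s == t) = cong₂ _==_ (mapP-mapP p s) (mapP-mapP p t)
mapC-mapC p (s << t) = cong₂ _<<_ (mapP-mapP p s) (mapP-mapP p t)
mapC-mapC p (mem t b) = cong (λ t → mem t b) (mapP-mapP p t)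
mapC-mapC p (φ ⊃ ψ) = cong₂ _⊃_ (mapC-mapC p φ) (mapC-mapC p ψ)
mapC-mapC {f = f} {g} {h} p (all< t φ) =
  trans (cong (mapC g) (mapC-all< f t φ)) (trans (mapC-all< g (mapP f t) (mapC f φ))
    (trans (cong₂ all< (mapP-mapP p t) (mapC-mapC p φ)) (sym (mapC-all< h t φ))))

FinT : ∀ {C k} → PT C k → Set
FinT = Finitary PT mapP

FinF : ∀ {C k} → PF C k → Set
FinF = Finitary PF mapC

join : ∀ {C : Set} {m n} → (Fin m → C) → (Fin n → C) → Fin (m +ℕ n) → C
join {m = m} f g i = [ f , g ]′ (splitAt m i)

join-↑ˡ : ∀ {C : Set} {m n} (f : Fin m → C) (g : Fin n → C) i → join f g (i ↑ˡ n) ≡ f i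
join-↑ˡ {m = m} {n} f g i = cong [ f , g ]′ (splitAt-↑ˡ m i n)

join-↑ʳ : ∀ {C : Set} {m n} (f : Fin m → C) (g : Fin n → C) i → join f g (m ↑ʳ i) ≡ g i
join-↑ʳ {m = m} {n} f g i = cong [ f , g ]′ (splitAt-↑ʳ m n i)

module _ {C : Set} where

  finT₂ : ∀ {k} {s t : PT C k} → FinT s → FinT t →
    Σ ℕ λ n → Σ (Fin n → C) λ f → Σ (PT (Fin n) k) λ s' → Σ (PT (Fin n) k) λ t' → (mapP f s' ≡ s) × (mapP f t' ≡ t)
  finT₂ (fin {m} f s refl) (fin {n} g t refl) = m +ℕ n , join f g , mapP (_↑ˡ n) s , mapP (m ↑ʳ_) t ,
    mapP-mapP (join-↑ˡ f g) s , mapP-mapP (join-↑ʳ f g) t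

  finT : ∀ {k} (t : PT C k) → FinT t
  finT (v i) = fin {size = 0} (λ ()) (v i) refl
  finT (cst c) = fin {size = 1} (λ _ → c) (cst zero) refl
  finT zr = fin {size = 0} (λ ()) zr refl
  finT on = fin {size = 0} (λ ()) on refl
  finT (s ⊞ t) with finT₂ (finT s) (finT t)
  ... | n , f , s' , t' , refl , refl = fin f (s' ⊞ t') refl
  finT (s ⊠ t) with finT₂ (finT s) (finT t)
  ... | n , f , s' , t' , refl , refl = fin f (s' ⊠ t') refl

  finF₂ : ∀ {k l} {φ : PF C k} {ψ : PF C l} → FinF φ → FinF ψ →
    Σ ℕ λ n → Σ (Fin n → C) λ f → Σ (PF (Fin n) k) λ s' → Σ (PF (Fin n) l) λ t' → (mapC f s' ≡ φ) × (mapC f t' ≡ ψ)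
  finF₂ (fin {m} f s refl) (fin {n} g t refl) = m +ℕ n , join f g , mapC (_↑ˡ n) s , mapC (m ↑ʳ_) t ,
    mapC-mapC (join-↑ˡ f g) s , mapC-mapC (join-↑ʳ f g) t

  finF : ∀ {k} (φ : PF C k) → FinF φ
  finF ff = fin {size = 0} (λ ()) ff refl
  finF (s == t) with finT₂ (finT s) (finT t)
  ... | n , f , s' , t' , refl , refl = fin f (s' == t') refl
  finF (s << t) with finT₂ (finT s) (finT t)
  ... | n , f , s' , t' , refl , refl = fin f (s' << t') refl
  finF (mem t b) with finT t
  ... | fin f t' refl = fin f (mem t' b) refl
  finF (φ ⊃ ψ) with finF₂ (finF φ) (finF ψ)
  ... | n , f , s' , t' , refl , refl = fin f (s' ⊃ t') refl
  finF (all< t φ) with finT t | finF φ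
  ... | fin {m} f s refl | fin {n} g ψ refl = fin {size = m +ℕ n} (join f g) (all< (mapP (_↑ˡ n) s) (mapC (m ↑ʳ_) ψ))
    (trans (mapC-all< (join f g) (mapP (_↑ˡ n) s) (mapC (m ↑ʳ_) ψ)) (cong₂ all< (mapP-mapP (join-↑ˡ f g) s) (mapC-mapC (join-↑ʳ f g) ψ)))

-- Induction, bounding and comprehension in semantic form

record Strong (M : Model) : Set where
  open Model M
  field
    basic : ∀ {φ} → Basic φ → Valid φ
    indΣ₂ : ∀ {φ} → Σ⁰ 2 φ → Valid (indAx φ)
    bndΣ₂ : ∀ {φ} → Σ⁰ 2 φ → Valid (bndAx φ)
    compΔ₁ : ∀ {φ ψ} → Σ⁰ 1 φ → Π⁰ 1 ψ → Valid (compAx φ ψ)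

module Principles (M : Model) (st : Strong M) (A B : Model.S M) where
  open Model M
  open Interp M
  open Strong st

  I : Bool → D → Set
  I = ⟪ A , B ⟫

  I-stable : StableI I
  I-stable = ⟪⟫-stable {A} {B}

  Sem : ∀ {k} → PF D k → Vec D k → Set
  Sem φ e = PSat I (λ d → d) e φ

  Sem-stable : ∀ {k} (φ : PF D k) {e} → Stable (Sem φ e)
  Sem-stable φ = PSat-stable (λ b → I-stable b) φ

  private
    η : ℕ → S
    η = ◂◂ A B

    penv : ∀ {n} → (Fin n → D) → ℕ → D
    penv = finEnv 0#

    toFm⟺ : ∀ {n k} (f : Fin n → D) (φ : PF (Fin n) k) (e : Vec D k) →
      Sat (e ++ᵉ penv f) η (toFm φ) ⟺ Sem (mapC f φ) e
    toFm⟺ {k = k} f φ e = ⟺-trans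
      (Sat-toFm {κ = f} φ refl refl (++ᵉ-lookup e (penv f)) (λ j → trans (++ᵉ-drop e (penv f) (toℕ j)) (finEnv-toℕ 0# f j)))
      (⟺-sym (PSat-mapC φ))

  ind2 : (θ : PF D 3) → let P = λ x → ∃ᶜ λ u → ∀ z → Sem θ (z ∷ u ∷ x ∷ []) in
    P 0# → (∀ x → P x → P (x + 1#)) → ∀ x → P x
  ind2 θ with finF θ
  ... | fin f θ' refl = λ base ps x → to x (indΣ₂ {φ} cl (penv f) η (andI
      (proj₂ (Sat-subst φ λ { zero → refl ; (suc n) → refl }) (from 0# base))
      (λ d s → proj₂ (Sat-subst φ λ { zero → refl ; (suc n) → refl }) (from (d + 1#) (ps d (to d s))))) x)
    where
    φ = ∃ⁿ (∀ⁿ (toFm θ'))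
    cl : Σ⁰ 2 φ
    cl = s∃ (sΠ (p∀ (pΣ (s0 (toFm-Δ₀ θ')))))
    to : ∀ x → Sat (x ◂ penv f) η φ → ∃ᶜ λ u → ∀ z → Sem (mapC f θ') (z ∷ u ∷ x ∷ [])
    to x h k = h λ u s → k (u , λ z → proj₁ (toFm⟺ f θ' (z ∷ u ∷ x ∷ [])) (s z))
    from : ∀ x → (∃ᶜ λ u → ∀ z → Sem (mapC f θ') (z ∷ u ∷ x ∷ [])) → Sat (x ◂ penv f) η φ
    from x h k = h λ { (u , s) → k u λ z → proj₂ (toFm⟺ f θ' (z ∷ u ∷ x ∷ [])) (s z) }

  ind0 : (θ : PF D 1) → let P = λ x → Sem θ (x ∷ []) in P 0# → (∀ x → P x → P (x + 1#)) → ∀ x → P x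
  ind0 θ base ps x = Sem-stable θ (ind2 θ' (return (0# , λ z → proj₂ (eq z 0# 0#) base))
      (λ y h → h >>= λ { (u , s) → return (0# , λ z → proj₂ (eq z 0# (y + 1#)) (ps y (proj₁ (eq 0# u y) (s 0#)))) }) x
      >>= λ { (u , s) → return (proj₁ (eq 0# u x) (s 0#)) })
    where
    θ' : PF D 3
    θ' = sub (λ _ → #2) cst θ
    eq : ∀ z u x → Sem θ' (z ∷ u ∷ x ∷ []) ⟺ Sem θ (x ∷ [])
    eq z u x = PSat-sub θ (λ { zero → refl }) (λ _ → refl)

  ind1 : (θ : PF D 2) → let P = λ x → ∃ᶜ λ w → Sem θ (w ∷ x ∷ []) in P 0# → (∀ x → P x → P (x + 1#)) → ∀ x → P x
  ind1 θ base ps x = out x (ind2 θ' (inn 0# base) (λ y h → inn (y + 1#) (ps y (out y h))) x)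
    where
    θ' : PF D 3
    θ' = sub (λ { zero → #1 ; (suc _) → #2 }) cst θ
    eq : ∀ z u x → Sem θ' (z ∷ u ∷ x ∷ []) ⟺ Sem θ (u ∷ x ∷ [])
    eq z u x = PSat-sub θ (λ { zero → refl ; (suc zero) → refl }) (λ _ → refl)
    inn : ∀ x → (∃ᶜ λ w → Sem θ (w ∷ x ∷ [])) → ∃ᶜ λ u → ∀ z → Sem θ' (z ∷ u ∷ x ∷ [])
    inn x h = h >>= λ { (w , s) → return (w , λ z → proj₂ (eq z w x) s) }
    out : ∀ x → (∃ᶜ λ u → ∀ z → Sem θ' (z ∷ u ∷ x ∷ [])) → ∃ᶜ λ w → Sem θ (w ∷ x ∷ [])
    out x h = h >>= λ { (w , s) → return (w , proj₁ (eq 0# w x) (s 0#)) }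

  coll : (θ : PF D 3) → ∀ m → (∀ i → i < m → ∃ᶜ λ j → ∀ z → Sem θ (z ∷ j ∷ i ∷ [])) →
    ∃ᶜ λ n → ∀ i → i < m → ∃ᶜ λ j → (j < n) × ∀ z → Sem θ (z ∷ j ∷ i ∷ [])
  -- The bounding axiom demands a witness for every `i`; the guard `i < m` makes the demand trivial
  -- beyond `m`, where 0 serves.
  coll θ m h with finF ((#2 << cst m) ⊃ θ)
  ... | fin f θ' e = λ k → bndΣ₂ {Φ} (sΠ (p∀ (pΣ (s0 (toFm-Δ₀ θ'))))) (penv f) η total m
        λ n b → k (n , λ i i<m k' → b i i<m λ j s → let j<n , s' = andE <-stable (Sat-stable (substN bndρ Φ)) s in
          k' (j , j<n , λ z → proj₁ (eq z j i) (proj₁ (Sat-subst Φ (env j i n)) s' z) i<m))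
    where
    Φ = ∀ⁿ (toFm θ')
    eq : ∀ z j i → Sat (z ◂ j ◂ i ◂ penv f) η (toFm θ') ⟺ (i < m → Sem θ (z ∷ j ∷ i ∷ []))
    eq z j i = subst (λ χ → Sat (z ◂ j ◂ i ◂ penv f) η (toFm θ') ⟺ Sem χ (z ∷ j ∷ i ∷ [])) e (toFm⟺ f θ' (z ∷ j ∷ i ∷ []))
    env : ∀ j i n k → eval (j ◂ i ◂ n ◂ m ◂ penv f) (bndρ k) ≡ (j ◂ i ◂ penv f) k
    env j i n zero = refl
    env j i n (suc zero) = refl
    env j i n (suc (suc k)) = refl
    total : ∀ i → ¬ (∀ j → ¬ (∀ z → Sat (z ◂ j ◂ i ◂ penv f) η (toFm θ')))
    total i k = k 0# λ z → proj₂ (eq z 0# i) λ i<m → ⊥-elim (h i i<m λ { (j , s) → k j λ z → proj₂ (eq z j i) λ _ → s z })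

  compr : (θ⁺ θ⁻ : PF D 2) →
    (∀ n → (∃ᶜ λ w → Sem θ⁺ (w ∷ n ∷ [])) ⟺ (¬ Σ D λ w → Sem θ⁻ (w ∷ n ∷ []))) →
    ∃ᶜ λ Y → ∀ n → (n ∈ Y) ⟺ (∃ᶜ λ w → Sem θ⁺ (w ∷ n ∷ []))
  compr θ⁺ θ⁻ h with finF₂ (finF θ⁺) (finF θ⁻)
  ... | n , f , a , b , refl , refl = λ k →
      compΔ₁ {φ} {ψ} (s∃ (sΠ (p0 (toFm-Δ₀ a)))) (p∀ (pΣ (s0 (d⇒ (toFm-Δ₀ b) d⊥)))) (penv f) η
        (λ n → andI (λ s w t → proj₁ (h n) (to n s) (w , proj₁ (toFm⟺ f b (w ∷ n ∷ [])) t))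
                    (λ s → from n (proj₂ (h n) λ { (w , t) → s w (proj₂ (toFm⟺ f b (w ∷ n ∷ [])) t) })))
        λ Y y → k (Y , λ n → let p , q = andE (→-stable (Sat-stable (wkS φ) {n ◂ penv f} {Y ◂ η})) (→-stable ∈-stable) (y n) in
          (λ n∈Y → to n (proj₁ (Sat-ren φ λ _ → refl) (p n∈Y))) ,
          (λ s → q (proj₂ (Sat-ren φ λ _ → refl) (from n s))))
    where
    φ = ∃ⁿ (toFm a)
    ψ = ∀ⁿ (¬' (toFm b))
    to : ∀ n → Sat (n ◂ penv f) η φ → ∃ᶜ λ w → Sem (mapC f a) (w ∷ n ∷ [])
    to n s k = s λ w t → k (w , proj₁ (toFm⟺ f a (w ∷ n ∷ [])) t)
    from : ∀ n → (∃ᶜ λ w → Sem (mapC f a) (w ∷ n ∷ [])) → Sat (n ◂ penv f) η φ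
    from n s k = s λ { (w , t) → k w (proj₂ (toFm⟺ f a (w ∷ n ∷ [])) t) }

-- Ordered semiring laws from the basic axioms

module Arithmetic (M : Model) (st : Strong M) (A : Model.S M) where
  open Model M
  open Interp M
  open Strong st
  -- The formulas of this part mention no set, so `A` fills both set parameters.
  open Principles M st A A using (ind0; ind1)

  ≈-sym : ∀ {x y} → x ≈ y → y ≈ x
  ≈-sym p = ≈-euc p ≈-refl
  ≈-trans : ∀ {x y z} → x ≈ y → y ≈ z → x ≈ z
  ≈-trans p q = ≈-euc (≈-sym p) q

  setoid : Setoid 0ℓ 0ℓ
  setoid = record { Carrier = D ; _≈_ = _≈_ ; isEquivalence = record { refl = ≈-refl ; sym = ≈-sym ; trans = ≈-trans } }
  open import Relation.Binary.Reasoning.Setoid setoid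

  private
    at₀ : D → D → ℕ → D
    at₀ x y = x ◂ y ◂ λ _ → x

  suc≉0 : ∀ {x} → ¬ (x + 1# ≈ 0#)
  suc≉0 {x} = basic b1 (at₀ x x) (λ _ → A)
  suc-inj : ∀ {x y} → x + 1# ≈ y + 1# → x ≈ y
  suc-inj {x} {y} = basic b2 (at₀ x y) (λ _ → A)
  +-idʳ : ∀ x → x + 0# ≈ x
  +-idʳ x = basic b3 (at₀ x x) (λ _ → A)
  +-suc : ∀ x y → x + (y + 1#) ≈ (x + y) + 1#
  +-suc x y = basic b4 (at₀ x y) (λ _ → A)
  *-zeroʳ : ∀ x → x * 0# ≈ 0#
  *-zeroʳ x = basic b5 (at₀ x x) (λ _ → A)
  *-suc : ∀ x y → x * (y + 1#) ≈ x * y + x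
  *-suc x y = basic b6 (at₀ x y) (λ _ → A)
  ≮0 : ∀ {x} → ¬ (x < 0#)
  ≮0 {x} = basic b7 (at₀ x x) (λ _ → A)
  <-suc⁻ : ∀ {x y} → x < y + 1# → ¬ (x < y) → x ≈ y
  <-suc⁻ {x} {y} = proj₁ (andE (→-stable (→-stable ≈-stable)) (→-stable <-stable) (basic b8 (at₀ x y) (λ _ → A)))
  <-suc⁺ : ∀ {x y} → (¬ (x < y) → x ≈ y) → x < y + 1#
  <-suc⁺ {x} {y} = proj₂ (andE (→-stable (→-stable ≈-stable)) (→-stable <-stable) (basic b8 (at₀ x y) (λ _ → A)))

  +-idˡ : ∀ x → 0# + x ≈ x
  +-idˡ = ind0 (zr ⊞ #0 == #0) (+-idʳ 0#) (λ x h → ≈-trans (+-suc 0# x) (+-cong h ≈-refl))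

  +-assoc : ∀ x y z → (x + y) + z ≈ x + (y + z)
  +-assoc x y = ind0 ((cst x ⊞ cst y) ⊞ #0 == cst x ⊞ (cst y ⊞ #0))
    (≈-trans (+-idʳ _) (+-cong ≈-refl (≈-sym (+-idʳ y))))
    (λ z h → begin
      (x + y) + (z + 1#) ≈⟨ +-suc _ _ ⟩
      ((x + y) + z) + 1# ≈⟨ +-cong h ≈-refl ⟩
      (x + (y + z)) + 1# ≈⟨ +-suc _ _ ⟨
      x + ((y + z) + 1#) ≈⟨ +-cong ≈-refl (+-suc y z) ⟨
      x + (y + (z + 1#)) ∎)

  1+ : ∀ x → 1# + x ≈ x + 1#
  1+ = ind0 (on ⊞ #0 == #0 ⊞ on) (≈-trans (+-idʳ 1#) (≈-sym (+-idˡ 1#)))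
    (λ x h → ≈-trans (+-suc 1# x) (+-cong h ≈-refl))

  +-comm : ∀ x y → x + y ≈ y + x
  +-comm x = ind0 (cst x ⊞ #0 == #0 ⊞ cst x) (≈-trans (+-idʳ x) (≈-sym (+-idˡ x)))
    (λ y h → begin
      x + (y + 1#) ≈⟨ +-suc x y ⟩
      (x + y) + 1# ≈⟨ +-cong h ≈-refl ⟩
      (y + x) + 1# ≈⟨ +-suc y x ⟨
      y + (x + 1#) ≈⟨ +-cong ≈-refl (1+ x) ⟨
      y + (1# + x) ≈⟨ +-assoc y 1# x ⟨
      (y + 1#) + x ∎)

  distribˡ : ∀ x y z → x * (y + z) ≈ x * y + x * z
  distribˡ x y = ind0 (cst x ⊠ (cst y ⊞ #0) == cst x ⊠ cst y ⊞ cst x ⊠ #0)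
    (≈-trans (*-cong ≈-refl (+-idʳ y)) (≈-trans (≈-sym (+-idʳ _)) (+-cong ≈-refl (≈-sym (*-zeroʳ x)))))
    (λ z h → begin
      x * (y + (z + 1#)) ≈⟨ *-cong ≈-refl (+-suc y z) ⟩
      x * ((y + z) + 1#) ≈⟨ *-suc _ _ ⟩
      x * (y + z) + x ≈⟨ +-cong h ≈-refl ⟩
      (x * y + x * z) + x ≈⟨ +-assoc _ _ _ ⟩
      x * y + (x * z + x) ≈⟨ +-cong ≈-refl (*-suc x z) ⟨
      x * y + x * (z + 1#) ∎)

  *-zeroˡ : ∀ x → 0# * x ≈ 0#
  *-zeroˡ = ind0 (zr ⊠ #0 == zr) (*-zeroʳ 0#) (λ x h → ≈-trans (*-suc 0# x) (≈-trans (+-idʳ _) h))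

  *-idʳ : ∀ x → x * 1# ≈ x
  *-idʳ x = begin
    x * 1# ≈⟨ *-cong ≈-refl (+-idˡ 1#) ⟨
    x * (0# + 1#) ≈⟨ *-suc x 0# ⟩
    x * 0# + x ≈⟨ +-cong (*-zeroʳ x) ≈-refl ⟩
    0# + x ≈⟨ +-idˡ x ⟩
    x ∎

  suc-* : ∀ y x → (y + 1#) * x ≈ y * x + x
  suc-* y = ind0 ((cst y ⊞ on) ⊠ #0 == cst y ⊠ #0 ⊞ #0)
    (≈-trans (*-zeroʳ _) (≈-sym (≈-trans (+-idʳ _) (*-zeroʳ y))))
    (λ x h → begin
      (y + 1#) * (x + 1#) ≈⟨ *-suc _ _ ⟩
      (y + 1#) * x + (y + 1#) ≈⟨ +-cong h ≈-refl ⟩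
      (y * x + x) + (y + 1#) ≈⟨ +-assoc _ _ _ ⟩
      y * x + (x + (y + 1#)) ≈⟨ +-cong ≈-refl (≈-trans (≈-sym (+-assoc x y 1#)) (≈-trans (+-cong (+-comm x y) ≈-refl) (+-assoc y x 1#))) ⟩
      y * x + (y + (x + 1#)) ≈⟨ +-assoc _ _ _ ⟨
      (y * x + y) + (x + 1#) ≈⟨ +-cong (*-suc y x) ≈-refl ⟨
      y * (x + 1#) + (x + 1#) ∎)

  *-comm : ∀ x y → x * y ≈ y * x
  *-comm x = ind0 (cst x ⊠ #0 == #0 ⊠ cst x) (≈-trans (*-zeroʳ x) (≈-sym (*-zeroˡ x)))
    (λ y h → ≈-trans (*-suc x y) (≈-trans (+-cong h ≈-refl) (≈-sym (suc-* y x))))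

  *-assoc : ∀ x y z → (x * y) * z ≈ x * (y * z)
  *-assoc x y = ind0 ((cst x ⊠ cst y) ⊠ #0 == cst x ⊠ (cst y ⊠ #0))
    (≈-trans (*-zeroʳ _) (≈-sym (≈-trans (*-cong ≈-refl (*-zeroʳ y)) (*-zeroʳ x))))
    (λ z h → begin
      (x * y) * (z + 1#) ≈⟨ *-suc _ _ ⟩
      (x * y) * z + x * y ≈⟨ +-cong h ≈-refl ⟩
      x * (y * z) + x * y ≈⟨ distribˡ x (y * z) y ⟨
      x * (y * z + y) ≈⟨ *-cong ≈-refl (*-suc y z) ⟨
      x * (y * (z + 1#)) ∎)

  semiring : CommutativeSemiring 0ℓ 0ℓ
  semiring = record
    { Carrier = D ; _≈_ = _≈_ ; _+_ = _+_ ; _*_ = _*_ ; 0# = 0# ; 1# = 1#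
    ; isCommutativeSemiring = record
      { isSemiring = record
        { isSemiringWithoutAnnihilatingZero = record
          { +-isCommutativeMonoid = record
            { isMonoid = record
              { isSemigroup = record
                { isMagma = record { isEquivalence = Setoid.isEquivalence setoid ; ∙-cong = +-cong }
                ; assoc = +-assoc }
              ; identity = +-idˡ , +-idʳ }
            ; comm = +-comm }
          ; *-cong = *-cong
          ; *-assoc = *-assoc
          ; *-identity = (λ x → ≈-trans (*-comm 1# x) (*-idʳ x)) , *-idʳ
          ; distrib = distribˡ , (λ x y z → ≈-trans (*-comm (y + z) x) (≈-trans (distribˡ x y z) (+-cong (*-comm x y) (*-comm x z))))
          }
        ; zero = *-zeroˡ , *-zeroʳ }
      ; *-comm = *-comm } }

  open import Algebra.Solver.Ring.NaturalCoefficients.Default semiring public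
    using (solve; _:+_; _:*_; con; _:=_)

  +-cancelʳ : ∀ {x y} z → x + z ≈ y + z → x ≈ y
  +-cancelʳ {x} {y} = ind0 ((cst x ⊞ #0 == cst y ⊞ #0) ⊃ (cst x == cst y))
    (λ p → ≈-trans (≈-sym (+-idʳ x)) (≈-trans p (+-idʳ y)))
    (λ z h p → h (suc-inj (≈-trans (≈-sym (+-suc x z)) (≈-trans p (+-suc y z)))))

  +-cancelˡ : ∀ {x y} z → z + x ≈ z + y → x ≈ y
  +-cancelˡ {x} {y} z p = +-cancelʳ z (≈-trans (+-comm x z) (≈-trans p (+-comm z y)))

  infix 4 _≤_
  _≤_ : D → D → Set
  x ≤ y = ¬ (y < x)

  -- Subtraction by induction on `y`; the difference is an existential witness, whence `ind1`.
  <⇒∃ : ∀ {x y} → x < y → ∃ᶜ λ d → x + (d + 1#) ≈ y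
  <⇒∃ {x} {y} x<y = ind1 ((cst x << #1) ⊃ (cst x ⊞ (#0 ⊞ on) == #1))
    (return (0# , λ p → ⊥-elim (≮0 p)))
    (λ y h → h >>= λ { (d , p) → lem {A = x < y} >>= λ where
      (inj₁ q) → return (d + 1# , λ _ → ≈-trans (+-suc x (d + 1#)) (+-cong (p q) ≈-refl))
      (inj₂ q) → return (0# , λ r → ≈-trans (+-cong ≈-refl (+-idˡ 1#)) (+-cong (<-suc⁻ r q) ≈-refl)) })
    y >>= λ { (d , p) → return (d , p x<y) }

  x<x+1 : ∀ {x} → x < x + 1#
  x<x+1 = <-suc⁺ λ _ → ≈-refl

  <-step : ∀ {x y} → x < y → x < y + 1#
  <-step p = <-suc⁺ λ n → ⊥-elim (n p)

  ∃⇒< : ∀ {x y} d → x + (d + 1#) ≈ y → x < y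
  ∃⇒< {x} {y} d p = <-resp ≈-refl p (ind0 (cst x << cst x ⊞ (#0 ⊞ on))
    (<-resp ≈-refl (+-cong ≈-refl (≈-sym (+-idˡ 1#))) x<x+1)
    (λ d h → <-resp ≈-refl (≈-sym (+-suc x (d + 1#))) (<-step h)) d)

  <-trans : ∀ {x y z} → x < y → y < z → x < z
  <-trans {x} p q = <-stable (<⇒∃ p >>= λ { (d , dp) → <⇒∃ q >>= λ { (e , ep) →
    return (∃⇒< (d + 1# + e) (≈-trans (solve 3 (λ x d e → x :+ (d :+ con 1 :+ e :+ con 1) := x :+ (d :+ con 1) :+ (e :+ con 1)) ≈-refl x d e)
      (≈-trans (+-cong dp ≈-refl) ep))) } })

  <-irrefl : ∀ {x y} → x ≈ y → ¬ (x < y)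
  <-irrefl {x} e p = <⇒∃ p λ { (d , q) → suc≉0 {d} (+-cancelˡ x (≈-trans q (≈-trans (≈-sym e) (≈-sym (+-idʳ x))))) }

  pos : ∀ x → ¬ (x ≈ 0#) → 0# < x
  pos = ind0 (neg (#0 == zr) ⊃ (zr << #0)) (λ n → ⊥-elim (n ≈-refl)) (λ x _ _ → 0<suc x)
    where
    0<suc : ∀ x → 0# < x + 1#
    0<suc = ind0 (zr << #0 ⊞ on) x<x+1 (λ _ → <-step)

  0or+1 : ∀ x → ¬ ¬ ((x ≈ 0#) ⊎ Σ D λ d → d + 1# ≈ x)
  0or+1 x = lem {A = x ≈ 0#} >>= λ where
    (inj₁ e) → return (inj₁ e)
    (inj₂ n) → <⇒∃ (pos x n) >>= λ { (d , p) → return (inj₂ (d , ≈-trans (≈-sym (+-idˡ _)) p)) }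

  tri : ∀ x y → ¬ (x < y) → ¬ (x ≈ y) → y < x
  tri x = ind0 (neg (cst x << #0) ⊃ neg (cst x == #0) ⊃ (#0 << cst x)) (λ _ → pos x)
    (λ y h n m → <-stable (<⇒∃ (h (λ p → n (<-step p)) (λ e → n (<-resp (≈-sym e) ≈-refl x<x+1))) >>= λ { (d , p) →
      0or+1 d >>= λ where
        (inj₁ e) → ⊥-elim (m (≈-trans (≈-sym p) (+-cong ≈-refl (≈-trans (+-cong e ≈-refl) (+-idˡ 1#)))))
        (inj₂ (f , q)) → return (∃⇒< f (≈-trans (solve 2 (λ y f → y :+ con 1 :+ (f :+ con 1) := y :+ (f :+ con 1 :+ con 1)) ≈-refl y f)
          (≈-trans (+-cong ≈-refl (+-cong q ≈-refl)) p))) }))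

  ≤-reflexive : ∀ {x y} → x ≈ y → x ≤ y
  ≤-reflexive e = <-irrefl (≈-sym e)

  ≤-refl : ∀ {x} → x ≤ x
  ≤-refl = ≤-reflexive ≈-refl

  <⇒≤ : ∀ {x y} → x < y → x ≤ y
  <⇒≤ p q = <-irrefl ≈-refl (<-trans p q)

  <-≤-trans : ∀ {x y z} → x < y → y ≤ z → x < z
  <-≤-trans {x} {y} {z} p q = em <-stable (λ e → <-resp ≈-refl (≈-sym e) p) (λ n → <-trans p (tri z y q n))

  ≤-<-trans : ∀ {x y z} → x ≤ y → y < z → x < z
  ≤-<-trans {x} {y} {z} p q = em <-stable (λ e → <-resp e ≈-refl q) (λ n → <-trans (tri y x p n) q)

  ≤-trans : ∀ {x y z} → x ≤ y → y ≤ z → x ≤ z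
  ≤-trans p q r = p (≤-<-trans q r)

  ≤⇒<+1 : ∀ {x y} → x ≤ y → x < y + 1#
  ≤⇒<+1 p = ≤-<-trans p x<x+1

  <+1⇒≤ : ∀ {x y} → x < y + 1# → x ≤ y
  <+1⇒≤ p q = <-irrefl (≈-sym (<-suc⁻ p λ s → <-irrefl ≈-refl (<-trans q s))) q

  ≤⇒∃ : ∀ {x y} → x ≤ y → ∃ᶜ λ d → x + d ≈ y
  ≤⇒∃ {x} {y} p = <⇒∃ (≤⇒<+1 p) >>= λ { (d , q) → return (d , suc-inj (≈-trans (≈-sym (+-suc x d)) q)) }

  ∃⇒≤ : ∀ {x y} d → x + d ≈ y → x ≤ y
  ∃⇒≤ {x} d p = <+1⇒≤ (∃⇒< d (≈-trans (+-suc x d) (+-cong p ≈-refl)))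

  <⇒+1≤ : ∀ {x y} → x < y → x + 1# ≤ y
  <⇒+1≤ p q = <+1⇒≤ q p

  +1≤⇒< : ∀ {x y} → x + 1# ≤ y → x < y
  +1≤⇒< p = <-≤-trans x<x+1 p

  0≤ : ∀ {x} → 0# ≤ x
  0≤ = ≮0

  ≤-total : ∀ x y → ¬ ¬ ((x ≤ y) ⊎ (y ≤ x))
  ≤-total x y k = k (inj₁ λ p → k (inj₂ (<⇒≤ p)))

  max : ∀ x y → ∃ᶜ λ z → (x ≤ z) × (y ≤ z)
  max x y = ≤-total x y >>= λ where
    (inj₁ p) → return (y , p , ≤-refl)
    (inj₂ p) → return (x , ≤-refl , p)

  ≤-antisym : ∀ {x y} → x ≤ y → y ≤ x → x ≈ y
  ≤-antisym {x} {y} p q = ≈-stable λ n → p (tri x y q n)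

  +-mono-≤ : ∀ {x x' y y'} → x ≤ x' → y ≤ y' → x + y ≤ x' + y'
  +-mono-≤ {x} {x'} {y} {y'} p q r = ≤⇒∃ p λ { (d , a) → ≤⇒∃ q λ { (e , b) → ∃⇒≤ (d + e)
    (≈-trans (solve 4 (λ x y d e → x :+ y :+ (d :+ e) := x :+ d :+ (y :+ e)) ≈-refl x y d e) (+-cong a b)) r } }

  *-mono-≤ : ∀ {x x' y y'} → x ≤ x' → y ≤ y' → x * y ≤ x' * y'
  *-mono-≤ {x} {x'} {y} {y'} p q r = ≤⇒∃ p λ { (d , a) → ≤⇒∃ q λ { (e , b) → ∃⇒≤ (d * y + x * e + d * e)
    (≈-trans (solve 4 (λ x y d e → x :* y :+ (d :* y :+ x :* e :+ d :* e) := (x :+ d) :* (y :+ e)) ≈-refl x y d e) (*-cong a b)) r } }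

  x≤x+y : ∀ x y → x ≤ x + y
  x≤x+y x y = ∃⇒≤ y ≈-refl

  y≤x+y : ∀ x y → y ≤ x + y
  y≤x+y x y = ∃⇒≤ x (+-comm y x)

  ≤-resp : ∀ {x x' y y'} → x ≈ x' → y ≈ y' → x ≤ y → x' ≤ y'
  ≤-resp p q r s = r (<-resp (≈-sym q) (≈-sym p) s)

-- Coded finite sets and recursion along them

-- A finite set is coded by a pair (a , b): t belongs to it when 1 + (t + 1) b divides a.

-- The quotient is bounded by `a` because the divisors to which this is applied are successors.
divF : ∀ {C k} → PT C k → PT C k → PF C k
divF p a = ex< (a ⊞ on) (wkP p ⊠ #0 == wkP a)

moduF : ∀ {C k} → PT C k → PT C k → PT C k
moduF b t = ((t ⊞ on) ⊠ b) ⊞ on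

codeF : ∀ {C k} → PT C k → PT C k → PT C k → PF C k
codeF a b t = divF (moduF b t) a

-- Answering the queries to B from a code keeps the formula Δ₀, which makes "this code obeys the
-- recursion" accessible to induction.
byCode : ∀ {C k} → PT C k → PT C k → PF C k → PF C k
byCode a b ff = ff
byCode a b (s == t) = s == t
byCode a b (s << t) = s << t
byCode a b (mem t false) = mem t false
byCode a b (mem t true) = codeF a b t
byCode a b (φ ⊃ ψ) = byCode a b φ ⊃ byCode a b ψ
byCode a b (all< t φ) = all< t (byCode (wkP a) (wkP b) φ)

iffF : ∀ {C k} → PF C k → PF C k → PF C k
iffF φ ψ = (φ ⊃ ψ) ∧ᵖ (ψ ⊃ φ)

module Coding (M : Model) (st : Strong M) (A : Model.S M) where
  open Model M
  open Interp M
  open Principles M st A A using (ind0; ind1; ind2; Sem; Sem-stable; compr)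
  open Arithmetic M st A

  Div : D → D → Set
  Div p a = ∃ᶜ λ k → p * k ≈ a

  Div-resp : ∀ {p p' a a'} → p ≈ p' → a ≈ a' → Div p a → Div p' a'
  Div-resp e f h = h >>= λ { (k , q) → return (k , ≈-trans (*-cong (≈-sym e) ≈-refl) (≈-trans q f)) }

  Div-mul : ∀ {p a} c → Div p a → Div p (c * a)
  Div-mul {p} c h = h >>= λ { (k , q) → return (c * k ,
    ≈-trans (solve 3 (λ p c k → p :* (c :* k) := c :* (p :* k)) ≈-refl p c k) (*-cong ≈-refl q)) }

  Div-self : ∀ {p} z → Div p (p * z)
  Div-self z = return (z , ≈-refl)

  +≈0ˡ : ∀ {x y} → x + y ≈ 0# → x ≈ 0#
  +≈0ˡ {x} {y} e = ≤-antisym (≤-resp ≈-refl e (x≤x+y x y)) 0≤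

  Div-diff : ∀ {p a b} → Div p a → Div p (a + b) → Div p b
  Div-diff {p} {a} {b} h g = h >>= λ { (k , hk) → g >>= λ { (l , gl) → ≤-total k l >>= λ where
    (inj₁ k≤l) → ≤⇒∃ k≤l >>= λ { (e , q) → return (e , +-cancelˡ a (≈-trans (+-cong (≈-sym hk) ≈-refl)
      (≈-trans (≈-sym (distribˡ p k e)) (≈-trans (*-cong ≈-refl q) gl)))) }
    (inj₂ l≤k) → ≤⇒∃ l≤k >>= λ { (e , q) → return (0# , ≈-trans (*-zeroʳ p) (≈-sym (+≈0ˡ {y = p * e} (+-cancelˡ a
      (≈-trans (≈-sym (+-assoc a b (p * e))) (≈-trans (+-cong (≈-sym gl) ≈-refl) (≈-trans (≈-sym (distribˡ p l e))
        (≈-trans (*-cong ≈-refl q) (≈-trans hk (≈-sym (+-idʳ a))))))))))) } } }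

  modu : D → D → D
  modu b t = (t + 1#) * b + 1#

  Code : D → D → D → Set
  Code a b t = Div (modu b t) a

  -- Coprimality is expressed as cancellation, so no gcd has to be developed. Here it holds because
  -- `modu b t * z` is `(t + 1) * (b * z) + z`.
  coprime-b : ∀ {b t z} → Div (modu b t) (b * z) → Div (modu b t) z
  coprime-b {b} {t} {z} h = Div-diff (Div-mul (t + 1#) h)
    (return (z , solve 3 (λ t b z → ((t :+ con 1) :* b :+ con 1) :* z := (t :+ con 1) :* (b :* z) :+ z) ≈-refl t b z))

  coprime-d : ∀ {b t d w} → Div d b → Div (modu b t) (d * w) → Div (modu b t) w
  coprime-d {b} {t} {d} {w} h g = h >>= λ { (k , q) → coprime-b {b} {t} (Div-resp ≈-refl
    (≈-trans (solve 3 (λ d k w → k :* (d :* w) := d :* k :* w) ≈-refl d k w) (*-cong q ≈-refl)) (Div-mul k g)) }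

  Common : D → D → Set
  Common N b = ∀ d → d < N → Div (d + 1#) b

  -- The argument behind Gödel's β-function: the two moduli differ by `(d + 1) * b` with `d < N`,
  -- and both factors can be cancelled, the first because `d + 1` divides `b`.
  pairwise : ∀ {N b s t z} → Common N b → s < N → t < N → ¬ (s ≈ t) →
    Div (modu b t) (modu b s * z) → Div (modu b t) z
  pairwise {N} {b} {s} {t} {z} cm s<N t<N s≉t h = lem {A = s < t} >>= λ where
      (inj₁ s<t) → <⇒∃ s<t >>= λ { (d , e) → fin' d (≤-<-trans (≤-trans (x≤x+y d 1#) (≤-resp ≈-refl e (y≤x+y s (d + 1#)))) t<N)
        (Div-diff h (return (z , ≈-trans (*-cong (+-cong (*-cong (+-cong (≈-sym e) ≈-refl) ≈-refl) ≈-refl) ≈-refl)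
          (solve 4 (λ s d b z → ((s :+ (d :+ con 1) :+ con 1) :* b :+ con 1) :* z := ((s :+ con 1) :* b :+ con 1) :* z :+ (d :+ con 1) :* (b :* z)) ≈-refl s d b z)))) }
      (inj₂ s≮t) → <⇒∃ (tri s t s≮t s≉t) >>= λ { (d , e) → fin' d (≤-<-trans (≤-trans (x≤x+y d 1#) (≤-resp ≈-refl e (y≤x+y t (d + 1#)))) s<N)
        (Div-diff (Div-self z) (Div-resp ≈-refl (≈-trans (*-cong (+-cong (*-cong (+-cong (≈-sym e) ≈-refl) ≈-refl) ≈-refl) ≈-refl)
          (solve 4 (λ s d b z → ((s :+ (d :+ con 1) :+ con 1) :* b :+ con 1) :* z := ((s :+ con 1) :* b :+ con 1) :* z :+ (d :+ con 1) :* (b :* z)) ≈-refl t d b z)) h)) }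
    where
    fin' : ∀ d → d < N → Div (modu b t) ((d + 1#) * (b * z)) → Div (modu b t) z
    fin' d d<N g = coprime-b {b} {t} (coprime-d {b} {t} (cm d d<N) g)

  ∤1 : ∀ {b t} → ¬ (b ≈ 0#) → ¬ Div (modu b t) 1#
  ∤1 {b} {t} b≉0 h = h λ { (k , q) → 0or+1 k λ where
      (inj₁ k≈0) → suc≉0 (≈-trans (+-idˡ 1#) (≈-trans (≈-sym q) (≈-trans (*-cong ≈-refl k≈0) (*-zeroʳ _))))
      (inj₂ (l , e)) → big (≤-resp ≈-refl (≈-trans (*-cong ≈-refl e) q)
        (≤-resp ≈-refl (solve 2 (λ m l → m :+ m :* l := m :* (l :+ con 1)) ≈-refl (modu b t) l) (x≤x+y _ _))) }
    where
    big : ¬ (modu b t ≤ 1#)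
    big p = p (≤-<-trans (≤-reflexive (≈-sym (+-idˡ 1#))) (<-resp ≈-refl ≈-refl
      (+-mono-< (<-≤-trans (pos b b≉0) (≤-resp ≈-refl (solve 2 (λ t b → b :+ t :* b := (t :+ con 1) :* b) ≈-refl t b) (x≤x+y b (t * b)))))))
      where
      +-mono-< : ∀ {x y} → x < y → x + 1# < y + 1#
      +-mono-< q = ≤⇒<+1 (<⇒+1≤ q)

  divF-sat : ∀ {I C k} {κ : C → D} {e : Vec D k} p a → ¬ (⟦ p ⟧ κ e ≈ 0#) →
    PSat I κ e (divF p a) ⟺ Div (⟦ p ⟧ κ e) (⟦ a ⟧ κ e)
  divF-sat {I} {κ = κ} {e} p a p≉0 =
    (λ s → ex-e s >>= λ { (k , _ , q) → return (k , subst₂ (λ x y → x * k ≈ y) (wkP-eval p) (wkP-eval a) q) }) ,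
    (λ h → ex-i (h >>= λ { (k , q) → return (k ,
      ≤⇒<+1 (≤-resp (≈-trans (*-comm _ _) (*-idʳ k)) q (*-mono-≤ (≤-resp (+-idˡ 1#) ≈-refl (<⇒+1≤ (pos _ p≉0))) ≤-refl)) ,
      subst₂ (λ x y → x * k ≈ y) (sym (wkP-eval p)) (sym (wkP-eval a)) q) }))

  codeF-sat : ∀ {I C k} {κ : C → D} {e : Vec D k} a b t → PSat I κ e (codeF a b t) ⟺ Code (⟦ a ⟧ κ e) (⟦ b ⟧ κ e) (⟦ t ⟧ κ e)
  codeF-sat {I} a b t = divF-sat {I} (moduF b t) a suc≉0

  byCode-sat : ∀ {X C k} {κ : C → D} {e : Vec D k} {a' b'} a b → ⟦ a ⟧ κ e ≡ a' → ⟦ b ⟧ κ e ≡ b' → (φ : PF C k) →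
    PSat (withB A X) κ e (byCode a b φ) ⟺ PSat (withB A (Code a' b')) κ e φ
  byCode-sat a b p q ff = ⟺-refl
  byCode-sat a b p q (s == t) = ⟺-refl
  byCode-sat a b p q (s << t) = ⟺-refl
  byCode-sat a b p q (mem t false) = ⟺-refl
  byCode-sat {X} a b refl refl (mem t true) = codeF-sat {withB A X} a b t
  byCode-sat a b p q (φ ⊃ ψ) = →-cong (byCode-sat a b p q φ) (byCode-sat a b p q ψ)
  byCode-sat a b p q (all< t φ) = Π-cong λ d → →-cong ⟺-refl (byCode-sat (wkP a) (wkP b) (trans (wkP-eval a) p) (trans (wkP-eval b) q) φ)

  -- The witness grows like a factorial; it is only asserted to exist, so `ind1` replaces a
  -- definition by recursion.
  common : ∀ N → ∃ᶜ λ b → ¬ (b ≈ 0#) × Common N b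
  common N = ind1 θ (return (1# , andI (λ e → suc≉0 (≈-trans (+-idˡ 1#) e)) (λ d p → ⊥-elim (≮0 p))))
    (λ x h → h >>= λ { (b , s) → let b≉0 , cm = from b x s in
      return (b * (x + 1#) , to (b * (x + 1#)) (x + 1#)
        (λ e → 0or+1 b λ { (inj₁ z) → b≉0 z ; (inj₂ (c , q)) → suc≉0 {c * (x + 1#) + x}
           (≈-trans (solve 2 (λ c x → c :* (x :+ con 1) :+ x :+ con 1 := (c :+ con 1) :* (x :+ con 1)) ≈-refl c x) (≈-trans (*-cong q ≈-refl) e)) })
        (λ d d<x+1 → lem {A = d < x} >>= λ where
          (inj₁ d<x) → Div-resp ≈-refl (*-comm _ _) (Div-mul (x + 1#) (cm d d<x))
          (inj₂ d≮x) → return (b , ≈-trans (*-cong (+-cong (<-suc⁻ d<x+1 d≮x) ≈-refl) ≈-refl) (*-comm _ _)))) })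
    N >>= λ { (b , s) → return (b , from b N s) }
    where
    θ : PF D 2
    θ = neg (#0 == zr) ∧ᵖ all< #1 (divF (#0 ⊞ on) #1)
    from : ∀ b x → Sem θ (b ∷ x ∷ []) → ¬ (b ≈ 0#) × Common x b
    from b x s = let p , q = andE ¬-stable (Sem-stable (all< #1 (divF (#0 ⊞ on) #1)) {b ∷ x ∷ []}) s in
      p , λ d d<x → proj₁ (divF-sat {⟪ A , A ⟫} {κ = λ d → d} {e = d ∷ b ∷ x ∷ []} (#0 ⊞ on) #1 suc≉0) (q d d<x)
    to : ∀ b x → ¬ (b ≈ 0#) → Common x b → Sem θ (b ∷ x ∷ [])
    to b x p q = andI p λ d d<x → proj₂ (divF-sat {⟪ A , A ⟫} {κ = λ d → d} {e = d ∷ b ∷ x ∷ []} (#0 ⊞ on) #1 suc≉0) (q d d<x)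

  module Recursion (Θ : PF D 1)
    (local : ∀ (X Y : D → Set) s → (∀ t → t < s → X t ⟺ Y t) →
      PSat (withB A X) (λ d → d) (s ∷ []) Θ → PSat (withB A Y) (λ d → d) (s ∷ []) Θ) where

    Th : (D → Set) → D → Set
    Th X s = PSat (withB A X) (λ d → d) (s ∷ []) Θ

    local⟺ : ∀ {X Y s} → (∀ t → t < s → X t ⟺ Y t) → Th X s ⟺ Th Y s
    local⟺ h = local _ _ _ h , local _ _ _ (λ t p → ⟺-sym (h t p))

    Good : D → D → D → Set
    Good a b N = ∀ s → s < N → Code a b s ⟺ Th (Code a b) s

    Th-stable : ∀ {a b s} → Stable (Th (Code a b) s)
    Th-stable = PSat-stable (λ { false → ∈-stable ; true → ¬-stable }) Θ

    Th-resp : ∀ {a b s t} → s ≈ t → Th (Code a b) s → Th (Code a b) t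
    Th-resp e = proj₁ (PSat-resp (λ { false → ∈-resp ; true p → Div-resp (+-cong (*-cong (+-cong p ≈-refl) ≈-refl) ≈-refl) ≈-refl })
      (λ { zero → e }) Θ)

    thF : ∀ {k} → PT D k → PT D k → PT D k → PF D k
    thF a b s = byCode a b (sub (λ _ → s) cst Θ)

    thF-sat : ∀ {k} {e : Vec D k} a b s → Sem (thF a b s) e ⟺ Th (Code (⟦ a ⟧ (λ d → d) e) (⟦ b ⟧ (λ d → d) e)) (⟦ s ⟧ (λ d → d) e)
    thF-sat a b s = ⟺-trans (byCode-sat a b refl refl (sub (λ _ → s) cst Θ)) (PSat-sub Θ (λ { zero → refl }) (λ _ → refl))

    module Build (N b : D) (b≉0 : ¬ (b ≈ 0#)) (cm : Common N b) where

      p : D → D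
      p = modu b

      -- The third clause is the reason for the form of this invariant: the modulus of a non-member
      -- must be coprime to `a`, since otherwise multiplying `a` by `p x` might bring in elements
      -- other than `x`. Its unbounded `z` makes `∃ᶜ (H x)` a Σ⁰₂ statement, hence `ind2`.
      H : D → D → Set
      H x a = x ≤ N → ∀ s → s < N → (s < x → Code a b s ⟺ Th (Code a b) s) × (¬ (s < x) → ¬ Code a b s)
        × (¬ Code a b s → ∀ z → Div (p s) (a * z) → Div (p s) z)

      codeθ : PF D 4
      codeθ = codeF #2 (cst b) #0

      θ : PF D 3
      θ = neg (cst N << #2) ⊃ all< (cst N)
        (((#0 << #3) ⊃ iffF codeθ (thF #2 (cst b) #0)) ∧ᵖ ((neg (#0 << #3) ⊃ neg codeθ)
          ∧ᵖ (neg codeθ ⊃ divF (moduF (cst b) #0) (#2 ⊠ #1) ⊃ divF (moduF (cst b) #0) #1)))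

      module _ (s z a x : D) where
        private
          e : Vec D 4
          e = s ∷ z ∷ a ∷ x ∷ []
          I = ⟪ A , A ⟫
        c⟺ : Sem codeθ e ⟺ Code a b s
        c⟺ = codeF-sat {I} {κ = λ d → d} {e = e} #2 (cst b) #0
        t⟺ : Sem (thF #2 (cst b) #0) e ⟺ Th (Code a b) s
        t⟺ = thF-sat {e = e} #2 (cst b) #0
        d⟺ : Sem (divF (moduF (cst b) #0) (#2 ⊠ #1)) e ⟺ Div (p s) (a * z)
        d⟺ = divF-sat {I} {κ = λ d → d} {e = e} (moduF (cst b) #0) (#2 ⊠ #1) suc≉0
        d'⟺ : Sem (divF (moduF (cst b) #0) #1) e ⟺ Div (p s) z
        d'⟺ = divF-sat {I} {κ = λ d → d} {e = e} (moduF (cst b) #0) #1 suc≉0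

      to : ∀ {x a} → H x a → ∀ z → Sem θ (z ∷ a ∷ x ∷ [])
      to {x} {a} h z x≤N s s<N = let h1 , h2 , h3 = h x≤N s s<N ; C⟺ = c⟺ s z a x ; T⟺ = t⟺ s z a x in andI
        (λ s<x → andI (λ c → proj₂ T⟺ (proj₁ (h1 s<x) (proj₁ C⟺ c))) (λ t → proj₂ C⟺ (proj₂ (h1 s<x) (proj₁ T⟺ t))))
        (andI (λ s≮x c → h2 s≮x (proj₁ C⟺ c))
          (λ nc q → proj₂ (d'⟺ s z a x) (h3 (λ c → nc (proj₂ C⟺ c)) z (proj₁ (d⟺ s z a x) q))))

      from : ∀ {x a} → (∀ z → Sem θ (z ∷ a ∷ x ∷ [])) → H x a
      from {x} {a} f x≤N s s<N =
        (λ s<x → let i , j = andE (→-stable (Sem-stable (thF #2 (cst b) #0) {s ∷ 0# ∷ a ∷ x ∷ []})) (→-stable ¬-stable) (proj₁ (g 0#) s<x) in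
          (λ c → proj₁ (t⟺ s 0# a x) (i (proj₂ (c⟺ s 0# a x) c))) , (λ t → proj₁ (c⟺ s 0# a x) (j (proj₂ (t⟺ s 0# a x) t)))) ,
        (λ s≮x c → proj₁ (proj₂ (g 0#)) s≮x (proj₂ (c⟺ s 0# a x) c)) ,
        (λ nc z q → proj₁ (d'⟺ s z a x) (proj₂ (proj₂ (g z)) (λ c → nc (proj₁ (c⟺ s z a x) c)) (proj₂ (d⟺ s z a x) q)))
        where
        g : ∀ z → let e = s ∷ z ∷ a ∷ x ∷ [] in
          (s < x → Sem (iffF codeθ (thF #2 (cst b) #0)) e) × ((¬ (s < x) → ¬ Sem codeθ e)
            × (¬ Sem codeθ e → Sem (divF (moduF (cst b) #0) (#2 ⊠ #1)) e → Sem (divF (moduF (cst b) #0) #1) e))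
        g z = let x , y = andE (→-stable ¬-stable) ¬-stable (f z x≤N s s<N)
                  y1 , y2 = andE (→-stable ¬-stable) (→-stable (→-stable ¬-stable)) y in x , y1 , y2

      base : H 0# 1#
      base _ s s<N = (λ s<0 → ⊥-elim (≮0 s<0)) , (λ _ c → ∤1 {b} {s} b≉0 c) ,
        (λ _ z q → Div-resp ≈-refl (≈-trans (*-comm _ _) (*-idʳ z)) q)

      extend : ∀ {x a} → x < N → H x a → Th (Code a b) x → H (x + 1#) (a * p x)
      extend {x} {a} x<N h th _ s s<N = upto ,
          (λ s≮x+1 c → proj₁ (proj₂ (hs s s<N)) (λ q → s≮x+1 (<-step q)) (old s<N (λ e → s≮x+1 (<-resp (≈-sym e) ≈-refl x<x+1)) c)) ,
          (λ nc z q → pairwise cm x<N s<N (λ e → nc (at-x (≈-sym e)))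
            (proj₂ (proj₂ (hs s s<N)) (λ c → nc (mono c)) (p x * z) (Div-resp ≈-refl (*-assoc a (p x) z) q)))
        where
        hs = h (<⇒≤ x<N)
        mono : ∀ {t} → Code a b t → Code (a * p x) b t
        mono c = Div-resp ≈-refl (*-comm _ _) (Div-mul (p x) c)
        at-x : ∀ {t} → t ≈ x → Code (a * p x) b t
        at-x e = Div-resp (+-cong (*-cong (+-cong (≈-sym e) ≈-refl) ≈-refl) ≈-refl) (*-comm _ _) (Div-self a)
        old : ∀ {t} → t < N → ¬ (t ≈ x) → Code (a * p x) b t → Code a b t
        old {t} t<N t≉x c = ¬-stable λ nc → ∤1 {b} {t} b≉0 (pairwise cm x<N t<N (λ e → t≉x (≈-sym e))
          (Div-resp ≈-refl (≈-sym (*-idʳ _)) (proj₂ (proj₂ (hs t t<N)) nc (p x) c)))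
        upto : s < x + 1# → Code (a * p x) b s ⟺ Th (Code (a * p x) b) s
        upto s<x+1 = (λ c → Th-stable (lem {A = s ≈ x} >>= λ where
              (inj₁ e) → return (proj₁ same (Th-resp (≈-sym e) th))
              (inj₂ n) → return (proj₁ same (proj₁ (hsx n) (old s<N n c))))) ,
            (λ t → lem {A = s ≈ x} >>= λ where
              (inj₁ e) → at-x e
              (inj₂ n) → mono (proj₂ (hsx n) (proj₂ same t)))
          where
          hsx : ¬ (s ≈ x) → Code a b s ⟺ Th (Code a b) s
          hsx n = proj₁ (hs s s<N) (<-stable λ q → n (<-suc⁻ s<x+1 q))
          same : Th (Code a b) s ⟺ Th (Code (a * p x) b) s
          same = local⟺ λ t t<s → mono , old (<-trans t<s s<N) λ e → <-irrefl e (<-≤-trans t<s (<+1⇒≤ s<x+1))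

      skip : ∀ {x a} → x < N → H x a → ¬ Th (Code a b) x → H (x + 1#) a
      skip {x} {a} x<N h nth _ s s<N = upto , (λ s≮x+1 → proj₁ (proj₂ hs) (λ q → s≮x+1 (<-step q))) , proj₂ (proj₂ hs)
        where
        hs = h (<⇒≤ x<N) s s<N
        upto : s < x + 1# → Code a b s ⟺ Th (Code a b) s
        upto s<x+1 = (λ c → Th-stable λ nt → em {P = s < x} (λ z → z λ x → x) (λ q → nt (proj₁ (proj₁ hs q) c)) (λ q → proj₁ (proj₂ hs) q c)) ,
          (λ t → lem {A = s < x} >>= λ where
            (inj₁ q) → proj₂ (proj₁ hs q) t
            (inj₂ q) → ⊥-elim (nth (Th-resp (<-suc⁻ s<x+1 q) t)))

      build : ∀ x → ∃ᶜ (H x)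
      build x = ind2 θ (return (1# , to base)) (λ y h → h >>= λ { (a , s) → let ha = from s in
          lem {A = y < N} >>= λ where
            (inj₂ y≮N) → return (a , to λ y+1≤N → ⊥-elim (y≮N (+1≤⇒< y+1≤N)))
            (inj₁ y<N) → lem {A = Th (Code a b) y} >>= λ where
              (inj₁ t) → return (a * p y , to (extend y<N ha t))
              (inj₂ t) → return (a , to (skip y<N ha t)) }) x
        >>= λ { (a , s) → return (a , from s) }

    good : ∀ N → ∃ᶜ λ a → Σ D λ b → Good a b N
    good N = common N >>= λ { (b , b≉0 , cm) → Build.build N b b≉0 cm N >>= λ { (a , h) →
      return (a , b , λ s s<N → proj₁ (h ≤-refl s s<N) s<N) } }

    -- By `local`, codes that agree below `s` receive the same verdict at `s`.
    agree : ∀ {a b a' b' N} → Good a b N → Good a' b' N → ∀ s → s < N → Code a b s ⟺ Code a' b' s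
    agree {a} {b} {a'} {b'} {N} g g' s s<N = iff N s (ind0 θ (λ _ s s<0 → ⊥-elim (≮0 s<0)) step N ≤-refl s s<N)
      where
      c c' : PF D 2
      c = codeF (cst a) (cst b) #0
      c' = codeF (cst a') (cst b') #0
      θ : PF D 1
      θ = neg (cst N << #0) ⊃ all< #0 (iffF c c')
      iff : ∀ x s → Sem (iffF c c') (s ∷ x ∷ []) → Code a b s ⟺ Code a' b' s
      iff x s i = let p , q = andE (→-stable ¬-stable) (→-stable ¬-stable) i in
        ⟺-trans (⟺-sym (codeF-sat {⟪ A , A ⟫} {e = s ∷ x ∷ []} (cst a) (cst b) #0))
          (⟺-trans (p , q) (codeF-sat {⟪ A , A ⟫} {e = s ∷ x ∷ []} (cst a') (cst b') #0))
      step : ∀ x → Sem θ (x ∷ []) → Sem θ (x + 1# ∷ [])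
      step x h x+1≤N s s<x+1 = let p , q = ⟺-trans (codeF-sat {⟪ A , A ⟫} {e = s ∷ x + 1# ∷ []} (cst a) (cst b) #0)
                                      (⟺-trans r (⟺-sym (codeF-sat {⟪ A , A ⟫} {e = s ∷ x + 1# ∷ []} (cst a') (cst b') #0))) in andI p q
        where
        x<N = +1≤⇒< x+1≤N
        s≤x = <+1⇒≤ s<x+1
        r : Code a b s ⟺ Code a' b' s
        r = ⟺-trans (g s (≤-<-trans s≤x x<N)) (⟺-trans (local⟺ λ t t<s → iff x t (h (<⇒≤ x<N) t (<-≤-trans t<s s≤x)))
          (⟺-sym (g' s (≤-<-trans s≤x x<N))))

    goodF : ∀ {k} → PT D k → PT D k → PT D k → PF D k
    goodF a b N = all< N (iffF (codeF (wkP a) (wkP b) #0) (thF (wkP a) (wkP b) #0))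

    goodF-sat : ∀ {k} {e : Vec D k} a b N → Sem (goodF a b N) e ⟺ Good (⟦ a ⟧ (λ d → d) e) (⟦ b ⟧ (λ d → d) e) (⟦ N ⟧ (λ d → d) e)
    goodF-sat {e = e} a b N = Π-cong λ s → →-cong ⟺-refl
      ((λ i → let p , q = andE (→-stable (Sem-stable (thF (wkP a) (wkP b) #0))) (→-stable ¬-stable) i in
         ⟺-trans (⟺-sym (cs s)) (⟺-trans (p , q) (ts s))) ,
       (λ i → let p , q = ⟺-trans (cs s) (⟺-trans i (⟺-sym (ts s))) in andI p q))
      where
      cs : ∀ s → Sem (codeF (wkP a) (wkP b) #0) (s ∷ e) ⟺ Code (⟦ a ⟧ (λ d → d) e) (⟦ b ⟧ (λ d → d) e) s
      cs s = subst₂ (λ x y → Sem (codeF (wkP a) (wkP b) #0) (s ∷ e) ⟺ Code x y s) (wkP-eval a) (wkP-eval b)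
        (codeF-sat {⟪ A , A ⟫} {e = s ∷ e} (wkP a) (wkP b) #0)
      ts : ∀ s → Sem (thF (wkP a) (wkP b) #0) (s ∷ e) ⟺ Th (Code (⟦ a ⟧ (λ d → d) e) (⟦ b ⟧ (λ d → d) e)) s
      ts s = subst₂ (λ x y → Sem (thF (wkP a) (wkP b) #0) (s ∷ e) ⟺ Th (Code x y) s) (wkP-eval a) (wkP-eval b)
        (thF-sat {e = s ∷ e} (wkP a) (wkP b) #0)

    -- One number `w` bounds both components of the code, so the search for a good code is a single
    -- existential quantifier.
    θ± : PF D 4 → PF D 2
    θ± χ = ex< #0 (ex< #1 (goodF #1 #0 (#3 ⊞ on) ∧ᵖ χ))

    θ±-out : ∀ {χ w s} → Sem (θ± χ) (w ∷ s ∷ []) → ∃ᶜ λ a → Σ D λ b → Good a b (s + 1#) × Sem χ (b ∷ a ∷ w ∷ s ∷ [])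
    θ±-out {χ} {w} {s} h = ex-e h >>= λ { (a , _ , h) → ex-e h >>= λ { (b , _ , h) →
      let p , q = andE (Sem-stable (goodF #1 #0 (#3 ⊞ on)) {b ∷ a ∷ w ∷ s ∷ []}) (Sem-stable χ) h in
      return (a , b , proj₁ (goodF-sat {e = b ∷ a ∷ w ∷ s ∷ []} #1 #0 (#3 ⊞ on)) p , q) } }

    θ±-in : ∀ {χ s} a b → Good a b (s + 1#) → (∀ w → Sem χ (b ∷ a ∷ w ∷ s ∷ [])) → ∃ᶜ λ w → Sem (θ± χ) (w ∷ s ∷ [])
    θ±-in {χ} {s} a b g h = max a b >>= λ { (w , a≤w , b≤w) → return (w + 1# ,
      ex-i (return (a , ≤⇒<+1 a≤w , ex-i (return (b , ≤⇒<+1 b≤w ,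
        andI (proj₂ (goodF-sat {e = b ∷ a ∷ w + 1# ∷ s ∷ []} #1 #0 (#3 ⊞ on)) g) (h (w + 1#))))))) }

    inθ : PF D 4
    inθ = codeF #1 #0 #3

    in⟺ : ∀ b a w s → Sem inθ (b ∷ a ∷ w ∷ s ∷ []) ⟺ Code a b s
    in⟺ b a w s = codeF-sat {⟪ A , A ⟫} {κ = λ d → d} {e = b ∷ a ∷ w ∷ s ∷ []} #1 #0 #3

    -- Good codes exist and agree, so "some good code contains `s`" and "some good code omits `s`"
    -- are complementary Σ⁰₁ conditions, and comprehension yields B. Locality then replaces the code
    -- by B in the recursion equation.
    fixpoint : ∃ᶜ λ B → ∀ s → (s ∈ B) ⟺ PSat ⟪ A , B ⟫ (λ d → d) (s ∷ []) Θ
    fixpoint = compr (θ± inθ) (θ± (neg inθ)) (λ s →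
        (λ h → λ { (w' , h') → h λ { (w , h) → θ±-out {inθ} {w} {s} h λ { (a , b , g , c) → θ±-out {neg inθ} {w'} {s} h' λ { (a' , b' , g' , c') →
          c' (proj₂ (in⟺ b' a' w' s) (proj₁ (agree g g' s x<x+1) (proj₁ (in⟺ b a w s) c))) } } } }) ,
        (λ n → good (s + 1#) >>= λ { (a , b , g) → lem {A = Code a b s} >>= λ where
          (inj₁ c) → θ±-in {inθ} {s} a b g λ w → proj₂ (in⟺ b a w s) c
          (inj₂ c) → ⊥-elim (θ±-in {neg inθ} {s} a b g (λ w c' → c (proj₁ (in⟺ b a w s) c')) n) }))
      >>= λ { (B , h) → return (B , λ s → final B h s) }
      where
      module _ (B : S) (h : ∀ s → (s ∈ B) ⟺ (∃ᶜ λ w → Sem (θ± inθ) (w ∷ s ∷ []))) where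
        char : ∀ {a b N} → Good a b N → ∀ s → s < N → (s ∈ B) ⟺ Code a b s
        char {a} {b} g s s<N =
          (λ i → proj₁ (h s) i >>= λ { (w , q) → θ±-out {inθ} {w} {s} q >>= λ { (a' , b' , g' , c) →
            proj₁ (agree g' gs s x<x+1) (proj₁ (in⟺ b' a' w s) c) } }) ,
          (λ c → proj₂ (h s) (θ±-in {inθ} {s} a b gs λ w → proj₂ (in⟺ b a w s) c))
          where
          gs : Good a b (s + 1#)
          gs t t<s+1 = g t (≤-<-trans (<+1⇒≤ t<s+1) s<N)
        final : ∀ s → (s ∈ B) ⟺ PSat ⟪ A , B ⟫ (λ d → d) (s ∷ []) Θ
        final s = st' , st''
          where
          st⟺ : ∀ {a b} → Good a b (s + 1#) → (s ∈ B) ⟺ Th (_∈ B) s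
          st⟺ g = ⟺-trans (char g s x<x+1) (⟺-trans (g s x<x+1)
            (local⟺ λ t t<s → ⟺-sym (char g t (<-trans t<s x<x+1))))
          st' : s ∈ B → Th (_∈ B) s
          st' i = PSat-stable (⟪⟫-stable {A} {B}) Θ (good (s + 1#) >>= λ { (a , b , g) → return (proj₁ (st⟺ g) i) })
          st'' : Th (_∈ B) s → s ∈ B
          st'' t = ∈-stable (good (s + 1#) >>= λ { (a , b , g) → return (proj₂ (st⟺ g) t) })

-- Queries to B in the evaluation of a formula

-- locF w φ says that evaluating φ queries B only below w.

locF : ∀ {C k} → PT C k → PF C k → PF C k
locF w ff = ff ⊃ ff
locF w (s == t) = ff ⊃ ff
locF w (s << t) = ff ⊃ ff
locF w (mem t false) = ff ⊃ ff
locF w (mem t true) = t << w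
locF w (φ ⊃ ψ) = locF w φ ∧ᵖ locF w ψ
locF w (all< t φ) = all< t (locF (wkP w) φ)

pairF : ∀ {C k} → PT C k → PT C k → PT C k
pairF i w = (i ⊞ w) ⊠ (i ⊞ w) ⊞ i

infixr 5 _∨ᵖ_
-- The double negation on `ψ` lets `orI` and `orE` work without any stability assumption on the
-- disjuncts.
_∨ᵖ_ : ∀ {C k} → PF C k → PF C k → PF C k
φ ∨ᵖ ψ = neg φ ⊃ neg (neg ψ)

orI : ∀ {A B : Set} → ¬ ¬ (A ⊎ B) → ¬ A → ¬ ¬ B
orI h na nb = h λ { (inj₁ a) → na a ; (inj₂ b) → nb b }

orE : ∀ {A B : Set} → (¬ A → ¬ ¬ B) → ¬ ¬ (A ⊎ B)
orE h k = h (λ a → k (inj₁ a)) (λ b → k (inj₂ b))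

module Locality (M : Model) (st : Strong M) (A : Model.S M) where
  open Model M
  open Interp M
  open Arithmetic M st A
  open Principles M st A A using (coll; Sem)

  Loc' : ∀ {C k} → PF C k → (C → D) → Vec D k → D → Set
  Loc' ff κ e W = ⊤
  Loc' (s == t) κ e W = ⊤
  Loc' (s << t) κ e W = ⊤
  Loc' (mem t false) κ e W = ⊤
  Loc' (mem t true) κ e W = ⟦ t ⟧ κ e < W
  Loc' (φ ⊃ ψ) κ e W = Loc' φ κ e W × Loc' ψ κ e W
  Loc' (all< t φ) κ e W = ∀ d → d < ⟦ t ⟧ κ e → Loc' φ κ (d ∷ e) W

  Loc'-stable : ∀ {C k} (φ : PF C k) {κ e W} → Stable (Loc' φ κ e W)
  Loc'-stable ff _ = tt
  Loc'-stable (s == t) _ = tt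
  Loc'-stable (s << t) _ = tt
  Loc'-stable (mem t false) _ = tt
  Loc'-stable (mem t true) = <-stable
  Loc'-stable (φ ⊃ ψ) = ×-stable (Loc'-stable φ) (Loc'-stable ψ)
  Loc'-stable (all< t φ) = Π-stable λ _ → →-stable (Loc'-stable φ)

  locF-sat : ∀ {I C k} {κ : C → D} {e : Vec D k} {W} w (φ : PF C k) → ⟦ w ⟧ κ e ≡ W → PSat I κ e (locF w φ) ⟺ Loc' φ κ e W
  locF-sat w ff p = (λ _ → tt) , (λ _ x → x)
  locF-sat w (s == t) p = (λ _ → tt) , (λ _ x → x)
  locF-sat w (s << t) p = (λ _ → tt) , (λ _ x → x)
  locF-sat w (mem t false) p = (λ _ → tt) , (λ _ x → x)
  locF-sat w (mem t true) refl = ⟺-refl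
  locF-sat w (φ ⊃ ψ) p = let l = locF-sat w φ p ; r = locF-sat w ψ p in
    (λ h → Loc'-stable φ (λ n → h λ a _ → n (proj₁ l a)) , Loc'-stable ψ (λ n → h λ _ b → n (proj₁ r b))) ,
    (λ { (a , b) → andI (proj₂ l a) (proj₂ r b) })
  locF-sat w (all< t φ) p = Π-cong λ d → →-cong ⟺-refl (locF-sat (wkP w) φ (trans (wkP-eval w) p))

  Loc'-mono : ∀ {C k} (φ : PF C k) {κ e W W'} → W ≤ W' → Loc' φ κ e W → Loc' φ κ e W'
  Loc'-mono ff p h = tt
  Loc'-mono (s == t) p h = tt
  Loc'-mono (s << t) p h = tt
  Loc'-mono (mem t false) p h = tt
  Loc'-mono (mem t true) p h = <-≤-trans h p
  Loc'-mono (φ ⊃ ψ) p (a , b) = Loc'-mono φ p a , Loc'-mono ψ p b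
  Loc'-mono (all< t φ) p h d q = Loc'-mono φ p (h d q)

  Loc'-sound : ∀ {C k} (φ : PF C k) {κ e W} {X Y : D → Set} → Loc' φ κ e W → (∀ t → t < W → X t ⟺ Y t) →
    PSat (withB A X) κ e φ ⟺ PSat (withB A Y) κ e φ
  Loc'-sound ff l h = ⟺-refl
  Loc'-sound (s == t) l h = ⟺-refl
  Loc'-sound (s << t) l h = ⟺-refl
  Loc'-sound (mem t false) l h = ⟺-refl
  Loc'-sound (mem t true) l h = h _ l
  Loc'-sound (φ ⊃ ψ) (a , b) h = →-cong (Loc'-sound φ a h) (Loc'-sound ψ b h)
  Loc'-sound (all< t φ) l h =
    (λ f d q → proj₁ (Loc'-sound φ (l d q) h) (f d q)) , (λ f d q → proj₂ (Loc'-sound φ (l d q) h) (f d q))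

  Loc'-sub : ∀ {C C' k m} {σ : Fin k → PT C' m} {ν : C → PT C' m} {κ κ' e e' W} (φ : PF C k) →
      (∀ i → ⟦ σ i ⟧ κ' e' ≡ lookup e i) → (∀ c → ⟦ ν c ⟧ κ' e' ≡ κ c) →
      Loc' (sub σ ν φ) κ' e' W ⟺ Loc' φ κ e W
  Loc'-sub ff h g = ⟺-refl
  Loc'-sub (s == t) h g = ⟺-refl
  Loc'-sub (s << t) h g = ⟺-refl
  Loc'-sub (mem t false) h g = ⟺-refl
  Loc'-sub {W = W} (mem t true) h g = ≡⇒⟺ (cong (_< W) (subP-eval h g t))
  Loc'-sub (φ ⊃ ψ) h g = let l = Loc'-sub φ h g ; r = Loc'-sub ψ h g in
    (λ { (a , b) → proj₁ l a , proj₁ r b }) , (λ { (a , b) → proj₂ l a , proj₂ r b })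
  Loc'-sub {σ = σ} {ν} (all< t φ) h g = Π-cong λ d → →-cong (≡⇒⟺ (cong (d <_) (subP-eval h g t)))
    (Loc'-sub φ (λ { zero → refl ; (suc i) → trans (wkP-eval (σ i)) (h i) }) (λ c → trans (wkP-eval (ν c)) (g c)))

  -- The bounded quantifier is the point: the bounds for its instances are collected by `coll`, for
  -- which the environment is turned into parameters.
  Loc'-exists : ∀ {C k} (φ : PF C k) κ e → ∃ᶜ (Loc' φ κ e)
  Loc'-exists ff κ e = return (0# , tt)
  Loc'-exists (s == t) κ e = return (0# , tt)
  Loc'-exists (s << t) κ e = return (0# , tt)
  Loc'-exists (mem t false) κ e = return (0# , tt)
  Loc'-exists (mem t true) κ e = return (⟦ t ⟧ κ e + 1# , x<x+1)
  Loc'-exists (φ ⊃ ψ) κ e = Loc'-exists φ κ e >>= λ { (a , p) → Loc'-exists ψ κ e >>= λ { (b , q) → max a b >>= λ { (c , r , s) →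
    return (c , Loc'-mono φ r p , Loc'-mono ψ s q) } } }
  Loc'-exists {C} {k} (all< t φ) κ e = coll (locF #1 ψ) (⟦ t ⟧ κ e)
      (λ i _ → Loc'-exists φ κ (i ∷ e) >>= λ { (W , l) → return (W , λ z → proj₂ (eq z W i) l) })
    >>= λ { (n , h) → return (n , λ d p → Loc'-stable φ (h d p >>= λ { (j , j<n , s) → return (Loc'-mono φ (<⇒≤ j<n) (proj₁ (eq 0# j d) (s 0#))) })) }
    where
    σ : Fin (suc k) → PT D 3
    σ zero = #2
    σ (suc i) = cst (lookup e i)
    ψ : PF D 3
    ψ = sub σ (λ c → cst (κ c)) φ
    eq : ∀ z j i → Sem (locF #1 ψ) (z ∷ j ∷ i ∷ []) ⟺ Loc' φ κ (i ∷ e) j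
    eq z j i = ⟺-trans (locF-sat #1 ψ refl) (Loc'-sub φ (λ { zero → refl ; (suc i) → refl }) (λ _ → refl))

-- The columns

-- `square` is for closure of the cut under sum and product, `bounded-col` for bounding the cut
-- inside the model, and `closed` for elementarity and for the truth of `Ψ` in the cut.
record IsColumns (M : Model) (A B : Model.S M) (c : Model.D M) (X : PF (Model.D M) 3) : Set where
  open Model M
  open Interp M
  ⟨_,_⟩ : D → D → D
  ⟨ i , w ⟩ = (i + w) * (i + w) + i
  field
    start : ⟨ 0# , c ⟩ ∈ B
    keep : ∀ i w → ⟨ i , w ⟩ ∈ B → ⟨ i + 1# , w ⟩ ∈ B
    square : ∀ i w → ⟨ i , w ⟩ ∈ B → ⟨ i + 1# , (w + 1#) * (w + 1#) ⟩ ∈ B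
    bounded-col : ∀ i → ∃ᶜ λ p → ∀ w → ⟨ i , w ⟩ ∈ B → ¬ (p < w)
    closed : ∀ i x → ⟨ i , x ⟩ ∈ B → ∃ᶜ λ w → (⟨ i + 1# , w ⟩ ∈ B) × ∀ z → PSat ⟪ A , B ⟫ (λ d → d) (z ∷ w ∷ x ∷ []) X

-- The columns B_i = {w : ⟨i,w⟩ ∈ B} are defined by recursion: B_0 = {c}, and
-- B_{i+1} consists of B_i, of the squares (x+1)² for x ∈ B_i, and of the stages
-- w > x, x ∈ B_i, at which some candidate u < w for "∀z X(z,u,x)" is refuted
-- for the first time.  As X mentions B, a refutation only counts at stage w
-- when all of its queries lie below w.

module Columns (M : Model) (st : Strong M) (A : Model.S M) (c : Model.D M) (X : PF (Model.D M) 3) where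
  open Model M
  open Interp M
  open Arithmetic M st A
  open Locality M st A

  ⟨_,_⟩ : D → D → D
  ⟨ i , w ⟩ = (i + w) * (i + w) + i

  x≤x² : ∀ x → x ≤ x * x
  x≤x² x r = 0or+1 x λ where
    (inj₁ e) → ≤-trans (≤-reflexive e) 0≤ r
    (inj₂ (d , e)) → ≤-trans (≤-reflexive (≈-sym e)) (≤-resp ≈-refl
      (≈-trans (solve 1 (λ d → d :+ con 1 :+ d :* (d :+ con 1) := (d :+ con 1) :* (d :+ con 1)) ≈-refl d) (*-cong e e)) (x≤x+y _ _)) r

  i≤⟨⟩ : ∀ i w → i ≤ ⟨ i , w ⟩
  i≤⟨⟩ i w = y≤x+y _ _

  w≤⟨⟩ : ∀ i w → w ≤ ⟨ i , w ⟩
  w≤⟨⟩ i w = ≤-trans (y≤x+y i w) (≤-trans (x≤x² (i + w)) (x≤x+y _ _))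

  ⟨⟩-mono : ∀ {i j w x} → i < j → w ≤ x → ⟨ i , w ⟩ < ⟨ j , x ⟩
  ⟨⟩-mono p q = ≤-<-trans (+-mono-≤ (*-mono-≤ a a) ≤-refl) (+1≤⇒< (≤-resp (≈-sym (+-assoc _ _ _)) ≈-refl (+-mono-≤ ≤-refl (<⇒+1≤ p))))
    where a = +-mono-≤ (<⇒≤ p) q

  ⟨⟩-cong : ∀ {i j w x} → i ≈ j → w ≈ x → ⟨ i , w ⟩ ≈ ⟨ j , x ⟩
  ⟨⟩-cong p q = +-cong (*-cong (+-cong p q) (+-cong p q)) p

  -- The remainder `i` is smaller than the gap between the squares of `i + w` and of its successor.
  sum≮ : ∀ i w j x → ⟨ i , w ⟩ ≈ ⟨ j , x ⟩ → ¬ (i + w < j + x)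
  sum≮ i w j x e p = <-irrefl e (<-≤-trans (≤⇒<+1 (≤-resp ≈-refl ≈-refl (+-mono-≤ ≤-refl (x≤x+y i w))))
    (≤-trans (≤-trans (x≤x+y _ (i + w)) (≤-reflexive (solve 1 (λ a → a :* a :+ a :+ con 1 :+ a := (a :+ con 1) :* (a :+ con 1)) ≈-refl (i + w))))
      (≤-trans (*-mono-≤ (<⇒+1≤ p) (<⇒+1≤ p)) (x≤x+y _ j))))

  ⟨⟩-inj : ∀ i w j x → ⟨ i , w ⟩ ≈ ⟨ j , x ⟩ → (i ≈ j) × (w ≈ x)
  ⟨⟩-inj i w j x e = ij , +-cancelˡ i (≈-trans s (+-cong (≈-sym ij) ≈-refl))
    where
    s : i + w ≈ j + x
    s = ≤-antisym (sum≮ j x i w (≈-sym e)) (sum≮ i w j x e)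
    ij : i ≈ j
    ij = +-cancelˡ _ (≈-trans e (+-cong (*-cong (≈-sym s) (≈-sym s)) ≈-refl))

  Xs : PF D 4
  Xs = sub (lookup (#0 ∷ #2 ∷ #3 ∷ [])) cst X

  -- environment: w, u, x
  X' : PF D 3
  X' = all< #0 ((#2 << #1) ⊃ locF #1 Xs ⊃ Xs)

  -- w is the stage at which u is refuted
  LR : PF D 3
  LR = neg X' ∧ᵖ all< #0 (sub (lookup (#0 ∷ #2 ∷ #3 ∷ [])) cst X')

  -- environment: x, w
  event : PF D 2
  event = (#1 == (#0 ⊞ on) ⊠ (#0 ⊞ on)) ∨ᵖ ex< #1 (sub (lookup (#2 ∷ #0 ∷ #1 ∷ [])) cst LR)

  Θ : PF D 1
  Θ = ex< (#0 ⊞ on) (ex< (#1 ⊞ on) ((#2 == pairF #1 #0) ∧ᵖ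
        (((#1 == zr) ∧ᵖ (#0 == cst c)) ∨ᵖ
         (ex< #1 ((#2 == #0 ⊞ on) ∧ᵖ mem (pairF #0 #1) true) ∨ᵖ
          ex< #1 ((#2 == #0 ⊞ on) ∧ᵖ ex< #1 (mem (pairF #1 #0) true ∧ᵖ
             sub (lookup (#0 ∷ #2 ∷ [])) cst event))))))

  module Shallow (Y : D → Set) where
    P : ∀ {k} → PF D k → Vec D k → Set
    P φ e = PSat (withB A Y) (λ d → d) e φ

    -- The guard `u < w` forces the stage of a refutation above its candidate, so that following
    -- refutations climbs. `Loc'` makes the verdict at `w` depend on B below `w` only.
    Unrefuted : D → D → D → Set
    Unrefuted x u w = ∀ z → z < w → u < w → Loc' X (λ d → d) (z ∷ u ∷ x ∷ []) w → P X (z ∷ u ∷ x ∷ [])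

    -- Only the first stage counts: a refutation persists, so all later stages would otherwise enter
    -- the column and make it unbounded.
    Refuted : D → D → D → Set
    Refuted x u w = ¬ (¬ Unrefuted x u w → ¬ (∀ w' → w' < w → Unrefuted x u w'))

    Event : D → D → Set
    Event x w = ¬ ¬ ((w ≈ (x + 1#) * (x + 1#)) ⊎ ∃ᶜ λ u → (u < w) × Refuted x u w)

    data Step (i w : D) : Set where
      base : i ≈ 0# → w ≈ c → Step i w
      keep : ∀ j → i ≈ j + 1# → Y ⟨ j , w ⟩ → Step i w
      new  : ∀ j x → i ≈ j + 1# → x < w → Y ⟨ j , x ⟩ → Event x w → Step i w

    X'-sat : ∀ w u x → P X' (w ∷ u ∷ x ∷ []) ⟺ Unrefuted x u w
    X'-sat w u x = Π-cong λ z → →-cong ⟺-refl (→-cong ⟺-refl (→-cong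
      (⟺-trans (locF-sat {withB A Y} {κ = λ d → d} {e = z ∷ w ∷ u ∷ x ∷ []} #1 Xs refl) (Loc'-sub {σ = σ} {ν = cst} {κ' = λ d → d} {e' = z ∷ w ∷ u ∷ x ∷ []} X (env z) (λ _ → refl)))
      (PSat-sub {σ = σ} {ν = cst} X (env z) (λ _ → refl))))
      where
      σ : Fin 3 → PT D 4
      σ = lookup (#0 ∷ #2 ∷ #3 ∷ [])
      env : ∀ z i → ⟦ σ i ⟧ (λ d → d) (z ∷ w ∷ u ∷ x ∷ []) ≡ lookup (z ∷ u ∷ x ∷ []) i
      env z zero = refl
      env z (suc zero) = refl
      env z (suc (suc zero)) = refl

    LR-sat : ∀ w u x → P LR (w ∷ u ∷ x ∷ []) ⟺ Refuted x u w
    LR-sat w u x = ¬-cong (→-cong (¬-cong (X'-sat w u x)) (¬-cong (Π-cong λ w' → →-cong ⟺-refl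
      (⟺-trans (PSat-sub {e = w' ∷ u ∷ x ∷ []} X' (λ { zero → refl ; (suc zero) → refl ; (suc (suc zero)) → refl }) (λ _ → refl)) (X'-sat w' u x)))))

    event-sat : ∀ x w → P event (x ∷ w ∷ []) ⟺ Event x w
    event-sat x w = (λ h → orE h >>= λ { (inj₁ e) → return (inj₁ e) ; (inj₂ h) → return (inj₂ (ex-e h >>= λ { (u , p , q) → return (u , p , proj₁ (lr u) q) })) }) ,
      (λ h → orI (h >>= λ { (inj₁ e) → return (inj₁ e) ; (inj₂ h) → return (inj₂ (ex-i (h >>= λ { (u , p , q) → return (u , p , proj₂ (lr u) q) }))) }))
      where
      lr : ∀ u → _ ⟺ Refuted x u w
      lr u = ⟺-trans (PSat-sub {e = w ∷ u ∷ x ∷ []} {e' = u ∷ x ∷ w ∷ []} LR (λ { zero → refl ; (suc zero) → refl ; (suc (suc zero)) → refl }) (λ _ → refl)) (LR-sat w u x)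

    and-e : ∀ {A B : Set} → ¬ (A → ¬ B) → ¬ ¬ (A × B)
    and-e h k = h λ a b → k (a , b)

    Θ-out : ∀ s → P Θ (s ∷ []) → ∃ᶜ λ i → Σ D λ w → (s ≈ ⟨ i , w ⟩) × Step i w
    Θ-out s h = ex-e h >>= λ { (i , _ , h) → ex-e h >>= λ { (w , _ , h) → and-e h >>= λ { (e , h) → orE h >>= λ where
      (inj₁ h) → and-e h >>= λ { (p , q) → return (i , w , e , base p q) }
      (inj₂ h) → orE h >>= λ where
        (inj₁ h) → ex-e h >>= λ { (j , _ , h) → and-e h >>= λ { (p , q) → return (i , w , e , keep j p q) } }
        (inj₂ h) → ex-e h >>= λ { (j , _ , h) → and-e h >>= λ { (p , h) → ex-e h >>= λ { (x , x<w , h) → and-e h >>= λ { (q , h) →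
          return (i , w , e , new j x p x<w q (proj₁ (event-sat x w) (proj₁ (ev x j w i s) h))) } } } } } } }
      where
      ev : ∀ x j w i s → _ ⟺ P event (x ∷ w ∷ [])
      ev x j w i s = PSat-sub {σ = lookup (#0 ∷ #2 ∷ [])} {ν = cst} {e' = x ∷ j ∷ w ∷ i ∷ s ∷ []} event (λ { zero → refl ; (suc zero) → refl }) (λ _ → refl)

    Θ-in : ∀ s i w → s ≈ ⟨ i , w ⟩ → Step i w → P Θ (s ∷ [])
    Θ-in s i w e h = ex-i (return (i , ≤⇒<+1 (≤-resp ≈-refl (≈-sym e) (i≤⟨⟩ i w)) ,
        ex-i (return (w , ≤⇒<+1 (≤-resp ≈-refl (≈-sym e) (w≤⟨⟩ i w)) , andI e (go h)))))
      where
      lt : ∀ {j} → i ≈ j + 1# → j < i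
      lt p = <-resp ≈-refl (≈-sym p) x<x+1
      go : Step i w → _
      go (base p q) = orI (return (inj₁ (andI p q)))
      go (keep j p q) = orI (return (inj₂ (orI (return (inj₁ (ex-i (return (j , lt p , andI p q))))))))
      go (new j x p x<w q r) = orI (return (inj₂ (orI (return (inj₂ (ex-i (return (j , lt p ,
        andI p (ex-i (return (x , x<w , andI q (proj₂ (PSat-sub {e' = x ∷ j ∷ w ∷ i ∷ s ∷ []} event (λ { zero → refl ; (suc zero) → refl }) (λ _ → refl)) (proj₂ (event-sat x w) r)))))))))))))

  module _ {Y Z : D → Set} where
    open Shallow

    Unrefuted-local : ∀ {x u w} → (∀ t → t < w → Y t ⟺ Z t) → Unrefuted Y x u w ⟺ Unrefuted Z x u w
    Unrefuted-local h =
      (λ f z p q l → proj₁ (Loc'-sound X l h) (f z p q l)) , (λ f z p q l → proj₂ (Loc'-sound X l h) (f z p q l))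

    Refuted-local : ∀ {x u w} → (∀ t → t < w → Y t ⟺ Z t) → Refuted Y x u w → Refuted Z x u w
    Refuted-local h r k = r λ n f → k (λ g → n (proj₂ (Unrefuted-local h) g))
      (λ w' p → proj₁ (Unrefuted-local (λ t q → h t (<-trans q p))) (f w' p))

    -- Every query concerns a smaller number: the pair of an earlier column with an entry not above
    -- `w` precedes `s`, and a refutation at stage `w` asks below `w`, which is at most the pair
    -- itself.
    Step-local : ∀ {s i w} → s ≈ ⟨ i , w ⟩ → (∀ t → t < s → Y t ⟺ Z t) → Step Y i w → Step Z i w
    Step-local e h (base p q) = base p q
    Step-local {s} {i} {w} e h (keep j p q) = keep j p (proj₁ (h _ (<-resp ≈-refl (≈-sym e) (⟨⟩-mono (<-resp ≈-refl (≈-sym p) x<x+1) ≤-refl))) q)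
    Step-local {s} {i} {w} e h (new j x p x<w q r) = new j x p x<w
      (proj₁ (h _ (<-resp ≈-refl (≈-sym e) (⟨⟩-mono (<-resp ≈-refl (≈-sym p) x<x+1) (<⇒≤ x<w)))) q)
      (r >>= λ { (inj₁ e) → return (inj₁ e) ; (inj₂ f) → return (inj₂ (f >>= λ { (u , u<w , rf) →
        return (u , u<w , Refuted-local (λ t t<w → h t (<-≤-trans t<w (≤-resp ≈-refl (≈-sym e) (w≤⟨⟩ i w)))) rf) })) })

  P-nn : ∀ {Y : D → Set} {s} → ¬ ¬ (PSat (withB A Y) (λ d → d) (s ∷ []) Θ) → PSat (withB A Y) (λ d → d) (s ∷ []) Θ
  P-nn = ¬-stable

  Θ-local : ∀ (Y Z : D → Set) s → (∀ t → t < s → Y t ⟺ Z t) →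
    PSat (withB A Y) (λ d → d) (s ∷ []) Θ → PSat (withB A Z) (λ d → d) (s ∷ []) Θ
  Θ-local Y Z s h q = P-nn {Z} {s} (Shallow.Θ-out Y s q >>= λ { (i , w , e , st) → return (Shallow.Θ-in Z s i w e (Step-local e h st)) })

  module Verify (B : S) (fix : ∀ s → (s ∈ B) ⟺ PSat ⟪ A , B ⟫ (λ d → d) (s ∷ []) Θ)
    (mono : ∀ {z u u' x} → u ≤ u' → PSat ⟪ A , B ⟫ (λ d → d) (z ∷ u ∷ x ∷ []) X → PSat ⟪ A , B ⟫ (λ d → d) (z ∷ u' ∷ x ∷ []) X)
    (total : ∀ x → ∃ᶜ λ u → ∀ z → PSat ⟪ A , B ⟫ (λ d → d) (z ∷ u ∷ x ∷ []) X) where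
    open Shallow (_∈ B)
    open Principles M st A B

    put : ∀ {i w} → Step i w → ⟨ i , w ⟩ ∈ B
    put {i} {w} h = proj₂ (fix _) (Θ-in _ i w ≈-refl h)

    get : ∀ {i w} → ⟨ i , w ⟩ ∈ B → ∃ᶜ λ j → Σ D λ x → (i ≈ j) × (w ≈ x) × Step j x
    get {i} {w} h = Θ-out _ (proj₁ (fix _) h) >>= λ { (j , x , e , s) → let p , q = ⟨⟩-inj i w j x e in return (j , x , p , q , s) }

    Unrefuted-stable : ∀ {x u w} → Stable (Unrefuted x u w)
    Unrefuted-stable = Π-stable λ _ → →-stable (→-stable (→-stable (Sem-stable X)))

    Refuted-e : ∀ {x u w} → Refuted x u w → ¬ Unrefuted x u w × (∀ w' → w' < w → Unrefuted x u w')
    Refuted-e = andE ¬-stable (Π-stable λ _ → →-stable Unrefuted-stable)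

    -- Let `u*` be a true witness for `x`. By monotonicity no `u` from `u*` on is ever refuted, and
    -- each smaller `u` has at most one first stage of refutation, so bounding over `u < u*`
    -- suffices.
    events-bounded : ∀ x → ∃ᶜ λ W → ∀ w → Event x w → w ≤ W
    events-bounded x = total x >>= λ { (u* , good) → coll θ u*
        (λ u _ → lem {A = Σ D λ w → Refuted x u w} >>= λ where
           (inj₁ (w , r)) → return (w , λ z lr → unique (proj₁ (lr⟺ z w u) lr) r)
           (inj₂ n) → return (0# , λ z lr → ⊥-elim (n (z , proj₁ (lr⟺ z 0# u) lr))))
        >>= λ { (n , h) → max n ((x + 1#) * (x + 1#)) >>= λ { (W , n≤W , q≤W) → return (W , λ w ev W<w → ev λ where
           (inj₁ e) → q≤W (<-resp ≈-refl e W<w)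
           (inj₂ ev) → ev λ { (u , u<w , r) → em {P = u < u*} (λ z → z λ x → x)
             (λ u<u* → h u u<u* λ { (j , j<n , f) → f w (proj₂ (lr⟺ w j u) r) (<-trans (<-≤-trans j<n n≤W) W<w) })
             (λ u*≤u → proj₁ (Refuted-e r) λ z _ _ _ → mono u*≤u (good z)) }) } } }
      where
      θ : PF D 3
      θ = sub (lookup (#0 ∷ #2 ∷ cst x ∷ [])) cst LR ⊃ neg (#1 << #0)
      lr⟺ : ∀ z j i → Sem (sub (lookup (#0 ∷ #2 ∷ cst x ∷ [])) cst LR) (z ∷ j ∷ i ∷ []) ⟺ Refuted x i z
      lr⟺ z j i = ⟺-trans (PSat-sub {e = z ∷ i ∷ x ∷ []} LR (λ { zero → refl ; (suc zero) → refl ; (suc (suc zero)) → refl }) (λ _ → refl)) (LR-sat z i x)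
      unique : ∀ {u w w'} → Refuted x u w → Refuted x u w' → w ≤ w'
      unique r r' p = proj₁ (Refuted-e r') (proj₂ (Refuted-e r) _ p)

    -- Boundedness of a column is Σ⁰₂. In the step, the new members are events of some `x` not above
    -- the old bound `p`; their bounds from `events-bounded` are collected over `x < p + 1`.
    bounded-cols : ∀ i → ∃ᶜ λ p → ∀ w → ⟨ i , w ⟩ ∈ B → ¬ (p < w)
    bounded-cols = ind2 (mem (pairF #2 #0) true ⊃ neg (#1 << #0))
      (return (c , λ w h q → get h λ { (j , x , e , f , s) → case-base e f s q }))
      (λ i hp → hp >>= λ { (p , h) → coll θ (p + 1#) (λ x _ → events-bounded x >>= λ { (W , b) →
           return (W , λ z ev → b z (proj₁ (ev⟺ z W x) ev)) })
         >>= λ { (n , g) → max p n >>= λ { (W , p≤W , n≤W) → return (W , λ w hw W<w → get hw λ { (j , x , e , f , s) → step i p h n g W p≤W n≤W e f s W<w }) } } })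
      where
      case-base : ∀ {j w x} → 0# ≈ j → w ≈ x → Step j x → ¬ (c < w)
      case-base e f (base _ g) q = <-irrefl (≈-sym (≈-trans f g)) q
      case-base e f (keep j g _) q = suc≉0 (≈-sym (≈-trans e g))
      case-base e f (new j x g _ _ _) q = suc≉0 (≈-sym (≈-trans e g))
      θ : PF D 3
      θ = sub (lookup (#2 ∷ #0 ∷ [])) cst event ⊃ neg (#1 << #0)
      ev⟺ : ∀ z j i → Sem (sub (lookup (#2 ∷ #0 ∷ [])) cst event) (z ∷ j ∷ i ∷ []) ⟺ Event i z
      ev⟺ z j i = ⟺-trans (PSat-sub {e = i ∷ z ∷ []} event (λ { zero → refl ; (suc zero) → refl }) (λ _ → refl)) (event-sat i z)
      step : ∀ i p → (∀ w → ⟨ i , w ⟩ ∈ B → ¬ (p < w)) → ∀ n →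
        (∀ x → x < p + 1# → ∃ᶜ λ j → (j < n) × ∀ z → Sem θ (z ∷ j ∷ x ∷ [])) →
        ∀ W → p ≤ W → n ≤ W → ∀ {j x w} → i + 1# ≈ j → w ≈ x → Step j x → ¬ (W < w)
      step i p h n g W p≤W n≤W e f (base e' _) W<w = suc≉0 (≈-trans e e')
      step i p h n g W p≤W n≤W e f (keep j e' q) W<w =
        h _ (∈-resp (⟨⟩-cong (suc-inj (≈-sym (≈-trans e e'))) ≈-refl) q) (<-resp ≈-refl f (≤-<-trans p≤W W<w))
      step i p h n g W p≤W n≤W {w = w} e f (new j y e' y<x q ev) W<w =
        g y (≤⇒<+1 (h _ (∈-resp (⟨⟩-cong (suc-inj (≈-sym (≈-trans e e'))) ≈-refl) q))) λ { (k , k<n , b) →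
          b _ (proj₂ (ev⟺ _ k y) ev) (<-resp ≈-refl f (<-trans (<-≤-trans k<n n≤W) W<w)) }

    first-refutation : ∀ x u w → ¬ Unrefuted x u w → ∃ᶜ (Refuted x u)
    first-refutation x u w nu k = nu (all (w + 1#) w x<x+1)
      where
      σ : Fin 3 → PT D 2
      σ zero = #0
      σ (suc zero) = cst u
      σ (suc (suc _)) = cst x
      eq : ∀ w' y → Sem (sub σ cst X') (w' ∷ y ∷ []) ⟺ Unrefuted x u w'
      eq w' y = ⟺-trans (PSat-sub {e = w' ∷ u ∷ x ∷ []} X' (λ { zero → refl ; (suc zero) → refl ; (suc (suc zero)) → refl }) (λ _ → refl)) (X'-sat w' u x)
      all : ∀ y w' → w' < y → Unrefuted x u w'
      all y w' p = proj₁ (eq w' y) (ind0 (all< #0 (sub σ cst X')) (λ _ q → ⊥-elim (≮0 q))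
        (λ y h w' q → proj₂ (eq w' (y + 1#)) (Unrefuted-stable λ n → k (w' , λ f → f n λ w'' r →
            proj₁ (eq w'' y) (h w'' (<-≤-trans r (<+1⇒≤ q)))))) y w' p)

    -- A false instance `X(z,u,x)` is noticed at any stage beyond `z`, `u` and its queries to B;
    -- then there is a first such stage.
    refuted : ∀ x u → ¬ (∀ z → Sem X (z ∷ u ∷ x ∷ [])) → ∃ᶜ λ w → (u < w) × Refuted x u w
    refuted x u n = lem {A = Σ D λ z → ¬ Sem X (z ∷ u ∷ x ∷ [])} >>= λ where
      (inj₂ q) → ⊥-elim (n λ z → Sem-stable X λ m → q (z , m))
      (inj₁ (z , m)) → Loc'-exists X (λ d → d) (z ∷ u ∷ x ∷ []) >>= λ { (W , l) → max W z >>= λ { (W' , W≤ , z≤) → max W' u >>= λ { (W'' , W'≤ , u≤) →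
        first-refutation x u (W'' + 1#) (λ un → m (un z (≤⇒<+1 (≤-trans z≤ W'≤)) (≤⇒<+1 u≤) (Loc'-mono X (<⇒≤ (≤⇒<+1 (≤-trans W≤ W'≤))) l)))
          >>= λ { (w , r) → return (w , <-stable (λ q → proj₁ (Refuted-e r) λ z _ u<w _ → ⊥-elim (q u<w)) , r) } } } }

    columns : IsColumns M A B c X
    columns = record
      { start = put (base ≈-refl ≈-refl)
      ; keep = λ i w h → put (keep i ≈-refl h)
      ; square = λ i w h → put (new i w ≈-refl (w<sq w) h (return (inj₁ ≈-refl)))
      ; bounded-col = bounded-cols
      ; closed = λ i x h k → bounded-cols (i + 1#) λ { (p , b) →
          climb i x h k (p + 1#) λ { (w , s) → let q , r = andE ¬-stable ¬-stable s in
            b w (proj₁ (andE ∈-stable <-stable r)) (<-≤-trans x<x+1 q) } }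
      }
      where
      w<sq : ∀ w → w < (w + 1#) * (w + 1#)
      w<sq w = <-≤-trans x<x+1 (x≤x² (w + 1#))
      climbθ : D → D → PF D 2
      climbθ i x = neg (#0 << #1) ∧ᵖ (mem (pairF (cst i ⊞ on) #0) true ∧ᵖ (cst x << #0))
      -- If no member of column `i + 1` is a witness for `x`, each member `w` above `x` is refuted
      -- at a larger stage, which is an event of `x` and so belongs to the same column. This
      -- contradicts `bounded-cols`.
      climb : ∀ i x → ⟨ i , x ⟩ ∈ B → ¬ Σ D (λ w → (⟨ i + 1# , w ⟩ ∈ B) × ∀ z → Sem X (z ∷ w ∷ x ∷ [])) →
        ∀ y → ∃ᶜ λ w → Sem (climbθ i x) (w ∷ y ∷ [])
      climb i x h n = ind1 (climbθ i x)
        -- The square supplies a first candidate above `x`, as the constructor `new` requires.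
        (return ((x + 1#) * (x + 1#) , andI 0≤ (andI (put (new i x ≈-refl (w<sq x) h (return (inj₁ ≈-refl)))) (w<sq x))))
        (λ y hy → hy >>= λ { (w , s) → let y≤w , s' = andE ¬-stable ¬-stable s ; w∈ , x<w = andE ∈-stable <-stable s' in
          refuted x w (λ g → n (w , w∈ , g)) >>= λ { (w' , w<w' , r) →
            return (w' , andI (<⇒+1≤ (≤-<-trans y≤w w<w'))
              (andI (put (new i x ≈-refl (<-trans x<w w<w') h (return (inj₂ (return (w , w<w' , r)))))) (<-trans x<w w<w'))) } })

  -- The hypotheses range over all sets because `X` is fixed before B is known.
  columns-exist :
    (∀ B {z u u' x} → u ≤ u' → PSat ⟪ A , B ⟫ (λ d → d) (z ∷ u ∷ x ∷ []) X → PSat ⟪ A , B ⟫ (λ d → d) (z ∷ u' ∷ x ∷ []) X) →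
    (∀ B x → ∃ᶜ λ u → ∀ z → PSat ⟪ A , B ⟫ (λ d → d) (z ∷ u ∷ x ∷ []) X) →
    ∃ᶜ λ B → IsColumns M A B c X
  columns-exist mono total = Coding.Recursion.fixpoint M st A Θ Θ-local >>= λ { (B , fix) →
    return (B , Verify.columns B fix (λ {z} {u} {u'} {x} → mono B {z} {u} {u'} {x}) (total B)) }

-- Δ₀ approximations of arithmetical formulas

-- A set given by a pair (ε , δ) is {n : ∃w ε(w,n)}, with complement {n : ∃w δ(w,n)}.
-- tr true (tr false) says of a Δ₀ formula in such sets that its truth
-- (falsity) is confirmed by witnesses below w.

evT : ∀ {C k} → (ℕ → PT C k) → Tm → PT C k
evT τ (var n) = τ n
evT τ zer = zr
evT τ one = on
evT τ (s ⊕ t) = evT τ s ⊞ evT τ t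
evT τ (s ⊗ t) = evT τ s ⊠ evT τ t

liftτ : ∀ {C k} → (ℕ → PT C k) → ℕ → PT C (suc k)
liftτ τ zero = #0
liftτ τ (suc n) = wkP (τ n)

Codes : Set → Set
Codes C = ℕ → Bool → PF C 2

module _ {C : Set} (cs : Codes C) where

  memF : Bool → ∀ {k} → (ℕ → PT C k) → PT C k → Tm → ℕ → PF C k
  memF b τ w t X = ex< w (sub (lookup (#0 ∷ wkP (evT τ t) ∷ [])) cst (cs X b))

  tr : Bool → ∀ {k} → (ℕ → PT C k) → PT C k → ∀ {φ} → Δ₀ φ → PF C k
  tr true τ w d⊥ = ff
  tr false τ w d⊥ = ff ⊃ ff
  tr true τ w (d≐ s t) = evT τ s == evT τ t
  tr false τ w (d≐ s t) = neg (evT τ s == evT τ t)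
  tr true τ w (d≺ s t) = evT τ s << evT τ t
  tr false τ w (d≺ s t) = neg (evT τ s << evT τ t)
  tr true τ w (d∈ t X) = memF true τ w t X
  tr false τ w (d∈ t X) = memF false τ w t X
  -- A premise enters only through its confirmed falsity, which keeps both readings monotone in `w`.
  tr true τ w (d⇒ d e) = neg (tr false τ w d) ⊃ tr true τ w e
  tr false τ w (d⇒ d e) = tr true τ w d ∧ᵖ tr false τ w e
  tr true τ w (d∀< t d) = all< (evT τ t) (tr true (liftτ τ) (wkP w) d)
  tr false τ w (d∀< t d) = ex< (evT τ t) (tr false (liftτ τ) (wkP w) d)

  trΣ1 : ∀ {k} → (ℕ → PT C k) → PT C k → ∀ {φ} → Σ⁰ 1 φ → PF C k
  trΣ1 τ w (sΠ (p0 d)) = tr true τ w d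
  trΣ1 τ w (s∃ d) = ex< w (trΣ1 (liftτ τ) (wkP w) d)

  trΠ1 : ∀ {k} → (ℕ → PT C k) → PT C k → ∀ {φ} → Π⁰ 1 φ → PF C k
  trΠ1 τ w (pΣ (s0 d)) = neg (tr false τ w d)
  trΠ1 τ w (p∀ d) = all< w (trΠ1 (liftτ τ) (wkP w) d)

  trΣ2 : ∀ {k} → (ℕ → PT C k) → PT C k → PT C k → ∀ {φ} → Σ⁰ 2 φ → PF C k
  trΣ2 τ u z (sΠ d) = trΠ1 τ z d
  trΣ2 τ u z (s∃ d) = ex< u (trΣ2 (liftτ τ) (wkP u) (wkP z) d)

  -- Each block of like quantifiers is cut off at one number, so a Π⁰₃ formula takes the form ∀x∃u∀z
  -- of a Δ₀ formula; the confirmations of set membership share the bound `z`.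
  trΠ3 : ∀ {k} → (ℕ → PT C k) → PT C k → PT C k → PT C k → ∀ {φ} → Π⁰ 3 φ → PF C k
  trΠ3 τ x u z (pΣ d) = trΣ2 τ u z d
  trΠ3 τ x u z (p∀ d) = all< x (trΠ3 (liftτ τ) (wkP x) (wkP u) (wkP z) d)

-- The common ground of M and the cut: the approximations are analysed once and used in both.
record Frame (N : Model) (I : Bool → Model.D N → Set) : Set where
  open Model N
  open Interp N
  infix 4 _≤_
  _≤_ : D → D → Set
  x ≤ y = ¬ (y < x)
  field
    I-stable : StableI I
    x<x+1 : ∀ {x} → x < x + 1#
    <-≤-trans : ∀ {x y z} → x < y → y ≤ z → x < z
    <⇒≤ : ∀ {x y} → x < y → x ≤ y
    collection : (θ : PF D 3) → ∀ m → (∀ i → i < m → ∃ᶜ λ j → ∀ z → PSat I (λ d → d) (z ∷ j ∷ i ∷ []) θ) →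
      ∃ᶜ λ n → ∀ i → i < m → ∃ᶜ λ j → (j < n) × ∀ z → PSat I (λ d → d) (z ∷ j ∷ i ∷ []) θ

  ≤-refl : ∀ {x} → x ≤ x
  ≤-refl p = <⇒≤ p p

  ≤-trans : ∀ {x y z} → x ≤ y → y ≤ z → x ≤ z
  ≤-trans p q r = q (<-≤-trans r p)

  max : ∀ x y → ∃ᶜ λ z → (x ≤ z) × (y ≤ z)
  max x y k = k (y , (λ p → k (x , ≤-refl , <⇒≤ p)) , ≤-refl)

module Collect (N : Model) {I : Bool → Model.D N → Set} (fr : Frame N I) {C : Set} (κ : C → Model.D N) where
  open Model N
  open Interp N
  open Frame fr

  coll2 : ∀ {k} (F : PF C (suc (suc (suc k)))) e m → (∀ i → i < m → ∃ᶜ λ j → ∀ z → PSat I κ (z ∷ j ∷ i ∷ e) F) →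
      ∃ᶜ λ n → ∀ i → i < m → ∃ᶜ λ j → (j < n) × ∀ z → PSat I κ (z ∷ j ∷ i ∷ e) F
  coll2 {k} F e m h = collection (sub σ (λ c → cst (κ c)) F) m
      (λ i p → h i p >>= λ { (j , s) → return (j , λ z → proj₂ (eq z j i) (s z)) })
    >>= λ { (n , g) → return (n , λ i p → g i p >>= λ { (j , j<n , s) → return (j , j<n , λ z → proj₁ (eq z j i) (s z)) }) }
    where
    σ : Fin (suc (suc (suc k))) → PT D 3
    σ zero = #0
    σ (suc zero) = #1
    σ (suc (suc zero)) = #2
    σ (suc (suc (suc i))) = cst (lookup e i)
    eq : ∀ z j i → PSat I (λ d → d) (z ∷ j ∷ i ∷ []) (sub σ (λ c → cst (κ c)) F) ⟺ PSat I κ (z ∷ j ∷ i ∷ e) F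
    eq z j i = PSat-sub F (λ { zero → refl ; (suc zero) → refl ; (suc (suc zero)) → refl ; (suc (suc (suc i))) → refl }) (λ _ → refl)

  coll1 : ∀ {k} (F : PF C (suc (suc k))) e m → (∀ i → i < m → ∃ᶜ λ j → PSat I κ (j ∷ i ∷ e) F) →
      ∃ᶜ λ n → ∀ i → i < m → ∃ᶜ λ j → (j < n) × PSat I κ (j ∷ i ∷ e) F
  coll1 F e m h = coll2 (sub (λ i → v (suc i)) cst F) e m
      (λ i p → h i p >>= λ { (j , s) → return (j , λ z → proj₂ (eq z j i) s) })
    >>= λ { (n , g) → return (n , λ i p → g i p >>= λ { (j , j<n , s) → return (j , j<n , proj₁ (eq m j i) (s m)) }) }
    where
    eq : ∀ z j i → PSat I κ (z ∷ j ∷ i ∷ e) (sub (λ i → v (suc i)) cst F) ⟺ PSat I κ (j ∷ i ∷ e) F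
    eq z j i = PSat-sub F (λ _ → refl) (λ _ → refl)

  -- Otherwise every `j < m` fails at some `z`. Collection bounds these `z` by some `n`, and the `j`
  -- that is good at `n` is then good at its own `z`.
  swap : ∀ {k} (F : PF C (suc (suc k))) e m → (∀ {j z z'} → z ≤ z' → PSat I κ (j ∷ z' ∷ e) F → PSat I κ (j ∷ z ∷ e) F) →
    (∀ z → ∃ᶜ λ j → (j < m) × PSat I κ (j ∷ z ∷ e) F) → ∃ᶜ λ j → (j < m) × ∀ z → PSat I κ (j ∷ z ∷ e) F
  swap {k} F e m anti h no = coll1 (neg (sub σ cst F)) e m
      (λ j p no' → no (j , p , λ z → PSat-stable (λ b → I-stable b) F λ nF → no' (z , λ s → nF (proj₁ (eq z j) s))))
    λ { (n , g) → h n λ { (j , p , s) → g j p λ { (z , z<n , nF) → nF (proj₂ (eq z j) (anti {j} (<⇒≤ z<n) s)) } } }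
    where
    σ : Fin (suc (suc k)) → PT C (suc (suc k))
    σ zero = #1
    σ (suc zero) = #0
    σ (suc (suc i)) = v (suc (suc i))
    eq : ∀ z j → PSat I κ (z ∷ j ∷ e) (sub σ cst F) ⟺ PSat I κ (j ∷ z ∷ e) F
    eq z j = PSat-sub F (λ { zero → refl ; (suc zero) → refl ; (suc (suc i)) → refl }) (λ _ → refl)

module Stage (N : Model) {I : Bool → Model.D N → Set} (fr : Frame N I) {C : Set} (κ : C → Model.D N) (cs : Codes C) where
  open Model N
  open Interp N
  open Frame fr
  open Collect N fr κ

  P : ∀ {k} → Vec D k → PF C k → Set
  P e φ = PSat I κ e φ

  P-stable : ∀ {k} {e : Vec D k} (φ : PF C k) → Stable (P e φ)
  P-stable φ = PSat-stable (λ b → I-stable b) φ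

  record Represents {k} (e : Vec D k) (τ : ℕ → PT C k) (ρ : ℕ → D) : Set where
    constructor represents
    field at : ∀ n → ⟦ τ n ⟧ κ e ≡ ρ n
  open Represents

  rep-lift : ∀ {k} {e : Vec D k} {τ ρ} d → Represents e τ ρ → Represents (d ∷ e) (liftτ τ) (d ◂ ρ)
  at (rep-lift d r) zero = refl
  at (rep-lift {τ = τ} d r) (suc n) = trans (wkP-eval (τ n)) (at r n)

  rep-wk : ∀ {k} {e : Vec D k} {τ ρ} d → Represents e τ ρ → Represents (d ∷ e) (λ n → wkP (τ n)) ρ
  at (rep-wk {τ = τ} d r) n = trans (wkP-eval (τ n)) (at r n)

  evT-eval : ∀ {k} {e : Vec D k} {τ ρ} → Represents e τ ρ → ∀ t → ⟦ evT τ t ⟧ κ e ≡ eval ρ t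
  evT-eval r (var n) = at r n
  evT-eval r zer = refl
  evT-eval r one = refl
  evT-eval r (s ⊕ t) = cong₂ _+_ (evT-eval r s) (evT-eval r t)
  evT-eval r (s ⊗ t) = cong₂ _*_ (evT-eval r s) (evT-eval r t)

  wk-≤ : ∀ {k l} {e : Vec D k} {e' : Vec D l} {d d'} w w' → ⟦ w ⟧ κ e ≤ ⟦ w' ⟧ κ e' → ⟦ wkP w ⟧ κ (d ∷ e) ≤ ⟦ wkP w' ⟧ κ (d' ∷ e')
  wk-≤ w w' = subst₂ _≤_ (sym (wkP-eval w)) (sym (wkP-eval w'))

  tr∈ : ∀ {k} {e : Vec D k} {τ ρ} b w t X → Represents e τ ρ →
    P e (memF cs b τ w t X) ⟺ (∃ᶜ λ d → (d < ⟦ w ⟧ κ e) × P (d ∷ eval ρ t ∷ []) (cs X b))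
  tr∈ {e = e} {τ} b w t X r = (λ h → ex-e h >>= λ { (d , p , q) → return (d , p , proj₁ (eq d) q) }) ,
    (λ h → ex-i (h >>= λ { (d , p , q) → return (d , p , proj₂ (eq d) q) }))
    where
    eq : ∀ d → P (d ∷ e) (sub (lookup (#0 ∷ wkP (evT τ t) ∷ [])) cst (cs X b)) ⟺ P (d ∷ _ ∷ []) (cs X b)
    eq d = PSat-sub (cs X b) (λ { zero → refl ; (suc zero) → trans (wkP-eval (evT τ t)) (evT-eval r t) }) (λ _ → refl)

  -- Two environments that represent the same valuation are compared, because the same formula is
  -- used in contexts with different auxiliary variables.
  tr-mono : ∀ b {φ} (d : Δ₀ φ) {k l} {e : Vec D k} {e' : Vec D l} {τ τ' ρ} w w' → Represents e τ ρ → Represents e' τ' ρ →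
    ⟦ w ⟧ κ e ≤ ⟦ w' ⟧ κ e' → P e (tr cs b τ w d) → P e' (tr cs b τ' w' d)
  tr-mono true d⊥ w w' r r' p h = h
  tr-mono false d⊥ w w' r r' p h = h
  tr-mono true (d≐ s t) w w' r r' p h = subst₂ _≈_ (trans (evT-eval r s) (sym (evT-eval r' s))) (trans (evT-eval r t) (sym (evT-eval r' t))) h
  tr-mono false (d≐ s t) w w' r r' p h q = h (subst₂ _≈_ (trans (evT-eval r' s) (sym (evT-eval r s))) (trans (evT-eval r' t) (sym (evT-eval r t))) q)
  tr-mono true (d≺ s t) w w' r r' p h = subst₂ _<_ (trans (evT-eval r s) (sym (evT-eval r' s))) (trans (evT-eval r t) (sym (evT-eval r' t))) h
  tr-mono false (d≺ s t) w w' r r' p h q = h (subst₂ _<_ (trans (evT-eval r' s) (sym (evT-eval r s))) (trans (evT-eval r' t) (sym (evT-eval r t))) q)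
  tr-mono true (d∈ t X) w w' r r' p h = proj₂ (tr∈ true w' t X r') (proj₁ (tr∈ true w t X r) h >>= λ { (d , q , s) → return (d , <-≤-trans q p , s) })
  tr-mono false (d∈ t X) w w' r r' p h = proj₂ (tr∈ false w' t X r') (proj₁ (tr∈ false w t X r) h >>= λ { (d , q , s) → return (d , <-≤-trans q p , s) })
  tr-mono true (d⇒ d f) w w' r r' p h n = tr-mono true f w w' r r' p (h λ x → n (tr-mono false d w w' r r' p x))
  tr-mono false (d⇒ d f) w w' r r' p h k = h λ a b → k (tr-mono true d w w' r r' p a) (tr-mono false f w w' r r' p b)
  tr-mono true (d∀< t d) w w' r r' p h x q =
    tr-mono true d (wkP w) (wkP w') (rep-lift x r) (rep-lift x r') (wk-≤ w w' p)
      (h x (subst (x <_) (trans (evT-eval r' t) (sym (evT-eval r t))) q))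
  tr-mono false (d∀< t d) w w' r r' p h k = h λ x q s →
    k x (subst (x <_) (trans (evT-eval r t) (sym (evT-eval r' t))) q)
      (tr-mono false d (wkP w) (wkP w') (rep-lift x r) (rep-lift x r') (wk-≤ w w' p) s)

  Π1-anti : ∀ {φ} (d : Π⁰ 1 φ) {k l} {e : Vec D k} {e' : Vec D l} {τ τ' ρ} w w' → Represents e τ ρ → Represents e' τ' ρ →
    ⟦ w' ⟧ κ e' ≤ ⟦ w ⟧ κ e → P e (trΠ1 cs τ w d) → P e' (trΠ1 cs τ' w' d)
  Π1-anti (pΣ (s0 d)) w w' r r' p h f = h (tr-mono false d w' w r' r p f)
  Π1-anti (p∀ d) w w' r r' p h x q =
    Π1-anti d (wkP w) (wkP w') (rep-lift x r) (rep-lift x r') (wk-≤ w' w p) (h x (<-≤-trans q p))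

  Σ2-mono : ∀ {φ} (d : Σ⁰ 2 φ) {k l} {e : Vec D k} {e' : Vec D l} {τ τ' ρ} u z u' z' → Represents e τ ρ → Represents e' τ' ρ →
    ⟦ u ⟧ κ e ≤ ⟦ u' ⟧ κ e' → ⟦ z' ⟧ κ e' ≤ ⟦ z ⟧ κ e → P e (trΣ2 cs τ u z d) → P e' (trΣ2 cs τ' u' z' d)
  Σ2-mono (sΠ d) u z u' z' r r' p q h = Π1-anti d z z' r r' q h
  Σ2-mono (s∃ d) u z u' z' r r' p q h k = h λ x o s →
    k x (<-≤-trans o p) (Σ2-mono d (wkP u) (wkP z) (wkP u') (wkP z') (rep-lift x r) (rep-lift x r') (wk-≤ u u' p) (wk-≤ z' z q) s)

  Π3-mono : ∀ {φ} (d : Π⁰ 3 φ) {k l} {e : Vec D k} {e' : Vec D l} {τ τ' ρ} x u z x' u' z' → Represents e τ ρ → Represents e' τ' ρ →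
    ⟦ x' ⟧ κ e' ≤ ⟦ x ⟧ κ e → ⟦ u ⟧ κ e ≤ ⟦ u' ⟧ κ e' → ⟦ z' ⟧ κ e' ≤ ⟦ z ⟧ κ e → P e (trΠ3 cs τ x u z d) → P e' (trΠ3 cs τ' x' u' z' d)
  Π3-mono (pΣ d) x u z x' u' z' r r' o p q h = Σ2-mono d u z u' z' r r' p q h
  Π3-mono (p∀ d) x u z x' u' z' r r' o p q h y y< =
    Π3-mono d (wkP x) (wkP u) (wkP z) (wkP x') (wkP u') (wkP z') (rep-lift y r) (rep-lift y r') (wk-≤ x' x o) (wk-≤ u u' p) (wk-≤ z' z q)
      (h y (<-≤-trans y< o))

  module Correct (η : ℕ → S)
    (hε : ∀ X n → (n ∈ η X) ⟺ (∃ᶜ λ w → P (w ∷ n ∷ []) (cs X true)))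
    (hδ : ∀ X n → (¬ (n ∈ η X)) ⟺ (∃ᶜ λ w → P (w ∷ n ∷ []) (cs X false))) where

    Holds : Bool → (ℕ → D) → Fm → Set
    Holds true ρ φ = Sat ρ η φ
    Holds false ρ φ = ¬ Sat ρ η φ

    tr-sound : ∀ b {φ} (d : Δ₀ φ) {k} {e : Vec D k} {τ ρ w} → Represents e τ ρ → P e (tr cs b τ w d) → Holds b ρ φ
    tr-sound true d⊥ r h = h
    tr-sound false d⊥ r h = h
    tr-sound true (d≐ s t) r h = subst₂ _≈_ (evT-eval r s) (evT-eval r t) h
    tr-sound false (d≐ s t) r h q = h (subst₂ _≈_ (sym (evT-eval r s)) (sym (evT-eval r t)) q)
    tr-sound true (d≺ s t) r h = subst₂ _<_ (evT-eval r s) (evT-eval r t) h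
    tr-sound false (d≺ s t) r h q = h (subst₂ _<_ (sym (evT-eval r s)) (sym (evT-eval r t)) q)
    tr-sound true (d∈ t X) {w = w} r h = proj₂ (hε X _) (proj₁ (tr∈ true w t X r) h >>= λ { (d , _ , q) → return (d , q) })
    tr-sound false (d∈ t X) {w = w} r h = proj₂ (hδ X _) (proj₁ (tr∈ false w t X r) h >>= λ { (d , _ , q) → return (d , q) })
    tr-sound true (d⇒ d f) r h a = tr-sound true f r (h λ x → tr-sound false d r x a)
    tr-sound false (d⇒ d f) r h k = h λ a b → tr-sound false f r b (k (tr-sound true d r a))
    tr-sound true (d∀< t d) {ρ = ρ} r h x q = tr-sound true d (rep-lift x r) (h x (subst (x <_) (trans (eval-wk t) (sym (evT-eval r t))) q))
    tr-sound false (d∀< t d) r h k = h λ x q s → tr-sound false d (rep-lift x r) s (k x (subst (x <_) (trans (evT-eval r t) (sym (eval-wk t))) q))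

    -- The bound has to survive a change of variable context, so it is asked for in all environments
    -- at once.
    Confirmed : Bool → ∀ {φ} → Δ₀ φ → (ℕ → D) → D → Set
    Confirmed b d ρ W = ∀ m (e : Vec D m) τ w → Represents e τ ρ → W ≤ ⟦ w ⟧ κ e → P e (tr cs b τ w d)

    anytime : ∀ {b φ} (d : Δ₀ φ) {ρ} → (∀ m (e : Vec D m) τ w → Represents e τ ρ → P e (tr cs b τ w d)) → ∃ᶜ (Confirmed b d ρ)
    anytime d h = return (0# , λ _ e τ w r _ → h _ e τ w r)

    witness< : ∀ {b t X ρ} d → P (d ∷ eval ρ t ∷ []) (cs X b) → Confirmed b (d∈ t X) ρ (d + 1#)
    witness< {true} {t} {X} d h _ e τ w r p = proj₂ (tr∈ true w t X r) (return (d , <-≤-trans x<x+1 p , h))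
    witness< {false} {t} {X} d h _ e τ w r p = proj₂ (tr∈ false w t X r) (return (d , <-≤-trans x<x+1 p , h))

    tr-complete : ∀ b {φ} (d : Δ₀ φ) {k} (e : Vec D k) τ {ρ} → Represents e τ ρ → Holds b ρ φ → ∃ᶜ (Confirmed b d ρ)
    tr-complete true d⊥ e τ r h = ⊥-elim h
    tr-complete false d⊥ e τ r h = anytime {false} d⊥ λ _ _ _ _ _ x → x
    tr-complete true (d≐ s t) e τ r h = anytime {true} (d≐ s t) λ _ e τ w r → subst₂ _≈_ (sym (evT-eval r s)) (sym (evT-eval r t)) h
    tr-complete false (d≐ s t) e τ r h = anytime {false} (d≐ s t) λ _ e τ w r q → h (subst₂ _≈_ (evT-eval r s) (evT-eval r t) q)
    tr-complete true (d≺ s t) e τ r h = anytime {true} (d≺ s t) λ _ e τ w r → subst₂ _<_ (sym (evT-eval r s)) (sym (evT-eval r t)) h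
    tr-complete false (d≺ s t) e τ r h = anytime {false} (d≺ s t) λ _ e τ w r q → h (subst₂ _<_ (evT-eval r s) (evT-eval r t) q)
    tr-complete true (d∈ t X) e τ r h = proj₁ (hε X _) h >>= λ { (d , q) → return (d + 1# , witness< {true} {t} {X} d q) }
    tr-complete false (d∈ t X) e τ r h = proj₁ (hδ X _) h >>= λ { (d , q) → return (d + 1# , witness< {false} {t} {X} d q) }
    tr-complete true (d⇒ {φ} d f) e τ {ρ} r h = lem {A = Sat ρ η φ} >>= λ where
      (inj₁ a) → tr-complete true f e τ r (h a) >>= λ { (W , c) → return (W , λ _ e τ w r p _ → c _ e τ w r p) }
      (inj₂ n) → tr-complete false d e τ r n >>= λ { (W , c) → return (W , λ _ e τ w r p q → ⊥-elim (q (c _ e τ w r p))) }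
    tr-complete false (d⇒ {φ} {ψ} d f) e τ {ρ} r h =
      tr-complete true d e τ r (Sat-stable φ λ n → h λ a → ⊥-elim (n a)) >>= λ { (W , c) →
      tr-complete false f e τ r (λ b → h λ _ → b) >>= λ { (W' , c') → max W W' >>= λ { (V , p , q) →
      return (V , λ _ e τ w r s → andI (c _ e τ w r (≤-trans p s)) (c' _ e τ w r (≤-trans q s))) } } }
    -- Each instance is confirmed by its own bound; `coll1` finds a common one.
    tr-complete true (d∀< t d) {k} e τ {ρ} r h =
      coll1 F e (eval ρ t) (λ x q → tr-complete true d (x ∷ e) (liftτ τ) (rep-lift x r) (h x (subst (x <_) (sym (eval-wk t)) q)) >>= λ { (W , c) →
        return (W , c _ (W ∷ x ∷ e) _ #0 (rep-wk W (rep-lift x r)) ≤-refl) })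
      >>= λ { (n , g) → return (n , λ _ e' τ' w r' p x q → P-stable (tr cs true (liftτ τ') (wkP w) d) (g x (subst (x <_) (evT-eval r' t) q) >>= λ { (j , j<n , s) →
        return (tr-mono true d #0 (wkP w) (rep-wk j (rep-lift x r)) (rep-lift x r')
          (subst (j ≤_) (sym (wkP-eval w)) (≤-trans (<⇒≤ j<n) p)) s) })) }
      where
      F : PF C (suc (suc k))
      F = tr cs true (λ n → wkP (liftτ τ n)) #0 d
    tr-complete false (d∀< t {φ} d) e τ {ρ} r h =
      lem {A = Σ D λ x → (x < eval ρ t) × ¬ Sat (x ◂ ρ) η φ} >>= λ where
        (inj₂ n) → ⊥-elim (h λ x q → Sat-stable φ λ m → n (x , subst (x <_) (eval-wk t) q , m))
        (inj₁ (x , q , m)) → tr-complete false d (x ∷ e) (liftτ τ) (rep-lift x r) m >>= λ { (W , c) →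
          return (W , λ _ e' τ' w r' p k → k x (subst (x <_) (sym (evT-eval r' t)) q)
            (c _ (x ∷ e') (liftτ τ') (wkP w) (rep-lift x r') (subst (W ≤_) (sym (wkP-eval w)) p))) }

    Σ1-sound : ∀ {φ} (d : Σ⁰ 1 φ) {k} {e : Vec D k} {τ ρ w} → Represents e τ ρ → P e (trΣ1 cs τ w d) → Sat ρ η φ
    Σ1-sound (sΠ (p0 d)) r h = tr-sound true d r h
    Σ1-sound (s∃ d) r h k = h λ x _ s → k x (Σ1-sound d (rep-lift x r) s)

    Σ1-complete : ∀ {φ} (d : Σ⁰ 1 φ) {k} (e : Vec D k) τ {ρ} → Represents e τ ρ → Sat ρ η φ →
      ∃ᶜ λ W → ∀ m (e : Vec D m) τ w → Represents e τ ρ → W ≤ ⟦ w ⟧ κ e → P e (trΣ1 cs τ w d)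
    Σ1-complete (sΠ (p0 d)) e τ r h = tr-complete true d e τ r h
    Σ1-complete (s∃ d) e τ r h k = h λ x s → Σ1-complete d (x ∷ e) (liftτ τ) (rep-lift x r) s λ { (W , c) → max W (x + 1#) λ { (V , W≤V , x<V) →
      k (V , λ _ e' τ' w r' p q → q x (<-≤-trans x<x+1 (≤-trans x<V p)) (c _ (x ∷ e') (liftτ τ') (wkP w) (rep-lift x r') (subst (W ≤_) (sym (wkP-eval w)) (≤-trans W≤V p)))) } }

    Π1-complete : ∀ {φ} (d : Π⁰ 1 φ) {k} {e : Vec D k} {τ ρ} w → Represents e τ ρ → Sat ρ η φ → P e (trΠ1 cs τ w d)
    Π1-complete (pΣ (s0 d)) w r h f = tr-sound false d r f h
    Π1-complete (p∀ d) w r h x _ = Π1-complete d (wkP w) (rep-lift x r) (h x)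

    Π1-sound : ∀ {φ} (d : Π⁰ 1 φ) {k} (e : Vec D k) τ {ρ} → Represents e τ ρ →
      (∀ W → P (W ∷ e) (trΠ1 cs (λ n → wkP (τ n)) #0 d)) → Sat ρ η φ
    Π1-sound {φ} (pΣ (s0 d)) e τ r h = Sat-stable φ λ n → tr-complete false d e τ r n λ { (W , c) → h W (c _ (W ∷ e) _ #0 (rep-wk W r) ≤-refl) }
    Π1-sound (p∀ d) e τ r h x = Π1-sound d (x ∷ e) (liftτ τ) (rep-lift x r) λ W →
      P-stable (trΠ1 cs (λ n → wkP (liftτ τ n)) #0 d) (max W (x + 1#) >>= λ { (V , W≤V , x<V) →
        return (Π1-anti d #1 #0 (rep-lift x (rep-wk V r)) (rep-wk W (rep-lift x r)) W≤V (h V x (<-≤-trans x<x+1 x<V))) })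

    Σ2-complete : ∀ {φ} (d : Σ⁰ 2 φ) {ρ} → Sat ρ η φ →
      ∃ᶜ λ U → ∀ m (e : Vec D m) τ u z → Represents e τ ρ → U ≤ ⟦ u ⟧ κ e → P e (trΣ2 cs τ u z d)
    Σ2-complete (sΠ d) h = return (0# , λ _ e τ u z r _ → Π1-complete d z r h)
    Σ2-complete (s∃ d) h k = h λ x s → Σ2-complete d s λ { (W , c) → max W (x + 1#) λ { (V , W≤V , x<V) →
      k (V , λ _ e τ u z r p q → q x (<-≤-trans x<x+1 (≤-trans x<V p))
        (c _ (x ∷ e) (liftτ τ) (wkP u) (wkP z) (rep-lift x r) (subst (W ≤_) (sym (wkP-eval u)) (≤-trans W≤V p)))) } }

    mutual
      Σ2-sound : ∀ {φ} (d : Σ⁰ 2 φ) {k} (e : Vec D k) τ {ρ} u → Represents e τ ρ →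
        (∀ Z → P (Z ∷ e) (trΣ2 cs (λ n → wkP (τ n)) (wkP u) #0 d)) → Sat ρ η φ
      Σ2-sound (sΠ d) e τ u r h = Π1-sound d e τ r h
      Σ2-sound (s∃ d) e τ u r h k = Σ2-witness d e τ u r h λ { (j , _ , s) → k j s }

      -- For each `Z` some `j` below the bound survives up to `Z`, and survival is antitone in `Z`,
      -- so `swap` yields a single `j`. Its bound is kept for proving BΣ⁰₂ in the cut.
      Σ2-witness : ∀ {φ} (d : Σ⁰ 2 φ) {k} (e : Vec D k) τ {ρ} u → Represents e τ ρ →
        (∀ Z → P (Z ∷ e) (trΣ2 cs (λ n → wkP (τ n)) (wkP u) #0 (s∃ d))) → ∃ᶜ λ j → (j < ⟦ u ⟧ κ e) × Sat (j ◂ ρ) η φ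
      Σ2-witness d e τ {ρ} u r h =
        swap (trΣ2 cs (liftτ (λ n → wkP (τ n))) (wkP (wkP u)) #1 d) e (⟦ u ⟧ κ e)
          (λ {j} {z} {z'} z≤z' → Σ2-mono d (wkP (wkP u)) #1 (wkP (wkP u)) #1 (rep-lift j (rep-wk z' r)) (rep-lift j (rep-wk z r))
            (subst₂ _≤_ (sym (wk2 j z')) (sym (wk2 j z)) ≤-refl) z≤z')
          (λ Z → ex-e (h Z) >>= λ { (j , p , s) → return (j , subst (j <_) (wkP-eval u) p , s) })
        >>= λ { (j , p , s) → return (j , p , Σ2-sound d (j ∷ e) (liftτ τ) (wkP u) (rep-lift j r) λ Z →
            Σ2-mono d (wkP (wkP u)) #1 (wkP (wkP u)) #0 (rep-lift j (rep-wk Z r)) (rep-wk Z (rep-lift j r))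
              (subst₂ _≤_ (sym (wk2 j Z)) (sym (wk2 Z j)) ≤-refl) ≤-refl (s Z)) }
        where
        wk2 : ∀ a b → ⟦ wkP (wkP u) ⟧ κ (a ∷ b ∷ e) ≡ ⟦ u ⟧ κ e
        wk2 a b = trans (wkP-eval (wkP u)) (wkP-eval u)

    -- Every `y < x` has its own `U`; `coll2` provides one for all of them.
    Π3-complete : ∀ {φ} (d : Π⁰ 3 φ) {k} (e : Vec D k) τ {ρ} → Represents e τ ρ → Sat ρ η φ → ∀ x →
      ∃ᶜ λ U → ∀ m (e : Vec D m) τ x' u z → Represents e τ ρ → ⟦ x' ⟧ κ e ≡ x → U ≤ ⟦ u ⟧ κ e → P e (trΠ3 cs τ x' u z d)
    Π3-complete (pΣ d) e τ r h x = Σ2-complete d h >>= λ { (U , c) → return (U , λ _ e τ x' u z r _ p → c _ e τ u z r p) }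
    Π3-complete (p∀ d) {k} e τ {ρ} r h x =
      coll2 F (x ∷ e) x (λ y _ → Π3-complete d (y ∷ e) (liftτ τ) (rep-lift y r) (h y) x >>= λ { (U , c) →
        return (U , λ z → c _ (z ∷ U ∷ y ∷ x ∷ e) _ #3 #1 #0 (rF z U y) refl ≤-refl) })
      >>= λ { (n , g) → return (n , λ _ e' τ' x' u z r' e≡ p y y<x →
        P-stable (trΠ3 cs (liftτ τ') (wkP x') (wkP u) (wkP z) d) (g y (subst (y <_) e≡ y<x) >>= λ { (j , j<n , s) →
          return (Π3-mono d #3 #1 #0 (wkP x') (wkP u) (wkP z) (rF (⟦ z ⟧ κ e') j y) (rep-lift y r')
            (subst (_≤ x) (sym (trans (wkP-eval x') e≡)) ≤-refl) (subst (j ≤_) (sym (wkP-eval u)) (≤-trans (<⇒≤ j<n) p))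
            (subst (_≤ ⟦ z ⟧ κ e') (sym (wkP-eval z)) ≤-refl) (s (⟦ z ⟧ κ e'))) })) }
      where
      τF : ℕ → PT C (suc (suc (suc (suc k))))
      τF n = wkP (wkP (liftτ (λ n → wkP (τ n)) n))
      F : PF C (suc (suc (suc (suc k))))
      F = trΠ3 cs τF #3 #1 #0 d
      rF : ∀ z j y → Represents (z ∷ j ∷ y ∷ x ∷ e) τF (y ◂ ρ)
      rF z j y = rep-wk z (rep-wk j (rep-lift y (rep-wk x r)))

    -- The lower bound `x₀` makes the induction go through: removing a quantifier over `y` requires
    -- `x` to stay above `y` from then on.
    Π3-sound : ∀ {φ} (d : Π⁰ 3 φ) {k} (e : Vec D k) τ {ρ} x₀ → Represents e τ ρ →
      (∀ x → x₀ ≤ x → ∃ᶜ λ U → ∀ m (e : Vec D m) τ x' u z → Represents e τ ρ → ⟦ x' ⟧ κ e ≡ x → ⟦ u ⟧ κ e ≡ U → P e (trΠ3 cs τ x' u z d)) → Sat ρ η φ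
    Π3-sound {φ} (pΣ d) e τ x₀ r h = Sat-stable φ (h x₀ ≤-refl >>= λ { (U , c) → return
      (Σ2-sound d (x₀ ∷ U ∷ e) _ #1 (rep-wk x₀ (rep-wk U r)) λ Z → c _ (Z ∷ x₀ ∷ U ∷ e) _ #1 #2 #0 (rep-wk Z (rep-wk x₀ (rep-wk U r))) refl refl) })
    Π3-sound {∀ⁿ φ} (p∀ d) e τ {ρ} x₀ r h y = Sat-stable φ (max x₀ (y + 1#) >>= λ { (x₁ , x₀≤ , y<) → return
      (Π3-sound d (y ∷ e) (liftτ τ) x₁ (rep-lift y r) λ x x₁≤x → h x (≤-trans x₀≤ x₁≤x) >>= λ { (U , c) → return (U , λ _ e' τ' x' u z r' e≡ u≡ →
        let Z = ⟦ z ⟧ κ e' ; r'' = rep-wk Z (rep-wk U (rep-wk x r)) in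
        Π3-mono d #3 #2 #1 x' u z (rep-lift y r'') r' (subst (_≤ x) (sym e≡) ≤-refl) (subst (U ≤_) (sym u≡) ≤-refl) ≤-refl
          (c _ (Z ∷ U ∷ x ∷ e) _ #2 #1 #0 r'' refl refl y (<-≤-trans x<x+1 (≤-trans y< x₁≤x)))) }) })

-- The requirements and their truth in M

module Families (Ψ : Fm) (dΨ : Π⁰ 3 Ψ) where

  -- The statements ∀x ∃u ∀z X(z,u,x) that J has to satisfy.  elem θ: every true
  -- ∃y θ(y) has a witness below u.  psi ε: either the pair ε fails to define a set
  -- Y, or the existential quantifiers of Ψ(A,Y) have witnesses below u.
  data Idx : Set where
    elem : ∀ n → PF (Fin n) 1 → Idx
    psi  : ∀ n → (Bool → PF (Fin n) 2) → Idx

  names : Idx → ℕ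
  names (elem n _) = n
  names (psi n _) = n

  codes : ∀ {C} → (Bool → PF C 2) → Codes C
  codes ε zero b = ε b
  codes ε (suc _) true = mem #1 false
  codes ε (suc _) false = neg (mem #1 false)

  at₂ : ∀ {C k} → PF C 2 → PF C (suc (suc k))
  at₂ = sub (lookup (#0 ∷ #1 ∷ [])) cst

  -- Being in neither set is Π⁰₁, hence tested up to `z`; a `conflict` is Σ⁰₁, hence witnessed below
  -- `u`. Both are thus monotone in `u`.
  undecided : ∀ {C} → (Bool → PF C 2) → PF C 3
  undecided ε = ex< #1 (all< #1 (neg (at₂ (ε true)) ∧ᵖ neg (at₂ (ε false))))

  conflict : ∀ {C} → (Bool → PF C 2) → PF C 3
  conflict ε = ex< #1 (ex< #2 (at₂ (ε true)) ∧ᵖ ex< #2 (at₂ (ε false)))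

  -- environment: z, u, x
  X₀ : (i : Idx) → PF (Fin (names i)) 3
  X₀ (elem n θ) = ex< #0 (sub (lookup (#0 ∷ [])) cst θ) ⊃ ex< #1 (sub (lookup (#0 ∷ [])) cst θ)
  X₀ (psi n ε) = undecided ε ∨ᵖ (conflict ε ∨ᵖ trΠ3 (codes ε) (λ _ → zr) #2 #1 #0 dΨ)

  nameVar : ∀ {n k} → Fin (suc n) → PT (Fin n) (suc k)
  nameVar zero = #0
  nameVar (suc j) = cst j

  -- Parameters are absorbed by quantifying over all values up to `x`. One parameter-free axiom then
  -- serves all parameters of the cut, as these lie below members of the columns.
  bindName : ∀ {n} → PF (Fin (suc n)) 3 → PF (Fin n) 3
  bindName φ = all< (#2 ⊞ on) (sub (λ i → v (suc i)) nameVar φ)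

  close : ∀ n → PF (Fin n) 3 → PF (Fin 0) 3
  close zero φ = φ
  close (suc n) φ = close n (bindName φ)

  X : Idx → PF (Fin 0) 3
  X i = close (names i) (X₀ i)

  allX : List Idx → PF (Fin 0) 3
  allX [] = ff ⊃ ff
  allX (i ∷ l) = X i ∧ᵖ allX l

  module Use (N : Model) (I : Bool → Model.D N → Set) where
    open Model N
    open Interp N

    bind-sat : ∀ {n} (φ : PF (Fin (suc n)) 3) (κ : Fin (suc n) → D) {y z u x} → κ zero ≡ y →
      PSat I (λ j → κ (suc j)) (y ∷ z ∷ u ∷ x ∷ []) (sub (λ i → v (suc i)) nameVar φ) ⟺ PSat I κ (z ∷ u ∷ x ∷ []) φ
    bind-sat φ κ refl = PSat-sub φ (λ _ → refl) (λ { zero → refl ; (suc _) → refl })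

    close-use : ∀ n (φ : PF (Fin n) 3) {κ₀ z u x} → PSat I κ₀ (z ∷ u ∷ x ∷ []) (close n φ) →
      ∀ κ → (∀ i → κ i < x + 1#) → PSat I κ (z ∷ u ∷ x ∷ []) φ
    close-use zero φ h κ b = proj₁ (PSat-κ φ λ ()) h
    close-use (suc n) φ h κ b = proj₁ (bind-sat φ κ refl) (close-use n (bindName φ) h (λ j → κ (suc j)) (λ i → b (suc i)) (κ zero) (b zero))

  module Truth (M : Model) (st : Strong M) (A : Model.S M)
    (hΨ : ∀ Y → Model.Sat M (λ _ → Model.0# M) (Y ◂ λ _ → A) Ψ) (B : Model.S M) where
    open Model M
    open Interp M
    open Arithmetic M st A hiding (x<x+1; <-≤-trans; <⇒≤; ≤-refl; ≤-trans; max; _≤_)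
    open Principles M st A B using (I; I-stable; Sem; compr; coll)
    open Use M I

    frame : Frame M I
    frame = record
      { I-stable = I-stable ; x<x+1 = Arithmetic.x<x+1 M st A ; <-≤-trans = Arithmetic.<-≤-trans M st A
      ; <⇒≤ = Arithmetic.<⇒≤ M st A ; collection = coll }
    open Frame frame using (x<x+1; <-≤-trans; <⇒≤; ≤-refl; ≤-trans; max; _≤_)

    -- The hypotheses of `columns-exist`, uniformly in the parameters; totality survives `bindName`
    -- by collection.
    record Nice {n} (φ : PF (Fin n) 3) : Set where
      field
        mono : ∀ κ {z u u' x} → u ≤ u' → PSat I κ (z ∷ u ∷ x ∷ []) φ → PSat I κ (z ∷ u' ∷ x ∷ []) φ
        total : ∀ κ x → ∃ᶜ λ u → ∀ z → PSat I κ (z ∷ u ∷ x ∷ []) φ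
    open Nice

    bind-nice : ∀ {n} {φ : PF (Fin (suc n)) 3} → Nice φ → Nice (bindName φ)
    mono (bind-nice {n} {φ} nc) κ p h y q = proj₂ (bind-sat φ κ' refl) (mono nc κ' p (proj₁ (bind-sat φ κ' refl) (h y q)))
      where
      κ' : Fin (suc n) → D
      κ' zero = y
      κ' (suc j) = κ j
    total (bind-nice {n} {φ} nc) κ x = Collect.coll2 M frame κ F (x ∷ []) (x + 1#)
        (λ i _ → total nc (κ' i) x >>= λ { (u , h) → return (u , λ z → proj₂ (eq z u i) (h z)) })
      >>= λ { (n , g) → return (n , λ z y q → proj₂ (bind-sat φ (κ' y) refl) (PSat-stable (λ b → I-stable b) φ (g y q >>= λ { (j , j<n , h) →
        return (mono nc (κ' y) (<⇒≤ j<n) (proj₁ (eq z j y) (h z))) }))) }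
      where
      κ' : D → Fin (suc n) → D
      κ' y zero = y
      κ' y (suc j) = κ j
      ν : Fin (suc n) → PT (Fin n) 4
      ν zero = #2
      ν (suc j) = cst j
      F : PF (Fin n) 4
      F = sub (lookup (#0 ∷ #1 ∷ #3 ∷ [])) ν φ
      eq : ∀ z j i → PSat I κ (z ∷ j ∷ i ∷ x ∷ []) F ⟺ PSat I (κ' i) (z ∷ j ∷ x ∷ []) φ
      eq z j i = PSat-sub φ (λ { zero → refl ; (suc zero) → refl ; (suc (suc zero)) → refl }) (λ { zero → refl ; (suc _) → refl })

    close-nice : ∀ n {φ : PF (Fin n) 3} → Nice φ → Nice (close n φ)
    close-nice zero nc = nc
    close-nice (suc n) nc = close-nice n (bind-nice nc)

    elem-nice : ∀ n θ → Nice (X₀ (elem n θ))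
    mono (elem-nice n θ) κ {z} {u} {u'} {x} p h a = ex-i (ex-e (h (ex-i (ex-e a >>= λ { (y , q , s) → return (y , q , proj₂ (eq y u) (proj₁ (eq y u') s)) }))) >>= λ { (y , q , s) → return (y , <-≤-trans q p , proj₂ (eq y u') (proj₁ (eq y u) s)) })
      where
      eq : ∀ y u → PSat I κ (y ∷ z ∷ u ∷ x ∷ []) (sub (lookup (#0 ∷ [])) cst θ) ⟺ PSat I κ (y ∷ []) θ
      eq y u = PSat-sub θ (λ { zero → refl }) (λ _ → refl)
    total (elem-nice n θ) κ x = lem {A = Σ D λ y → PSat I κ (y ∷ []) θ} >>= λ where
        (inj₁ (y , h)) → return (y + 1# , λ z _ → ex-i (return (y , x<x+1 , proj₂ (eq y z (y + 1#)) h)))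
        (inj₂ no) → return (0# , λ z a → ⊥-elim (ex-e a λ { (y , _ , h) → no (y , proj₁ (eq y z 0#) h) }))
      where
      eq : ∀ y z u → PSat I κ (y ∷ z ∷ u ∷ x ∷ []) (sub (lookup (#0 ∷ [])) cst θ) ⟺ PSat I κ (y ∷ []) θ
      eq y z u = PSat-sub θ (λ { zero → refl }) (λ _ → refl)

    module Psi {n} (ε : Bool → PF (Fin n) 2) (κ : Fin n → D) where
      at₂-sat : ∀ {k} b w m (e : Vec D k) → PSat I κ (w ∷ m ∷ e) (at₂ (ε b)) ⟺ PSat I κ (w ∷ m ∷ []) (ε b)
      at₂-sat b w m e = PSat-sub (ε b) (λ { zero → refl ; (suc zero) → refl }) (λ _ → refl)

      Def : Bool → D → Set
      Def b m = ∃ᶜ λ w → PSat I κ (w ∷ m ∷ []) (ε b)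

      body : PF (Fin n) 3
      body = X₀ (psi n ε)

      open Stage M frame κ (codes ε)

      mono' : ∀ {z u u' x} → u ≤ u' → PSat I κ (z ∷ u ∷ x ∷ []) body → PSat I κ (z ∷ u' ∷ x ∷ []) body
      mono' {z} {u} {u'} {x} p h = orI (orE h >>= λ where
        (inj₁ a) → return (inj₁ (ex-i (ex-e a >>= λ { (m , q , s) → return (m , <-≤-trans q p , λ w w<z →
          proj₁ (¬-cong (→-cong (¬-cong (⟺-trans (at₂-sat true w m _) (⟺-sym (at₂-sat true w m _)))) (¬-cong (¬-cong (⟺-trans (at₂-sat false w m _) (⟺-sym (at₂-sat false w m _))))))) (s w w<z)) })))
        (inj₂ h) → return (inj₂ (orI (orE h >>= λ where
          (inj₁ a) → return (inj₁ (ex-i (ex-e a >>= λ { (m , q , s) → return (m , <-≤-trans q p , λ k → s λ a b → k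
            (ex-i (ex-e a >>= λ { (w , r , t) → return (w , <-≤-trans r p , proj₂ (at₂-sat true w m _) (proj₁ (at₂-sat true w m _) t)) }))
            (ex-i (ex-e b >>= λ { (w , r , t) → return (w , <-≤-trans r p , proj₂ (at₂-sat false w m _) (proj₁ (at₂-sat false w m _) t)) }))) })))
          (inj₂ t) → return (inj₂ (Π3-mono dΨ #2 #1 #0 #2 #1 #0 (represents λ _ → refl) (represents λ _ → refl) ≤-refl p ≤-refl t))))))

      toD : Bool → PF D 2
      toD b = mapC κ (ε b)
      -- Here the truth of `Ψ` for all sets of M enters: a pair that is neither undecided nor in
      -- conflict defines a set `Y` by comprehension, and `Π3-complete` turns `Ψ` at `Y` into the
      -- bound `u`.
      good : ¬ Σ D (λ m → ¬ Def true m × ¬ Def false m) → ¬ Σ D (λ m → Def true m × Def false m) →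
        ∀ x → ∃ᶜ λ u → ∀ z → PSat I κ (z ∷ u ∷ x ∷ []) (trΠ3 (codes ε) (λ _ → zr) #2 #1 #0 dΨ)
      good dec cfl x = compr (toD true) (toD false) (λ m →
          (λ t → λ { (w , f) → cfl (m , (t >>= λ { (w , t) → return (w , proj₁ (PSat-mapC (ε true)) t) }) , return (w , proj₁ (PSat-mapC (ε false)) f)) }) ,
          (λ nf nt → dec (m , (λ t → t λ { (w , t) → nt (w , proj₂ (PSat-mapC (ε true)) t) }) , (λ f → f λ { (w , f) → nf (w , proj₂ (PSat-mapC (ε false)) f) }))))
        >>= λ { (Y , hY) → Correct.Π3-complete (Y ◂ λ _ → A) (hε Y hY) (hδ Y hY) dΨ [] (λ _ → zr) (represents λ _ → refl) (hΨ Y) x >>= λ { (U , c) →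
            return (U , λ z → c _ (z ∷ U ∷ x ∷ []) (λ _ → zr) #2 #1 #0 (represents λ _ → refl) refl ≤-refl) } }
        where
        HY : S → Set
        HY Y = ∀ m → (m ∈ Y) ⟺ (∃ᶜ λ w → Sem (toD true) (w ∷ m ∷ []))
        y⟺ : ∀ Y → HY Y → ∀ m → (m ∈ Y) ⟺ Def true m
        y⟺ Y hY m = (λ i → proj₁ (hY m) i >>= λ { (w , t) → return (w , proj₁ (PSat-mapC (ε true)) t) }) ,
          (λ d → proj₂ (hY m) (d >>= λ { (w , t) → return (w , proj₂ (PSat-mapC (ε true)) t) }))
        hε : ∀ Y → HY Y → ∀ X n → (n ∈ (Y ◂ λ _ → A) X) ⟺ (∃ᶜ λ w → PSat I κ (w ∷ n ∷ []) (codes ε X true))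
        hε Y hY zero m = y⟺ Y hY m
        hε Y hY (suc X) m = (λ i → return (0# , i)) , (λ h → ∈-stable (h >>= λ { (_ , i) → return i }))
        hδ : ∀ Y → HY Y → ∀ X n → (¬ (n ∈ (Y ◂ λ _ → A) X)) ⟺ (∃ᶜ λ w → PSat I κ (w ∷ n ∷ []) (codes ε X false))
        hδ Y hY zero m = (λ ni nf → dec (m , (λ t → ni (proj₂ (y⟺ Y hY m) t)) , (λ f → f nf))) , (λ f i → cfl (m , proj₁ (y⟺ Y hY m) i , f))
        hδ Y hY (suc X) m = (λ i → return (0# , i)) , (λ h i → h λ { (_ , ni) → ni i })

      total' : ∀ x → ∃ᶜ λ u → ∀ z → PSat I κ (z ∷ u ∷ x ∷ []) body
      total' x = lem {A = Σ D λ m → ¬ Def true m × ¬ Def false m} >>= λ where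
        (inj₁ (m , nt , nf)) → return (m + 1# , λ z → orI (return (inj₁ (ex-i (return (m , x<x+1 , λ w _ →
          andI (λ t → nt (return (w , proj₁ (at₂-sat true w m _) t))) (λ f → nf (return (w , proj₁ (at₂-sat false w m _) f)))))))))
        (inj₂ dec) → lem {A = Σ D λ m → Def true m × Def false m} >>= λ where
          (inj₁ (m , t , f)) → t >>= λ { (w , tw) → f >>= λ { (w' , fw) → max (m + 1#) (w + 1#) >>= λ { (a , m≤a , w≤a) → max a (w' + 1#) >>= λ { (b , a≤b , w'≤b) →
            return (b , λ z → orI (return (inj₂ (orI (return (inj₁ (ex-i (return (m , <-≤-trans x<x+1 (≤-trans m≤a a≤b) , andI
              (ex-i (return (w , <-≤-trans x<x+1 (≤-trans w≤a a≤b) , proj₂ (at₂-sat true w m _) tw)))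
              (ex-i (return (w' , <-≤-trans x<x+1 w'≤b , proj₂ (at₂-sat false w' m _) fw))))))))))) ) } } } }
          (inj₂ cfl) → good dec cfl x >>= λ { (u , h) → return (u , λ z → orI (return (inj₂ (orI (return (inj₂ (h z))))))) }

    X₀-nice : ∀ i → Nice (X₀ i)
    X₀-nice (elem n θ) = elem-nice n θ
    X₀-nice (psi n ε) = record { mono = λ κ {z} → Psi.mono' ε κ {z} ; total = Psi.total' ε }

    X-nice : ∀ i → Nice (X i)
    X-nice i = close-nice (names i) (X₀-nice i)

    allX-nice : ∀ l → Nice (allX l)
    mono (allX-nice []) κ p h = λ x → x
    total (allX-nice []) κ x = return (0# , λ z y → y)
    mono (allX-nice (i ∷ l)) κ p h k = h λ a b → k (mono (X-nice i) κ p a) (mono (allX-nice l) κ p b)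
    total (allX-nice (i ∷ l)) κ x = total (X-nice i) κ x >>= λ { (u , a) → total (allX-nice l) κ x >>= λ { (u' , b) → max u u' >>= λ { (w , p , q) →
      return (w , λ z → andI (mono (X-nice i) κ p (a z)) (mono (allX-nice l) κ q (b z))) } } }

    allX-∈ : ∀ {i l κ e} → i ∈ˡ l → PSat I κ e (allX l) → PSat I κ e (X i)
    allX-∈ {i} {_ ∷ l} (here refl) h = PSat-stable (λ b → I-stable b) (X i) λ n → h λ a _ → n a
    allX-∈ {i} {_ ∷ l} (there m) h = PSat-stable (λ b → I-stable b) (X i) λ n → h λ _ b → n (allX-∈ m b)

-- Consistency of the requirements on A, B and c

numeral : ℕ → Tm
numeral zero = zer
numeral (suc n) = numeral n ⊕ one

pairT : Tm → Tm → Tm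
pairT i w = (i ⊕ w) ⊗ (i ⊕ w) ⊕ i

toTm-bounded : ∀ {k} (t : PT (Fin 0) k) → NumBoundT k (toTm t)
toTm-bounded (v i) = toℕ<n i
toTm-bounded zr = tt
toTm-bounded on = tt
toTm-bounded (s ⊞ t) = toTm-bounded s , toTm-bounded t
toTm-bounded (s ⊠ t) = toTm-bounded s , toTm-bounded t

toFm-bounded : ∀ {k} (φ : PF (Fin 0) k) → NumBound k (toFm φ) × SetBound 2 (toFm φ)
toFm-bounded ff = tt , tt
toFm-bounded (s == t) = (toTm-bounded s , toTm-bounded t) , tt
toFm-bounded (s << t) = (toTm-bounded s , toTm-bounded t) , tt
toFm-bounded (mem t false) = toTm-bounded t , s≤s z≤n
toFm-bounded (mem t true) = toTm-bounded t , s≤s (s≤s z≤n)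
toFm-bounded (φ ⊃ ψ) = let a , b = toFm-bounded φ ; c , d = toFm-bounded ψ in (a , c) , (b , d)
toFm-bounded (all< t φ) = let a , b = toFm-bounded φ in
  ((s≤s z≤n , NumBoundT-subst (toTm t) (λ _ p → s≤s p) (toTm-bounded t)) , a) , ((tt , b))

module Axioms (Ψ : Fm) (dΨ : Π⁰ 3 Ψ) (nbΨ : NumBound 0 Ψ) (sbΨ : SetBound 2 Ψ) where
  open Families Ψ dΨ

  data AxI : Set where
    num : ℕ → AxI
    start keep square bdd : AxI
    clos : Idx → AxI

  -- number variable 0 is c, set variables 0 and 1 are A and B
  Ax : AxI → Fm
  Ax (num n) = numeral n ≺ var 0
  Ax start = pairT zer (var 0) ∈' 1
  Ax keep = ∀ⁿ (∀ⁿ (pairT (var 1) (var 0) ∈' 1 ⇒ pairT (var 1 ⊕ one) (var 0) ∈' 1))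
  Ax square = ∀ⁿ (∀ⁿ (pairT (var 1) (var 0) ∈' 1 ⇒ pairT (var 1 ⊕ one) ((var 0 ⊕ one) ⊗ (var 0 ⊕ one)) ∈' 1))
  Ax bdd = ∀ⁿ (∃ⁿ (∀ⁿ (pairT (var 2) (var 0) ∈' 1 ⇒ ¬' (var 1 ≺ var 0))))
  Ax (clos i) = ∀ⁿ (∀ⁿ (pairT (var 1) (var 0) ∈' 1 ⇒ ∃ⁿ (pairT (var 2 ⊕ one) (var 0) ∈' 1 ∧' ∀ⁿ (toFm (X i)))))

  G₀ : Fm → Set
  G₀ φ = Σ AxI λ a → φ ≡ Ax a

  numeral-bounded : ∀ n → NumBoundT 2 (numeral n)
  numeral-bounded zero = tt
  numeral-bounded (suc n) = numeral-bounded n , tt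

  private
    l0 : ∀ {n} → 0 <ℕ suc n
    l0 = s≤s z≤n
    l1 : ∀ {n} → 1 <ℕ suc (suc n)
    l1 = s≤s (s≤s z≤n)
    l2 : ∀ {n} → 2 <ℕ suc (suc (suc n))
    l2 = s≤s (s≤s (s≤s z≤n))

  Ax-bounded : ∀ a → Bounded 2 (Ax a)
  Ax-bounded (num n) = (numeral-bounded n , s≤s z≤n) , tt
  Ax-bounded start = (((tt , l0) , (tt , l0)) , tt) , l1
  Ax-bounded keep = ((((l1 , l0) , (l1 , l0)) , l1) , ((((l1 , tt) , l0) , ((l1 , tt) , l0)) , (l1 , tt))) , (s≤s (s≤s z≤n) , s≤s (s≤s z≤n))
  Ax-bounded square = ((((l1 , l0) , (l1 , l0)) , l1) , ((((l1 , tt) , sq) , ((l1 , tt) , sq)) , (l1 , tt))) , (s≤s (s≤s z≤n) , s≤s (s≤s z≤n))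
    where
    sq = ((l0 , tt) , (l0 , tt))
  Ax-bounded bdd = ((((((l2 , l0) , (l2 , l0)) , l2) , ((l1 , l0) , tt)) , tt) , tt) , (((s≤s (s≤s z≤n) , (tt , tt)) , tt) , tt)
  Ax-bounded (clos i) = ((((l1 , l0) , (l1 , l0)) , l1) ,
      (((((((l2 , tt) , l0) , ((l2 , tt) , l0)) , (l2 , tt)) , (NumBound-mono (toFm (X i)) (s≤s (s≤s (s≤s z≤n))) (proj₁ (toFm-bounded (X i))) , tt)) , tt) , tt) , tt) ,
      (s≤s (s≤s z≤n) , ((((s≤s (s≤s z≤n) , (proj₂ (toFm-bounded (X i)) , tt)) , tt) , tt) , tt))

  -- The part of the axioms that holds when `c` is the value of the numeral `N` and the columns are
  -- built for the conjunction over `l`.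
  Covered : ℕ → List Idx → AxI → Set
  Covered N l (num n) = n <ℕ N
  Covered N l (clos i) = i ∈ˡ l
  Covered N l _ = ⊤

  weaken : ∀ {N N' l} i → N ≤ℕ N' → ∀ {a} → Covered N l a → Covered N' (i ++ l) a
  weaken i p {num n} c = ℕₚ.<-≤-trans c p
  weaken i p {start} c = tt
  weaken i p {keep} c = tt
  weaken i p {square} c = tt
  weaken i p {bdd} c = tt
  weaken [] p {clos j} c = c
  weaken (x ∷ i) p {clos j} c = there (weaken i p {clos j} c)

  cover : ∀ L → Σ ℕ λ N → Σ (List Idx) λ l → All (Covered N l) L
  cover [] = 0 , [] , []
  cover (a ∷ L) with cover L
  cover (num n ∷ L) | N , l , c = N ⊔ suc n , l , ℕₚ.m≤n⊔m N (suc n) ∷ mapAll (λ {a} → weaken [] (ℕₚ.m≤m⊔n N (suc n)) {a}) c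
  cover (clos i ∷ L) | N , l , c = N , i ∷ l , here refl ∷ mapAll (λ {a} → weaken (i ∷ []) ℕₚ.≤-refl {a}) c
  cover (start ∷ L) | N , l , c = N , l , tt ∷ c
  cover (keep ∷ L) | N , l , c = N , l , tt ∷ c
  cover (square ∷ L) | N , l , c = N , l , tt ∷ c
  cover (bdd ∷ L) | N , l , c = N , l , tt ∷ c

  used : ∀ {T φ} → Loc T G₀ φ → List AxI
  used (hyp (a , _)) = a ∷ []
  used (thm _) = []
  used (app d e) = used d ++ used e

  used-sound : ∀ {T φ} (M : Model) → M ⊨ T → ∀ {ρ η} (d : Loc T G₀ φ) → All (λ a → Model.Sat M ρ η (Ax a)) (used d) → Model.Sat M ρ η φ
  used-sound M m (hyp (a , refl)) (h ∷ []) = h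
  used-sound M m (thm d) h = Model.sound M m d _ _
  used-sound M m (app d e) h = used-sound M m d (++⁻ˡ (used d) h) (used-sound M m e (++⁻ʳ (used d) h))

  module Finite (M : Model) (st : Strong M) (A : Model.S M)
    (hΨ : ∀ ρ η Y → Model.Sat M ρ (Y ◂ A ◂ η) Ψ) where
    open Model M
    open Interp M
    open Arithmetic M st A

    val-< : ∀ {ρ ρ'} m n → m <ℕ n → eval ρ (numeral m) < eval ρ' (numeral n)
    val-< {ρ} {ρ'} m (suc n) (s≤s p) with ℕₚ.m≤n⇒m<n∨m≡n p
    ... | inj₁ q = <-trans (val-< {ρ} {ρ'} m n q) x<x+1
    ... | inj₂ refl = <-resp (≈-reflexive m) ≈-refl x<x+1
      where
      ≈-reflexive : ∀ m → eval ρ' (numeral m) ≈ eval ρ (numeral m)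
      ≈-reflexive zero = ≈-refl
      ≈-reflexive (suc m) = +-cong (≈-reflexive m) ≈-refl

    hΨ' : ∀ Y → Sat (λ _ → 0#) (Y ◂ λ _ → A) Ψ
    hΨ' Y = proj₁ (Sat-bounded Ψ nbΨ sbΨ (λ _ ()) (λ { zero _ → refl ; (suc zero) _ → refl ; (suc (suc _)) (s≤s (s≤s ())) })) (hΨ (λ _ → 0#) (λ _ → A) Y)

    sat : ∀ N l → ∃ᶜ λ B → ∀ a → Covered N l a → Sat (eval (λ _ → 0#) (numeral N) ◂ λ _ → 0#) (A ◂ B ◂ λ _ → A) (Ax a)
    sat N l = columns-exist
        (λ B p h → proj₂ (PSat-mapC (allX l)) (Nice.mono (Truth.allX-nice M st A hΨ' B l) _ p (proj₁ (PSat-mapC (allX l)) h)))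
        (λ B x → Nice.total (Truth.allX-nice M st A hΨ' B l) _ x >>= λ { (u , h) → return (u , λ z → proj₂ (PSat-mapC (allX l)) (h z)) })
      >>= λ { (B , cols) → return (B , go B cols) }
      where
      c = eval (λ _ → 0#) (numeral N)
      κ₀ : Fin 0 → D
      κ₀ ()
      open Columns M st A c (mapC κ₀ (allX l))
      open Truth using (module Nice)
      go : ∀ B → IsColumns M A B c (mapC κ₀ (allX l)) → ∀ a → Covered N l a → Sat (c ◂ λ _ → 0#) (A ◂ B ◂ λ _ → A) (Ax a)
      go B cols (num n) p = val-< n N p
      go B cols start _ = IsColumns.start cols
      go B cols keep _ = IsColumns.keep cols
      go B cols square _ = IsColumns.square cols
      go B cols bdd _ i k = IsColumns.bounded-col cols i λ { (p , h) → k p h }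
      go B cols (clos i) m j x h k = IsColumns.closed cols j x h λ { (w , w∈ , g) → k w (andI w∈ λ z →
        proj₂ (Sat-toFm {κ = κ₀} {e = z ∷ w ∷ x ∷ []} (X i) refl refl (λ { zero → refl ; (suc zero) → refl ; (suc (suc zero)) → refl }) (λ ()))
          (Truth.allX-∈ M st A hΨ' B {κ = κ₀} m (proj₁ (PSat-mapC (allX l)) (g z)))) }

    -- Compactness at the level of derivations: only the axioms at the leaves have to be true in M,
    -- and there are finitely many.
    consistent : ∀ {T} → M ⊨ T → ¬ Loc T G₀ ⊥'
    consistent m d with cover (used d)
    ... | N , l , c = sat N l λ { (B , h) → used-sound M m d (mapAll (λ {a} → h a) c) }

-- The cut J as a model

module Cut (Ψ : Fm) (dΨ : Π⁰ 3 Ψ) (nbΨ : NumBound 0 Ψ) (sbΨ : SetBound 2 Ψ)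
  (M : Model) (st : Strong M) (ρ₀ : ℕ → Model.D M) (η₀ : ℕ → Model.S M)
  (sat : ∀ a → Model.Sat M ρ₀ η₀ (Axioms.Ax Ψ dΨ nbΨ sbΨ a)) where
  open Model M
  open Interp M
  open Families Ψ dΨ
  open Axioms Ψ dΨ nbΨ sbΨ

  A B : S
  A = η₀ 0
  B = η₀ 1
  c : D
  c = ρ₀ 0

  open Arithmetic M st A
  open Principles M st A B using (ind0; ind1; coll; I; I-stable; Sem; Sem-stable)

  ⟨_,_⟩ : D → D → D
  ⟨ i , w ⟩ = (i + w) * (i + w) + i

  val : ℕ → D
  val n = eval ρ₀ (numeral n)

  κ₀ : Fin 0 → D
  κ₀ ()

  closure : ∀ i j x → ⟨ j , x ⟩ ∈ B → ∃ᶜ λ w → (⟨ j + 1# , w ⟩ ∈ B) × ∀ z → PSat I κ₀ (z ∷ w ∷ x ∷ []) (X i)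
  closure i j x m k = sat (clos i) j x m λ w s → let p , q = andE ∈-stable (Π-stable λ _ → Sat-stable (toFm (X i))) s in
    k (w , p , λ z → proj₁ (Sat-toFm {κ = κ₀} {e = z ∷ w ∷ x ∷ []} (X i) refl refl (λ { zero → refl ; (suc zero) → refl ; (suc (suc zero)) → refl }) (λ ())) (q z))

  nested : ∀ {i j w} → i ≤ j → ⟨ i , w ⟩ ∈ B → ⟨ j , w ⟩ ∈ B
  nested {i} {j} {w} p m = ∈-stable (≤⇒∃ p >>= λ { (d , e) → return (∈-resp (cg e) (go d)) })
    where
    cg : ∀ {i j} → i ≈ j → ⟨ i , w ⟩ ≈ ⟨ j , w ⟩
    cg e = +-cong (*-cong (+-cong e ≈-refl) (+-cong e ≈-refl)) e
    go : ∀ d → ⟨ i + d , w ⟩ ∈ B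
    go = ind0 (mem (pairF (cst i ⊞ #0) (cst w)) true) (∈-resp (cg (≈-sym (+-idʳ i))) m)
      (λ d h → ∈-resp (cg (≈-sym (+-suc i d))) (sat keep (i + d) w h))

  val-≤ : ∀ {m n} → m ≤ℕ n → val m ≤ val n
  val-≤ {zero} p = 0≤
  val-≤ {suc m} {suc n} (s≤s p) = +-mono-≤ (val-≤ p) ≤-refl

  -- The column index is a natural number of the metatheory; this is where the cut becomes external
  -- to M.
  Below : D → ℕ × D → Set
  Below x (k , w) = (⟨ val k , w ⟩ ∈ B) × (x ≤ w)

  J : D → Set
  J x = ∃ᶜ (Below x)

  J-down : ∀ {x y} → x ≤ y → J y → J x
  J-down p h = h >>= λ { (kw , m , q) → return (kw , m , ≤-trans p q) }

  DJ : Set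
  DJ = Σ D J

  join₂ : ∀ {k w k' w'} → ⟨ val k , w ⟩ ∈ B → ⟨ val k' , w' ⟩ ∈ B →
    ∃ᶜ λ l → Σ D λ u → (⟨ val l , u ⟩ ∈ B) × (w ≤ u) × (w' ≤ u)
  join₂ {k} {w} {k'} {w'} m m' = ≤-total w w' >>= λ where
      (inj₁ p) → return (k ⊔ k' , w' , nested (val-≤ (ℕₚ.m≤n⊔m k k')) m' , p , ≤-refl)
      (inj₂ p) → return (k ⊔ k' , w , nested (val-≤ (ℕₚ.m≤m⊔n k k')) m , ≤-refl , p)

  bound-all : ∀ {n} (f : Fin n → DJ) → ∃ᶜ λ k → Σ D λ w → (⟨ val k , w ⟩ ∈ B) × ∀ i → proj₁ (f i) ≤ w
  bound-all {zero} f = return (0 , c , sat start , λ ())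
  bound-all {suc n} f = bound-all (λ i → f (suc i)) >>= λ { (k , w , m , b) → proj₂ (f zero) >>= λ { ((k' , w') , m' , p) →
    join₂ {k} {w} {k'} {w'} m m' >>= λ { (l , u , mu , q , q') → return (l , u , mu , λ { zero → ≤-trans p q' ; (suc i) → ≤-trans (b i) q }) } } }

  sq≥ : ∀ {w x} → x ≤ (w + 1#) * (w + 1#) → ∀ k → ⟨ val k , w ⟩ ∈ B → J x
  sq≥ {w} p k m = return ((suc k , (w + 1#) * (w + 1#)) , sat square (val k) w m , p)

  J-+ : ∀ {x y} → J x → J y → J (x + y)
  J-+ jx jy = jx >>= λ { ((k , w) , m , p) → jy >>= λ { ((k' , w') , m' , p') → join₂ {k} {w} {k'} {w'} m m' >>= λ { (l , u , mu , q , q') →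
    sq≥ (≤-trans (+-mono-≤ (≤-trans p q) (≤-trans p' q')) (≤-resp ≈-refl (solve 1 (λ u → u :+ u :+ (u :* u :+ con 1) := (u :+ con 1) :* (u :+ con 1)) ≈-refl u) (x≤x+y (u + u) _))) l mu } } }

  J-* : ∀ {x y} → J x → J y → J (x * y)
  J-* jx jy = jx >>= λ { ((k , w) , m , p) → jy >>= λ { ((k' , w') , m' , p') → join₂ {k} {w} {k'} {w'} m m' >>= λ { (l , u , mu , q , q') →
    sq≥ (≤-trans (*-mono-≤ (≤-trans p q) (≤-trans p' q')) (*-mono-≤ (x≤x+y u 1#) (x≤x+y u 1#))) l mu } } }

  J-1 : J 1#
  J-1 = sq≥ (≤-resp (+-idˡ 1#) (solve 1 (λ u → con 0 :+ con 1 :+ (u :* u :+ (u :+ u)) := (u :+ con 1) :* (u :+ con 1)) ≈-refl c) (x≤x+y (0# + 1#) (c * c + (c + c)))) 0 (sat start)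

  J-0 : J 0#
  J-0 = J-down 0≤ J-1

  c∈J : J c
  c∈J = return ((0 , c) , sat start , ≤-refl)

  PM : ∀ {k} → PF DJ k → Vec D k → Set
  PM φ e = PSat I proj₁ e φ

  PM-stable : ∀ {k} (φ : PF DJ k) {e} → Stable (PM φ e)
  PM-stable φ = PSat-stable (λ b → I-stable b) φ

  I-resp : RespI I
  I-resp false = ∈-resp
  I-resp true = ∈-resp

  ∃J : PF DJ 2 → D → Set
  ∃J ε n = ∃ᶜ λ (w : DJ) → PM ε (proj₁ w ∷ n ∷ [])

  -- The two formulas need to be complementary only over J; with witnesses sought in all of M they
  -- may overlap or leave gaps.
  record SJ : Set where
    field
      ε : Bool → PF DJ 2
      decides : ∀ (n : DJ) → (¬ ∃J (ε true) (proj₁ n)) ⟺ ∃J (ε false) (proj₁ n)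
  open SJ

  JM : Model
  JM = record
    { D = DJ ; S = SJ
    ; _≈_ = λ x y → proj₁ x ≈ proj₁ y ; _<_ = λ x y → proj₁ x < proj₁ y
    ; _∈_ = λ n Y → ∃J (ε Y true) (proj₁ n)
    ; 0# = 0# , J-0 ; 1# = 1# , J-1
    ; _+_ = λ x y → proj₁ x + proj₁ y , J-+ (proj₂ x) (proj₂ y)
    ; _*_ = λ x y → proj₁ x * proj₁ y , J-* (proj₂ x) (proj₂ y)
    ; ≈-stable = ≈-stable ; <-stable = <-stable ; ∈-stable = ¬-stable
    ; ≈-refl = ≈-refl ; ≈-euc = ≈-euc ; +-cong = +-cong ; *-cong = *-cong ; <-resp = <-resp
    ; ∈-resp = λ {x} {x'} {Y} p h → h >>= λ { (w , s) → return (w , proj₁ (PSat-resp I-resp (λ { zero → ≈-refl ; (suc zero) → p }) (ε Y true)) s) }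
    }

  module Jm = Model JM
  module Ji = Interp JM

  IJ : Bool → DJ → Set
  IJ b x = I b (proj₁ x)

  ⟦⟧-J : ∀ {C k} (κ : C → DJ) (e : Vec DJ k) t → proj₁ (Ji.⟦ t ⟧ κ e) ≡ ⟦ t ⟧ (λ c → proj₁ (κ c)) (map proj₁ e)
  ⟦⟧-J κ e (v i) = sym (lookup-map i proj₁ e)
  ⟦⟧-J κ e (cst c) = refl
  ⟦⟧-J κ e zr = refl
  ⟦⟧-J κ e on = refl
  ⟦⟧-J κ e (s ⊞ t) = cong₂ _+_ (⟦⟧-J κ e s) (⟦⟧-J κ e t)
  ⟦⟧-J κ e (s ⊠ t) = cong₂ _*_ (⟦⟧-J κ e s) (⟦⟧-J κ e t)

  -- J is an initial segment, so a bounded quantifier with its bound in J has the same range in J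
  -- and in M.
  absolute : ∀ {C k} (κ : C → DJ) (e : Vec DJ k) φ → Ji.PSat IJ κ e φ ⟺ PSat I (λ c → proj₁ (κ c)) (map proj₁ e) φ
  absolute κ e ff = ⟺-refl
  absolute κ e (s == t) = ≡⇒⟺ (cong₂ _≈_ (⟦⟧-J κ e s) (⟦⟧-J κ e t))
  absolute κ e (s << t) = ≡⇒⟺ (cong₂ _<_ (⟦⟧-J κ e s) (⟦⟧-J κ e t))
  absolute κ e (mem t b) = ≡⇒⟺ (cong (I b) (⟦⟧-J κ e t))
  absolute κ e (φ ⊃ ψ) = →-cong (absolute κ e φ) (absolute κ e ψ)
  absolute κ e (all< t φ) =
    (λ h d p → let p' = subst (d <_) (sym (⟦⟧-J κ e t)) p ; d' = d , J-down (<⇒≤ p') (proj₂ (Ji.⟦ t ⟧ κ e)) in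
      proj₁ (absolute κ (d' ∷ e) φ) (h d' p')) ,
    (λ h d p → proj₂ (absolute κ (d ∷ e) φ) (h (proj₁ d) (subst (proj₁ d <_) (⟦⟧-J κ e t) p)))

  -- All parameters lie below one member `w` of some column `k`, so the requirement `elem` at `w`
  -- speaks about them, and the bound that it gives lies in column `suc k`, hence in J.
  elementary : (θ : PF DJ 1) → Σ D (λ y → PM θ (y ∷ [])) → ∃ᶜ λ (y : DJ) → PM θ (proj₁ y ∷ [])
  elementary θ (y , h) with finF θ
  ... | fin {n} f θ' refl = bound-all f >>= λ { (k , w , m , b) → closure (elem n θ') (val k) w m >>= λ { (w' , m' , g) →
      -- The choice `z = y + 1` lets the premise of `elem` see the given `y`.
      ex-e (Use.close-use M I n (X₀ (elem n θ')) (g (y + 1#)) (λ i → proj₁ (f i)) (λ i → ≤⇒<+1 (b i))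
        (ex-i (return (y , x<x+1 , proj₂ (eq y _ _ _) h))))
      >>= λ { (y' , y'<w' , s) → return ((y' , return ((suc k , w') , m' , <⇒≤ y'<w')) , proj₁ (eq y' _ _ _) s) } } }
    where
    eq : ∀ y z u x → PSat I (λ i → proj₁ (f i)) (y ∷ z ∷ u ∷ x ∷ []) (sub (lookup (#0 ∷ [])) cst θ') ⟺ PM (mapC f θ') (y ∷ [])
    eq y z u x = ⟺-trans (PSat-sub θ' (λ { zero → refl }) (λ _ → refl)) (⟺-sym (PSat-mapC θ'))

  elementary₂ : (θ : PF DJ 2) (x : DJ) → Σ D (λ y → PM θ (y ∷ proj₁ x ∷ [])) → ∃J θ (proj₁ x)
  elementary₂ θ x (y , h) = elementary (sub (lookup (#0 ∷ cst x ∷ [])) cst θ) (y , proj₂ (eq y) h) >>= λ { (y , s) → return (y , proj₁ (eq (proj₁ y)) s) }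
    where
    eq : ∀ y → PM (sub (lookup (#0 ∷ cst x ∷ [])) cst θ) (y ∷ []) ⟺ PM θ (y ∷ proj₁ x ∷ [])
    eq y = PSat-sub θ (λ { zero → refl ; (suc zero) → refl }) (λ _ → refl)

  -- By elementarity a Σ⁰₁ fact about an element of J holds in J once it holds in M, so the
  -- induction is carried out in M, guarded by `x ≤ a`.
  indJ : (θ : PF DJ 2) → ∃J θ 0# → (∀ (x : DJ) → ∃J θ (proj₁ x) → ∃J θ (proj₁ x + 1#)) → ∀ (x : DJ) → ∃J θ (proj₁ x)
  indJ θ base step (a , ja) = ind1 (neg (cst a << #1) ⊃ mapC proj₁ θ)
      (base >>= λ { (w , h) → return (proj₁ w , λ _ → proj₂ (PSat-mapC θ) h) })
      (λ x h → lem {A = x < a} >>= λ where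
        (inj₂ x≮a) → return (0# , λ q → ⊥-elim (x≮a (+1≤⇒< q)))
        (inj₁ x<a) → let x' = x , J-down (<⇒≤ x<a) ja in h >>= λ { (w , s) →
          elementary₂ θ x' (w , proj₁ (PSat-mapC θ) (s (<⇒≤ x<a))) >>= λ h' → step x' (return h') >>= λ { (w , s) → return (proj₁ w , λ _ → proj₂ (PSat-mapC θ) s) } }) a
    >>= λ { (w , s) → elementary₂ θ (a , ja) (w , proj₁ (PSat-mapC θ) (s ≤-refl)) }

  -- Here `c` must be nonstandard: every column of standard index is contained in column `c`, which
  -- is bounded in M.
  above : ∃ᶜ λ b → ∀ x → J x → x ≤ b
  above k = sat bdd c λ p h → k (p , λ x jx p<x → jx λ { ((l , w) , m , x≤w) →
    h w (nested (<⇒≤ (sat (num l))) m) (<-≤-trans p<x x≤w) })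

  -- Overspill. `χ` says that some `i < m` has all `j < n` refuted below `w`. If J had no bound to
  -- offer, `∃w χ` would hold for every `n` in J, while elementarity excludes it for every `n` above
  -- J. Being Σ⁰₁ in M, it would spread by `ind1` to all `n`, against `above`.
  collJ : (θ : PF DJ 3) → ∀ (m : DJ) →
    (∀ (i : DJ) → proj₁ i < proj₁ m → ∃ᶜ λ (j : DJ) → ∀ (z : DJ) → PM θ (proj₁ z ∷ proj₁ j ∷ proj₁ i ∷ [])) →
    ∃ᶜ λ (n : DJ) → ∀ (i : DJ) → proj₁ i < proj₁ m → ∃ᶜ λ (j : DJ) → (proj₁ j < proj₁ n) × ∀ (z : DJ) → PM θ (proj₁ z ∷ proj₁ j ∷ proj₁ i ∷ [])
  collJ θ (m , jm) h no = above λ { (b , ub) → all b λ { (w , s) → high b ub w s } }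
    where
    θD : PF D 3
    θD = mapC proj₁ θ
    θ₅ : PF D 5
    θ₅ = sub (lookup (#0 ∷ #1 ∷ #2 ∷ [])) cst θD
    -- environment: w, n
    χ : PF D 2
    χ = ex< (cst m) (all< #2 (ex< #2 (neg θ₅)))
    eq : ∀ z j i w n → Sem θ₅ (z ∷ j ∷ i ∷ w ∷ n ∷ []) ⟺ PM θ (z ∷ j ∷ i ∷ [])
    eq z j i w n = ⟺-trans (PSat-sub θD (λ { zero → refl ; (suc zero) → refl ; (suc (suc zero)) → refl }) (λ _ → refl)) (PSat-mapC θ)
    low : ∀ n → J n → ∃ᶜ λ w → Sem χ (w ∷ n ∷ [])
    low n jn k = no ((n , jn) , λ { (i , ji) i<m no' → coll (neg (θi i)) n
        (λ j j<n k' → no' ((j , J-down (<⇒≤ j<n) jn) , j<n , λ { (z , jz) → PM-stable θ λ nθ → k' (z , λ y e → nθ (proj₁ (eq' i y z j) e)) }))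
        λ { (w , g) → k (w , ex-i (return (i , i<m , λ j j<n → ex-i (g j j<n >>= λ { (z , z<w , s) →
          return (z , z<w , λ e → s 0# (proj₂ (eq' i 0# z j) (proj₁ (eq z j i w n) e))) })))) } })
      where
      θi : D → PF D 3
      θi i = sub (lookup (#1 ∷ #2 ∷ cst i ∷ [])) cst θD
      eq' : ∀ i y z j → Sem (θi i) (y ∷ z ∷ j ∷ []) ⟺ PM θ (z ∷ j ∷ i ∷ [])
      eq' i y z j = ⟺-trans (PSat-sub θD (λ { zero → refl ; (suc zero) → refl ; (suc (suc zero)) → refl }) (λ _ → refl)) (PSat-mapC θ)
    high : ∀ n → (∀ x → J x → x ≤ n) → ∀ w → ¬ Sem χ (w ∷ n ∷ [])
    high n ub w s = ex-e s λ { (i , i<m , f) → let i' = i , J-down (<⇒≤ i<m) jm in h i' i<m λ { ((j , jj) , g) →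
      ex-e (f j (<-≤-trans x<x+1 (ub (j + 1#) (J-+ jj J-1)))) λ { (z , _ , nθ) →
        elementary (neg (sub (lookup (#0 ∷ cst (j , jj) ∷ cst i' ∷ [])) cst θ)) (z , λ e → nθ (proj₂ (eq z j i w n) (proj₁ (eq'' (j , jj) i' z) e)))
          λ { (z' , nθ') → nθ' (proj₂ (eq'' (j , jj) i' (proj₁ z')) (g z')) } } } }
      where
      eq'' : ∀ (j i : DJ) z → PM (sub (lookup (#0 ∷ cst j ∷ cst i ∷ [])) cst θ) (z ∷ []) ⟺ PM θ (z ∷ proj₁ j ∷ proj₁ i ∷ [])
      eq'' j i z = PSat-sub θ (λ { zero → refl ; (suc zero) → refl ; (suc (suc zero)) → refl }) (λ _ → refl)
    all : ∀ n → ∃ᶜ λ w → Sem χ (w ∷ n ∷ [])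
    all = ind1 χ (low 0# J-0) (λ n hn → hn >>= λ { (w , s) → lem {A = Σ D λ x → J x × n < x} >>= λ where
      (inj₁ (x , jx , n<x)) → low (n + 1#) (J-+ (J-down (<⇒≤ n<x) jx) J-1)
      (inj₂ q) → ⊥-elim (high n (λ x jx n<x → q (x , jx , n<x)) w s) })

  frameJ : Frame JM IJ
  frameJ = record
    { I-stable = λ b → I-stable b ; x<x+1 = x<x+1 ; <-≤-trans = <-≤-trans ; <⇒≤ = <⇒≤
    ; collection = λ θ m h → collJ θ m (λ i p → h i p >>= λ { (j , s) → return (j , λ z → proj₁ (absolute (λ d → d) (z ∷ j ∷ i ∷ []) θ) (s z)) })
        >>= λ { (n , g) → return (n , λ i p → g i p >>= λ { (j , q , s) → return (j , q , λ z → proj₂ (absolute (λ d → d) (z ∷ j ∷ i ∷ []) θ) (s z)) }) } }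

  PJ : ∀ {k} → PF DJ k → Vec DJ k → Set
  PJ φ e = Ji.PSat IJ (λ d → d) e φ

  param : ∀ {k} → PT DJ k → (ℕ → DJ) → ℕ → PT DJ k
  param t ρ zero = t
  param t ρ (suc n) = cst (ρ n)

  module InJ (η : ℕ → SJ) where
    cs : Codes DJ
    cs X b = ε (η X) b

    ∃J⟺ : ∀ (θ : PF DJ 2) (n : DJ) → ∃J θ (proj₁ n) ⟺ (∃ᶜ λ w → PJ θ (w ∷ n ∷ []))
    ∃J⟺ θ n = (λ h → h >>= λ { (w , s) → return (w , proj₂ (absolute (λ d → d) (w ∷ n ∷ []) θ) s) }) ,
      (λ h → h >>= λ { (w , s) → return (w , proj₁ (absolute (λ d → d) (w ∷ n ∷ []) θ) s) })

    open Stage JM frameJ (λ d → d) cs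
    open Correct η (λ X n → ∃J⟺ (cs X true) n) (λ X n → ⟺-trans (decides (η X) n) (∃J⟺ (cs X false) n))

    rep : ∀ {k} {e : Vec DJ k} {t ρ} x → Ji.⟦ t ⟧ (λ d → d) e ≡ x → Represents e (param t ρ) (x ◂ ρ)
    rep x p = represents λ { zero → p ; (suc n) → refl }

    Σ1⟺ : ∀ {φ} (d : Σ⁰ 1 φ) ρ (n : DJ) → Jm.Sat (n ◂ ρ) η φ ⟺ ∃J (trΣ1 cs (param #1 ρ) #0 d) (proj₁ n)
    Σ1⟺ {φ} d ρ n = ⟺-trans
      ((λ s → Σ1-complete d (n ∷ []) (param #0 ρ) (rep n refl) s >>= λ { (W , h) → return (W , h _ (W ∷ n ∷ []) _ #0 (rep n refl) ≤-refl) }) ,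
       (λ h → Jm.Sat-stable φ (h >>= λ { (W , s) → return (Σ1-sound d (rep n refl) s) })))
      (⟺-sym (∃J⟺ (trΣ1 cs (param #1 ρ) #0 d) n))

    Π1⟺ : ∀ {φ} (d : Π⁰ 1 φ) ρ (n : DJ) → (¬ Jm.Sat (n ◂ ρ) η φ) ⟺ ∃J (neg (trΠ1 cs (param #1 ρ) #0 d)) (proj₁ n)
    Π1⟺ {φ} d ρ n = ⟺-trans
      ((λ ns k → ns (Π1-sound d (n ∷ []) (param #0 ρ) (rep n refl) λ W → P-stable (trΠ1 cs (λ m → wkP (param #0 ρ m)) #0 d)
          λ nh → k (W , λ h → nh (Π1-anti d #0 #0 (rep n refl) (rep-wk W (rep n refl)) ≤-refl h)))) ,
       (λ h s → h λ { (W , nh) → nh (Π1-complete d #0 (rep n refl) s) }))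
      (⟺-sym (∃J⟺ (neg (trΠ1 cs (param #1 ρ) #0 d)) n))

    induction : ∀ {φ} → Σ⁰ 1 φ → ∀ ρ → Jm.Sat ρ η (indAx φ)
    induction {φ} d ρ h x = proj₂ (Σ1⟺ d ρ x) (indJ θ (proj₁ (Σ1⟺ d ρ Jm.0#) base) (λ y s → proj₁ (Σ1⟺ d ρ (y Jm.+ Jm.1#)) (step y (proj₂ (Σ1⟺ d ρ y) s))) x)
      where
      θ = trΣ1 cs (param #1 ρ) #0 d
      bs = andE (Jm.Sat-stable (inst zer φ) {ρ} {η}) (Π-stable λ y → →-stable (Jm.Sat-stable (substN succσ φ) {y ◂ ρ} {η})) h
      base : Jm.Sat (Jm.0# ◂ ρ) η φ
      base = proj₁ (Jm.Sat-subst φ λ { zero → refl ; (suc n) → refl }) (proj₁ bs)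
      step : ∀ y → Jm.Sat (y ◂ ρ) η φ → Jm.Sat ((y Jm.+ Jm.1#) ◂ ρ) η φ
      step y s = proj₁ (Jm.Sat-subst φ λ { zero → refl ; (suc n) → refl }) (proj₂ bs y s)

    bounding : ∀ {φ} → Σ⁰ 2 φ → ∀ ρ → Jm.Sat ρ η (bndAx φ)
    -- What is collected is not the witness but a bound `t` for it, which gives `F` the form ∀z of a
    -- Δ₀ formula; `Σ2-witness` recovers a witness below `t`, hence below `n`.
    bounding {φ} d ρ h m k = Frame.collection frameJ F m
        (λ i _ → Σ2-complete (s∃ d) {i ◂ ρ} (h i) >>= λ { (U , g) → return (U , λ z → g _ (z ∷ U ∷ i ∷ []) _ #1 #0 (rep-wk z (rep i refl)) ≤-refl) })
      λ { (n , g) → k n λ i i<m k' → g i i<m λ { (t , t<n , s) →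
        Σ2-witness d (t ∷ i ∷ []) (param #1 ρ) #0 (rep i refl) s λ { (j , j<t , sj) →
          k' j (andI (<-trans j<t t<n) (proj₂ (Jm.Sat-subst φ (λ { zero → refl ; (suc zero) → refl ; (suc (suc n)) → refl })) sj)) } } }
      where
      F : PF DJ 3
      F = trΣ2 cs (λ n → wkP (param #1 ρ n)) (wkP #0) #0 (s∃ d)

    comprehension : ∀ {φ ψ} → Σ⁰ 1 φ → Π⁰ 1 ψ → ∀ ρ → Jm.Sat ρ η (compAx φ ψ)
    comprehension {φ} {ψ} d d' ρ h k = k Y λ n → andI
        (λ i → proj₂ (Jm.Sat-ren φ λ _ → refl) (proj₂ (Σ1⟺ d ρ n) i))
        (λ s → proj₁ (Σ1⟺ d ρ n) (proj₁ (Jm.Sat-ren φ λ _ → refl) s))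
      where
      φψ : ∀ n → (Jm.Sat (n ◂ ρ) η φ → Jm.Sat (n ◂ ρ) η ψ) × (Jm.Sat (n ◂ ρ) η ψ → Jm.Sat (n ◂ ρ) η φ)
      φψ n = andE (→-stable (Jm.Sat-stable ψ)) (→-stable (Jm.Sat-stable φ)) (h n)
      Y : SJ
      ε Y true = trΣ1 cs (param #1 ρ) #0 d
      ε Y false = neg (trΠ1 cs (param #1 ρ) #0 d')
      decides Y n = ⟺-trans (¬-cong (⟺-sym (Σ1⟺ d ρ n))) (⟺-trans (¬-cong (φψ n)) (Π1⟺ d' ρ n))

  basicJ : ∀ {φ} → Basic φ → Jm.Valid φ
  basicJ b1 ρ η = suc≉0
  basicJ b2 ρ η = suc-inj
  basicJ b3 ρ η = +-idʳ _
  basicJ b4 ρ η = +-suc _ _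
  basicJ b5 ρ η = *-zeroʳ _
  basicJ b6 ρ η = *-suc _ _
  basicJ b7 ρ η = ≮0
  basicJ b8 ρ η = andI (λ p n → <-suc⁻ p n) <-suc⁺

  -- Truth of the sentence in J

  decidable-set : (b : Bool) → SJ
  ε (decidable-set b) true = mem #1 b
  ε (decidable-set b) false = neg (mem #1 b)
  decides (decidable-set b) n = (λ h → return (Jm.0# , λ i → h (return (Jm.0# , i)))) , (λ h h' → h λ { (_ , ni) → h' λ { (_ , i) → ni i } })

  Â B̂ : SJ
  Â = decidable-set false
  B̂ = decidable-set true

  module PsiJ (Y : SJ) {n} (f : Fin n → DJ) (ε' : Bool → PF (Fin n) 2) (eε : ∀ b → mapC f (ε' b) ≡ ε Y b) where

    P' : ∀ {k} → PF (Fin n) k → Vec DJ k → Set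
    P' φ e = Ji.PSat IJ f e φ

    Def : Bool → DJ → Set
    Def b m = ∃ᶜ λ w → P' (ε' b) (w ∷ m ∷ [])

    Y⟺ : ∀ b m → ∃J (ε Y b) (proj₁ m) ⟺ Def b m
    Y⟺ b m = (λ h → h >>= λ { (w , s) → return (w , proj₂ (eq w) s) }) , (λ h → h >>= λ { (w , s) → return (w , proj₁ (eq w) s) })
      where
      eq : ∀ w → P' (ε' b) (w ∷ m ∷ []) ⟺ PM (ε Y b) (proj₁ w ∷ proj₁ m ∷ [])
      eq w = subst (λ χ → P' (ε' b) (w ∷ m ∷ []) ⟺ PM χ (proj₁ w ∷ proj₁ m ∷ [])) (eε b)
        (⟺-trans (absolute f (w ∷ m ∷ []) (ε' b)) (⟺-sym (PSat-mapC (ε' b))))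

    open Frame frameJ using () renaming (max to maxJ)
    open Stage JM frameJ f (codes ε')

    hε : ∀ X m → (m Jm.∈ (Y ◂ λ _ → Â) X) ⟺ (∃ᶜ λ w → P' (codes ε' X true) (w ∷ m ∷ []))
    hε zero m = Y⟺ true m
    hε (suc X) m = ⟺-refl
    hδ : ∀ X m → (¬ (m Jm.∈ (Y ◂ λ _ → Â) X)) ⟺ (∃ᶜ λ w → P' (codes ε' X false) (w ∷ m ∷ []))
    hδ zero m = ⟺-trans (decides Y m) (Y⟺ false m)
    hδ (suc X) m = decides Â m

    open Correct (Y ◂ λ _ → Â) hε hδ

    at-sat : ∀ {k} b w m (e : Vec DJ k) → P' (at₂ (ε' b)) (w ∷ m ∷ e) ⟺ P' (ε' b) (w ∷ m ∷ [])
    at-sat b w m e = Ji.PSat-sub (ε' b) (λ { zero → refl ; (suc zero) → refl }) (λ _ → refl)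

    no-conflict : ∀ {z u x} → ¬ P' (conflict ε') (z ∷ u ∷ x ∷ [])
    no-conflict h = Ji.ex-e h λ { (m , _ , s) → s λ a b → Ji.ex-e a λ { (w , _ , t) → Ji.ex-e b λ { (w' , _ , t') →
      proj₂ (decides Y m) (proj₂ (Y⟺ false m) (return (w' , proj₁ (at-sat false w' m _) t'))) (proj₂ (Y⟺ true m) (return (w , proj₁ (at-sat true w m _) t))) } } }

    -- For a set of J every `m < u` is decided at some stage in J, and collection in J gives a stage
    -- `s` by which all of them are.
    decided : ∀ u → ∃ᶜ λ (s : DJ) → ∀ {z x} → proj₁ s ≤ proj₁ z → ¬ P' (undecided ε') (z ∷ u ∷ x ∷ [])
    decided u = Collect.coll1 JM frameJ f (ε' true ∨ᵖ ε' false) [] u (λ m _ → lem {A = Def true m} >>= λ where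
        (inj₁ t) → t >>= λ { (w , s) → return (w , orI (return (inj₁ s))) }
        (inj₂ n) → proj₁ (Y⟺ false m) (proj₁ (decides Y m) (λ t → n (proj₁ (Y⟺ true m) t))) >>= λ { (w , s) → return (w , orI (return (inj₂ s))) })
      >>= λ { (s , g) → return (s , λ {z} {x} s≤z h → Ji.ex-e h λ { (m , m<u , q) → g m m<u λ { (w , w<s , t) →
        q w (<-≤-trans w<s s≤z) λ nt nf → orE t λ { (inj₁ t) → nt (proj₂ (at-sat true w m _) t) ; (inj₂ t) → nf (proj₂ (at-sat false w m _) t) } } }) }

    F₃ : PF (Fin n) 3
    F₃ = trΠ3 (codes ε') (λ _ → zr) #2 #1 #0 dΨ

    -- Beyond the stage `s` of `decided`, and by `no-conflict`, only the disjunct about `Ψ` can be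
    -- the true one.
    resolve : ∀ u → ∃ᶜ λ (s : DJ) → ∀ z x → proj₁ s ≤ proj₁ z → P' (X₀ (psi n ε')) (z ∷ u ∷ x ∷ []) → P' F₃ (z ∷ u ∷ x ∷ [])
    resolve u = decided u >>= λ { (s , dec) → return (s , λ z x s≤z h → P-stable {e = z ∷ u ∷ x ∷ []} F₃
      (orE {P' (undecided ε') (z ∷ u ∷ x ∷ [])} {P' (conflict ε' ∨ᵖ F₃) (z ∷ u ∷ x ∷ [])} h >>= λ where
      (inj₁ h) → ⊥-elim (dec {z} {x} s≤z h)
      (inj₂ h) → orE {P' (conflict ε') (z ∷ u ∷ x ∷ [])} {P' F₃ (z ∷ u ∷ x ∷ [])} h >>= λ where
        (inj₁ h) → ⊥-elim (no-conflict {z} {u} {x} h)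
        (inj₂ h) → return h)) }

    Witnessed : DJ → Set
    Witnessed x = ∃ᶜ λ U → ∀ m (e : Vec DJ m) τ x' u z →
        Represents e τ (λ _ → Jm.0#) → Ji.⟦ x' ⟧ f e ≡ x → Ji.⟦ u ⟧ f e ≡ U → P' (trΠ3 (codes ε') τ x' u z dΨ) e

    transfer : ∀ (x y U Z : DJ) m (e : Vec DJ m) τ x' u z → Represents e τ (λ _ → Jm.0#) → Ji.⟦ x' ⟧ f e ≡ x → Ji.⟦ u ⟧ f e ≡ U →
      proj₁ x ≤ proj₁ y → proj₁ (Ji.⟦ z ⟧ f e) ≤ proj₁ Z → P' F₃ (Z ∷ U ∷ y ∷ []) → P' (trΠ3 (codes ε') τ x' u z dΨ) e
    transfer x y U Z m e τ x' u z r ex eu p q h =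
      Π3-mono dΨ {e = Z ∷ U ∷ y ∷ []} {e' = e} {τ = λ _ → zr} {τ' = τ} {ρ = λ _ → Jm.0#} #2 #1 #0 x' u z (represents λ _ → refl) r p' u' q h
      where
      p' : proj₁ (Ji.⟦ x' ⟧ f e) ≤ proj₁ y
      p' = subst (λ t → proj₁ t ≤ proj₁ y) (sym ex) p
      u' : proj₁ U ≤ proj₁ (Ji.⟦ u ⟧ f e)
      u' = subst (λ t → proj₁ U ≤ proj₁ t) (sym eu) ≤-refl

    module _ (x y U : DJ) (x≤y : proj₁ x ≤ proj₁ y) (body : ∀ z → P' (X₀ (psi n ε')) (z ∷ U ∷ y ∷ [])) where
      from-stage : ∀ (s : DJ) → (∀ z x → proj₁ s ≤ proj₁ z → P' (X₀ (psi n ε')) (z ∷ U ∷ x ∷ []) → P' F₃ (z ∷ U ∷ x ∷ [])) →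
        ∀ m (e : Vec DJ m) τ x' u z →
        Represents e τ (λ _ → Jm.0#) → Ji.⟦ x' ⟧ f e ≡ x → Ji.⟦ u ⟧ f e ≡ U → P' (trΠ3 (codes ε') τ x' u z dΨ) e
      from-stage s g m e τ x' u z r ex eu = P-stable {e = e} (trΠ3 (codes ε') τ x' u z dΨ) λ no →
        maxJ s (Ji.⟦ z ⟧ f e) λ { (Z , s≤Z , z≤Z) → no (transfer x y U Z m e τ x' u z r ex eu x≤y z≤Z (g Z y s≤Z (body Z))) }

      witnessed : Witnessed x
      witnessed no = resolve U λ { (s , g) → no (U , from-stage s g) }

    closed : ∀ (y U : DJ) → (∀ z → PSat I κ₀ (z ∷ proj₁ U ∷ proj₁ y ∷ []) (X (psi n ε'))) → (∀ i → proj₁ (f i) ≤ proj₁ y) →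
      ∀ z → P' (X₀ (psi n ε')) (z ∷ U ∷ y ∷ [])
    closed y U g b z = proj₂ (absolute f (z ∷ U ∷ y ∷ []) (X₀ (psi n ε')))
      (Use.close-use M I n (X₀ (psi n ε')) (g (proj₁ z)) (λ i → proj₁ (f i)) (λ i → ≤⇒<+1 (b i)))

    -- A column member `y` above `x` and above all parameters of the set is taken; the requirement
    -- `psi` at `y` puts `U` into the next column, hence into J.
    all-witnessed : ∀ x → Witnessed x
    all-witnessed x = bound-all f >>= λ { (k , w , mw , b) → proj₂ x >>= λ { ((k' , w') , mw' , x≤w') →
      join₂ {k} {w} {k'} {w'} mw mw' >>= λ { (l , y , my , w≤y , w'≤y) → closure (psi n ε') (val l) y my >>= λ { (U , mU , g) →
        witnessed x (y , return ((l , y) , my , ≤-refl)) (U , return ((suc l , U) , mU , ≤-refl)) (≤-trans x≤w' w'≤y)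
          (closed (y , return ((l , y) , my , ≤-refl)) (U , return ((suc l , U) , mU , ≤-refl)) g (λ i → ≤-trans (b i) w≤y)) } } } }

    holds : Jm.Sat (λ _ → Jm.0#) (Y ◂ λ _ → Â) Ψ
    holds = Π3-sound dΨ [] (λ _ → zr) Jm.0# (represents λ _ → refl) λ x _ → all-witnessed x

  sentenceJ : Jm.Valid (∃ˢ (∀ˢ Ψ))
  sentenceJ ρ η k = k Â λ Y → proj₁ (Jm.Sat-bounded Ψ nbΨ sbΨ (λ _ ()) (λ { zero _ → refl ; (suc zero) _ → refl ; (suc (suc _)) (s≤s (s≤s ())) })) (named Y (finF₂ (finF (ε Y true)) (finF (ε Y false))))
    where
    pick : ∀ {n} → PF (Fin n) 2 → PF (Fin n) 2 → Bool → PF (Fin n) 2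
    pick a b true = a
    pick a b false = b
    pick-≡ : ∀ Y {n} (f : Fin n → DJ) a b → mapC f a ≡ ε Y true → mapC f b ≡ ε Y false → ∀ t → mapC f (pick a b t) ≡ ε Y t
    pick-≡ Y f a b p q true = p
    pick-≡ Y f a b p q false = q
    named : ∀ Y → (Σ ℕ λ n → Σ (Fin n → DJ) λ f → Σ (PF (Fin n) 2) λ a → Σ (PF (Fin n) 2) λ b → (mapC f a ≡ ε Y true) × (mapC f b ≡ ε Y false)) →
      Jm.Sat (λ _ → Jm.0#) (Y ◂ λ _ → Â) Ψ
    named Y (n , f , a , b , p , q) = PsiJ.holds Y f (pick a b) (pick-≡ Y f a b p q)

  T : Theory
  T = (RCA₀ ∪ᵀ BΣ⁰ 2) ∪ᵀ ｛ ∃ˢ (∀ˢ Ψ) ｝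

  JM⊨T : JM ⊨ T
  JM⊨T (inj₁ (inj₁ (inj₁ (inj₁ b)))) = basicJ b
  JM⊨T (inj₁ (inj₁ (inj₁ (inj₂ (ind d))))) ρ η = InJ.induction η d ρ
  JM⊨T (inj₁ (inj₁ (inj₂ (comp d e)))) ρ η = InJ.comprehension η d e ρ
  JM⊨T (inj₁ (inj₂ (bnd d))) ρ η = InJ.bounding η d ρ
  JM⊨T (inj₂ refl) = sentenceJ

  -- Failure of IΣ⁰₂ in J

  -- "B_i is bounded" holds in J exactly of the standard i
  col : Fm
  col = ∃ⁿ (∀ⁿ (pairT (var 2) (var 0) ∈' 0 ⇒ ¬' (var 1 ≺ var 0)))

  col-Σ₂ : Σ⁰ 2 col
  col-Σ₂ = s∃ (sΠ (p∀ (pΣ (s0 (d⇒ (d∈ _ _) (d⇒ (d≺ _ _) d⊥))))))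

  Bdd : DJ → Set
  Bdd i = ∃ᶜ λ (y : DJ) → ∀ (w : DJ) → ⟨ proj₁ i , proj₁ w ⟩ ∈ B → proj₁ w ≤ proj₁ y

  col⟺ : ∀ ρ (i : DJ) → Jm.Sat (i ◂ ρ) (λ _ → B̂) col ⟺ Bdd i
  col⟺ ρ i = (λ h k → h λ y s → k (y , λ w m → s w (return (Jm.0# , m)))) ,
    (λ h k → h λ { (y , s) → k y λ w m p → m λ { (_ , m) → s w m p } })

  -- The bound that M gives need not lie in J. But if no element of J were a bound, column `k` would
  -- have members above every `y` by induction in M: any `y` reached lies below a member of the
  -- column, so it is in J and is exceeded again.
  standard-bdd : ∀ k (i : DJ) → proj₁ i ≤ val k → Bdd i
  standard-bdd k (i , ji) i≤k no = sat bdd (val k) λ p bp → climb (p + 1#) λ { (w , s) → let m , q = andE ∈-stable ¬-stable s in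
      bp w m (<-≤-trans x<x+1 q) }
    where
    χ : PF D 2
    χ = mem (pairF (cst (val k)) #0) true ∧ᵖ neg (#0 << #1)
    climb : ∀ y → ∃ᶜ λ w → Sem χ (w ∷ y ∷ [])
    climb = ind1 χ (return (c , andI (nested {0#} 0≤ (sat start)) 0≤)) (λ y h → h >>= λ { (w , s) → let m , q = andE ∈-stable ¬-stable s in
      lem {A = Σ DJ λ w → (⟨ i , proj₁ w ⟩ ∈ B) × (y < proj₁ w)} >>= λ where
        (inj₁ ((w , _) , m , y<w)) → return (w , andI (nested i≤k m) (<⇒+1≤ y<w))
        (inj₂ n) → ⊥-elim (no ((y , return ((k , w) , m , q)) , λ w m y<w → n (w , m , y<w))) })

  -- A bound in J lies below a member `w` of some column `k`. The square of `w + 1` exceeds the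
  -- bound and belongs to column `suc k`, so `k < i` would put it into column `i`.
  bdd-standard : ∀ (i : DJ) → Bdd i → ∃ᶜ λ k → proj₁ i ≤ val k
  bdd-standard (i , ji) h = h >>= λ { ((y , jy) , b) → jy >>= λ { ((k , w) , m , y≤w) → return (k , λ k<i →
    let w² = (w + 1#) * (w + 1#)
        m² = sat square (val k) w m in
    b (w² , return ((suc k , w²) , m² , ≤-refl)) (nested (<⇒+1≤ k<i) m²) (≤-<-trans y≤w
      (<-≤-trans x<x+1 (≤-resp ≈-refl (solve 1 (λ u → u :+ con 1 :+ (u :* u :+ u) := (u :+ con 1) :* (u :+ con 1)) ≈-refl w) (x≤x+y (w + 1#) (w * w + w)))))) } }

  -- The indices of bounded columns contain 0 and are closed under successor, yet omit `c`, which is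
  -- an element of J above all numerals.
  ¬IΣ₂ : ¬ Jm.Valid (indAx col)
  ¬IΣ₂ valid = bdd-standard ĉ (proj₁ (col⟺ ρ ĉ) (valid ρ (λ _ → B̂) (andI
      (proj₂ (col⟺ ρ Jm.0#) (standard-bdd 0 Jm.0# ≤-refl))
      (λ i s → proj₂ (col⟺ ρ (i Jm.+ Jm.1#)) (bdd-standard i (proj₁ (col⟺ ρ i) s) >>= λ { (k , i≤k) →
          standard-bdd (suc k) (i Jm.+ Jm.1#) (+-mono-≤ i≤k ≤-refl) }))) ĉ))
      λ { (k , c≤k) → c≤k (sat (num k)) }
    where
    ĉ : DJ
    ĉ = c , c∈J
    ρ : ℕ → DJ
    ρ _ = ĉ

-- The two term models combined

module _ (Ψ : Fm) (dΨ : Π⁰ 3 Ψ) (nbΨ : NumBound 0 Ψ) (sbΨ : SetBound 2 Ψ) where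
  private
    T : Theory
    T = (RCA₀ ∪ᵀ BΣ⁰ 2) ∪ᵀ ｛ ∃ˢ (∀ˢ Ψ) ｝

  strong : ProvesScheme T (IΣ⁰ 2) → ∀ M → M ⊨ T → Strong M
  strong pr M m = record
    { basic = λ b → m (inj₁ (inj₁ (inj₁ (inj₁ b))))
    ; indΣ₂ = λ d → Model.sound M m (pr _ (ind d))
    ; bndΣ₂ = λ d → m (inj₁ (inj₂ (bnd d)))
    ; compΔ₁ = λ d e → m (inj₁ (inj₁ (inj₂ (comp d e)))) }

  main : Consistent T → ¬ ProvesScheme T (IΣ⁰ 2)
  -- `H₀` yields `A`, and with it the consistency of all requirements; the cut is taken in the model
  -- of `H₁`, where the variables 0 and 1 name `c`, `A` and `B`. As the goal is falsity, the
  -- classical existence of `A` can be unpacked.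
  main con pr = H₀.model⊨T (inj₂ refl) (λ _ → zer) (λ _ → 0) λ A hA →
      let con₁ = Finite.consistent H₀.model (strong pr H₀.model H₀.model⊨T) A (λ ρ η Y → proj₁
            (Model.Sat-bounded H₀.model Ψ nbΨ sbΨ (λ _ ()) (λ { zero _ → refl ; (suc zero) _ → refl ; (suc (suc _)) (s≤s (s≤s ())) })) (hA Y)) H₀.model⊨T
      in absurd con₁
    where
    open Axioms Ψ dΨ nbΨ sbΨ
    module H₀ = Henkin T (λ _ → ⊥) 0 (λ ()) (λ d → con (Loc⇒⊢ d))
    G₀-bounded : ∀ {γ} → G₀ γ → Bounded 2 γ
    G₀-bounded (a , refl) = Ax-bounded a
    absurd : ¬ Loc T G₀ ⊥' → ⊥
    absurd con₁ = C.¬IΣ₂ (Model.sound C.JM C.JM⊨T (pr _ (ind C.col-Σ₂)))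
      where
      module H₁ = Henkin T G₀ 2 G₀-bounded con₁
      module C = Cut Ψ dΨ nbΨ sbΨ H₁.model (strong pr H₁.model H₁.model⊨T) var (λ n → n) (λ a → H₁.model⊨G₀ (a , refl))

theorem4p2 : (Ψ : Fm) → Π⁰ 3 Ψ → NumBound 0 Ψ → SetBound 2 Ψ →
    Consistent ((RCA₀ ∪ᵀ BΣ⁰ 2) ∪ᵀ ｛ ∃ˢ (∀ˢ Ψ) ｝) →
    ¬ ProvesScheme ((RCA₀ ∪ᵀ BΣ⁰ 2) ∪ᵀ ｛ ∃ˢ (∀ˢ Ψ) ｝) (IΣ⁰ 2)
theorem4p2 = main
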